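{- Let $L$ be a fixed graph and $H$ a finite, simple, connected graph. There are positive integer-valued functions $f,g,h$ of $(\varepsilon,H)$ such that for every $\varepsilon\in(0,1)$ and every $L$-minor-free graph $G$: if $G$ is $H$-free, then $\mathrm{RBE}(G,H,\varepsilon)$ accepts $G$; and if $G$ is $\varepsilon$-far from $H$-free, then $\mathrm{RBE}(G,H,\varepsilon)$ rejects $G$ with probability at least $0.99$.
   Context: $G$ is $L$-minor-free if $L$ cannot be obtained from $G$ by vertex deletions, edge deletions and edge contractions. Access to $G=(V,E)$, $V=\{1,\dots,n\}$, is via the random neighbor oracle: a query on $v$ returns a uniformly random neighbor of $v$, independently. $\mathrm{Traverse}(G,v,d,\ell)$: set $L_0=\{v\}$; for $j=1,\dots,\ell$, each $u\in L_{j-1}$ makes $d$ random neighbor queries obtaining $\Gamma_u$, recording edges $(u,x)$, $x\in\Gamma_u$; $L_j$ is the union of the $\Gamma_u$ minus earlier levels; return the subgraph of recorded edges. $\mathrm{RBE}(G,H,\varepsilon)$: repeat $f(\varepsilon,H)$ times: pick $v\in V$ uniformly at random, run $\mathrm{Traverse}(G,v,h(\varepsilon,H),g(\varepsilon,H))$, and reject if the returned subgraph contains a copy of $H$; otherwise accept. $G$ is $\varepsilon$-far from $H$-free if more than $\varepsilon|V|$ edges must be deleted to obtain a graph with no subgraph isomorphic to $H$. -}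

module Defs where

open import Data.Nat using (ℕ; zero; suc; _<ᵇ_)
open import Data.Fin using (Fin; toℕ; _≟_)
open import Data.Bool using (Bool; true; false; _∧_; if_then_else_; not)
open import Data.List using (List; []; _∷_; _++_; length; lookup; allFin; filterᵇ; deduplicateᵇ; map)
open import Data.Bool.ListAction using (any)
open import Data.Nat.ListAction using (sum)
open import Data.List.Membership.Propositional using (_∈_)
open import Data.List.Relation.Unary.Any using (Any)
open import Data.Maybe using (Maybe; just; nothing)
open import Data.Product using (Σ; ∃; _×_; _,_)
open import Data.Sum using (_⊎_)
open import Data.Unit using (⊤)
open import Data.Integer using (+_)
open import Data.Rational using (ℚ; _/_; _+_; _*_; 0ℚ; 1ℚ)
open import Relation.Nullary using (¬_; does)
open import Relation.Binary.PropositionalEquality using (_≡_)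
open import Function.Definitions using (Injective)

record Graph (n : ℕ) : Set where
  field
    adj    : Fin n → Fin n → Bool
    sym    : ∀ i j → adj i j ≡ adj j i
    irrefl : ∀ i → adj i i ≡ false
open Graph public

data Reach {n : ℕ} (G : Graph n) (P : Fin n → Set) : Fin n → Fin n → Set where
  here : ∀ {u} → Reach G P u u
  step : ∀ {u w v} → adj G u w ≡ true → P w → Reach G P w v → Reach G P u v

Connected : {k : ℕ} → Graph k → Set
Connected {k} H = Fin k × (∀ i j → Reach H (λ _ → ⊤) i j)

CopyOf : {k n : ℕ} → Graph k → Graph n → Set
CopyOf {k} {n} H G =
  Σ (Fin k → Fin n) λ φ → Injective _≡_ _≡_ φ ×
    (∀ i j → adj H i j ≡ true → adj G (φ i) (φ j) ≡ true)

Free : {k n : ℕ} → Graph k → Graph n → Set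
Free H G = ¬ CopyOf H G

-- L is a minor of G, via a minor model (branch sets):
-- branch v = just x means v lies in the branch set B_x (sets are disjoint
-- automatically); each B_x is nonempty and connected in G[B_x], and every
-- edge xy of L is realised by an edge of G between B_x and B_y.
IsMinor : {l n : ℕ} → Graph l → Graph n → Set
IsMinor {l} {n} L G =
  Σ (Fin n → Maybe (Fin l)) λ branch →
    (∀ x → ∃ λ v → branch v ≡ just x) ×
    (∀ x u v → branch u ≡ just x → branch v ≡ just x →
       Reach G (λ w → branch w ≡ just x) u v) ×
    (∀ x y → adj L x y ≡ true →
       ∃ λ u → ∃ λ v → branch u ≡ just x × branch v ≡ just y × adj G u v ≡ true)

MinorFree : {l n : ℕ} → Graph l → Graph n → Set
MinorFree L G = ¬ IsMinor L G

edgeCount : {n : ℕ} → Graph n → ℕ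
edgeCount {n} G =
  sum (map (λ i → sum (map (λ j → if (toℕ i <ᵇ toℕ j) ∧ adj G i j then 1 else 0)
                         (allFin n)))
           (allFin n))

_⊆E_ : {n : ℕ} → Graph n → Graph n → Set
G' ⊆E G = ∀ i j → adj G' i j ≡ true → adj G i j ≡ true

ℕtoℚ : ℕ → ℚ
ℕtoℚ m = (+ m) / 1

Far : {k n : ℕ} → ℚ → Graph k → Graph n → Set
Far {k} {n} ε H G =
  ∀ (G' : Graph n) → G' ⊆E G → Free H G' →
    Data.Rational._<_ (ε * ℕtoℚ n) (ℕtoℚ (edgeCount G Data.Nat.∸ edgeCount G'))

-- Randomised computations: trees of uniform choices

data Rand (A : Set) : Set where
  ret  : A → Rand A
  pick : (k : ℕ) → (Fin (suc k) → Rand A) → Rand A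

_>>=_ : {A B : Set} → Rand A → (A → Rand B) → Rand B
ret a    >>= f = f a
pick k g >>= f = pick k (λ i → g i >>= f)

uniform : {A : Set} → List A → Rand (Maybe A)
uniform []       = ret nothing
uniform (x ∷ xs) = pick (length xs) (λ i → ret (just (lookup (x ∷ xs) i)))

sumℚ : (m : ℕ) → (Fin m → ℚ) → ℚ
sumℚ zero    q = 0ℚ
sumℚ (suc m) q = q Fin.zero + sumℚ m (λ i → q (Fin.suc i))

data Mass {A : Set} (P : A → Set) : Rand A → ℚ → Set where
  leaf-yes : ∀ {a} → P a → Mass P (ret a) 1ℚ
  leaf-no  : ∀ {a} → ¬ P a → Mass P (ret a) 0ℚ
  node     : ∀ {k f} (q : Fin (suc k) → ℚ) → (∀ i → Mass P (f i) (q i)) →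
             Mass P (pick k f) (((+ 1) / suc k) * sumℚ (suc k) q)

data Always {A : Set} (P : A → Set) : Rand A → Set where
  leaf : ∀ {a} → P a → Always P (ret a)
  node : ∀ {k f} → (∀ i → Always P (f i)) → Always P (pick k f)

module _ {n : ℕ} (G : Graph n) where

  neighbours : Fin n → List (Fin n)
  neighbours u = filterᵇ (adj G u) (allFin n)

  randomNeighbour : Fin n → Rand (Maybe (Fin n))
  randomNeighbour u = uniform (neighbours u)

  queries : Fin n → ℕ → Rand (List (Fin n))
  queries u zero    = ret []
  queries u (suc d) = randomNeighbour u >>= λ
    { nothing  → queries u d
    ; (just x) → queries u d >>= λ xs → ret (x ∷ xs) }

  expand : ℕ → List (Fin n) → Rand (List (Fin n) × List (Fin n × Fin n))
  expand d []       = ret ([] , [])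
  expand d (u ∷ us) = queries u d >>= λ Γ → expand d us >>= λ
    { (ws , es) → ret (Γ ++ ws , map (λ x → (u , x)) Γ ++ es) }

  eqᵇ : Fin n → Fin n → Bool
  eqᵇ i j = does (i ≟ j)

  memᵇ : Fin n → List (Fin n) → Bool
  memᵇ x xs = any (eqᵇ x) xs

  traverseLoop : ℕ → ℕ → List (Fin n) → List (Fin n) → List (Fin n × Fin n) →
                 Rand (List (Fin n) × List (Fin n × Fin n))
  traverseLoop d zero    vis lvl es = ret (vis , es)
  traverseLoop d (suc ℓ) vis lvl es = expand d lvl >>= λ
    { (found , es′) →
        let new = filterᵇ (λ x → not (memᵇ x vis)) (deduplicateᵇ eqᵇ found)
        in traverseLoop d ℓ (vis ++ new) new (es ++ es′) }

  -- returns the explored subgraph: (its vertices L_0 ∪ … ∪ L_ℓ, its edges)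
  Traverse : Fin n → ℕ → ℕ → Rand (List (Fin n) × List (Fin n × Fin n))
  Traverse v d ℓ = traverseLoop d ℓ (v ∷ []) (v ∷ []) []

  RBE-runs : ℕ → ℕ → ℕ → Rand (List (List (Fin n) × List (Fin n × Fin n)))
  RBE-runs zero    d ℓ = ret []
  RBE-runs (suc t) d ℓ = uniform (allFin n) >>= λ
    { nothing  → ret []
    ; (just v) → Traverse v d ℓ >>= λ s → RBE-runs t d ℓ >>= λ ss → ret (s ∷ ss) }

ContainsCopy : {k n : ℕ} → Graph k → List (Fin n) × List (Fin n × Fin n) → Set
ContainsCopy {k} {n} H (vs , es) =
  Σ (Fin k → Fin n) λ φ → Injective _≡_ _≡_ φ × (∀ i → φ i ∈ vs) ×
    (∀ i j → adj H i j ≡ true → ((φ i , φ j) ∈ es) ⊎ ((φ j , φ i) ∈ es))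

Rejects : {k n : ℕ} → Graph k → List (List (Fin n) × List (Fin n × Fin n)) → Set
Rejects H runs = Any (ContainsCopy H) runs

{-# OPTIONS --safe #-}
module Submission where

{-
A graph that is far from H-free contains linearly many edge-disjoint copies Φ i of H, and after coloring
the vertices of G by those of H one may assume that Φ i u always has color u. Contract, for a connected
set D of vertices of H all of whose images determine Φ i q, the images of D into that of q: for a vertex w
next to D the pairs (Φ i q , Φ i w) form a minor of G, which is degenerate since G is L-minor-free. Hence on
a constant fraction of the copies Φ i q determines Φ i w, or vice versa. Repeating this, one arranges H in an
elimination forest in which every vertex determines its ancestors.

Next discard the copies through a vertex a whenever they are few compared to the degree of a. Then a random
neighbour of Φ i u is, with constant probability and for each edge uw of H, of the form Φ j w with
Φ j u = Φ i u. A walk inside a subtree of the forest preserves the images of the ancestors, even though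
it changes the copy at each step, so the search can pick up H from the root downwards, and the pieces of
different copies that it finds fit together. The coloring makes the result injective.
-}

open import Data.Nat using (ℕ; zero; suc; _+_; _*_; _≤_; _<_; z≤n; s≤s; _≤?_; _<?_; _^_; _∸_; _<ᵇ_; >-nonZero)
open import Data.Nat.Properties hiding (_≟_)
open import Data.Fin using (Fin; zero; suc; _≟_; toℕ; fromℕ<)
import Data.Fin.Properties as F
open import Data.Bool using (Bool; true; false; _∧_; if_then_else_; T; T?; not)
open import Data.Product using (Σ; ∃; _×_; _,_; proj₁; proj₂)
open import Data.Sum using (_⊎_; inj₁; inj₂)
open import Data.Empty using (⊥-elim)
open import Function using (_∘_)
open import Relation.Nullary using (¬_; Dec; yes; no; does)
open import Relation.Nullary.Decidable using (dec-true; dec-false; does-⇔; _×-dec_; _⊎-dec_; ¬?; map′; _→-dec_)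
open import Relation.Binary.PropositionalEquality renaming (sym to ≡-sym)
open import Algebra.Properties.Semiring.Sum +-*-semiring using (sum; ∑-distrib-+; ∑-comm; sum-cong-≗; *-distribˡ-sum; *-distribʳ-sum)
open import Defs
open import Data.Nat.Tactic.RingSolver using (solve-∀)
import Data.Bool as B
open import Data.Maybe using (Maybe; just; nothing)
import Data.Maybe as Maybe
open import Function.Bundles using (mk⇔; Equivalence)
open import Data.Nat.ListAction using () renaming (sum to sumᴸ)
open import Data.List using (map; tabulate; allFin; List; []; _∷_; _++_; length; lookup; filterᵇ; deduplicateᵇ)
open import Data.Vec.Functional using () renaming (_∷_ to _∷ᶠ_; [] to []ᶠ)
open import Function.Definitions using (Injective)
open import Data.Integer using (+_)
import Data.Integer as ℤ
import Data.Integer.Properties as ℤ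
open import Data.Rational using (ℚ; _/_; 0ℚ; 1ℚ)
import Data.Rational as ℚ
import Data.Rational.Properties as ℚ
open import Data.Rational.Solver using (module +-*-Solver)
import Data.Rational.Unnormalised as ℚᵘ
import Data.Rational.Unnormalised.Properties as ℚᵘ
open import Data.List.Properties using (length-++; length-filter)
open import Data.List.Membership.Propositional using (_∈_; find)
open import Data.List.Membership.Propositional.Properties using (∈-++⁺ˡ; ∈-++⁺ʳ; ∈-++⁻; ∈-map⁺; ∈-filter⁺; ∈-map⁻; ∈-filter⁻; ∈-lookup; ∈-allFin)
open import Data.List.Relation.Unary.Any using (here; there; any?)
open import Data.Bool.Properties using (T-≡)
import Data.List.Membership.DecPropositional as DecMembership
open import Data.Product.Properties using (≡-dec)
open import Data.Unit using (⊤)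

-- The obstacle is that an `L`-minor-free graph has bounded average degree but may have vertices of
-- huge degree. There a query hits a prescribed edge of a prescribed copy with vanishing
-- probability; the most one can hope for is an edge of some copy through the same vertex. So the
-- edges collected at different vertices stem from different copies, and a cycle of `H` followed in
-- this way need not close up. It does close if the image of the vertex just reached determines the
-- vertex to which the closing edge must lead, and this is what the dependencies are for. The order
-- of the reductions matters. Colors and dependencies pass to subfamilies, whereas the popularity
-- that the queries rely on does not, so pruning comes last. It is affordable because the sum of all
-- degrees is linear in `n`, while every earlier reduction keeps a constant fraction of linearly
-- many copies.

private variable
  l n m k : ℕ

-- Finite sums

does-true : ∀ {a} {A : Set a} (A? : Dec A) → does A? ≡ true → A
does-true (yes a) _ = a

true≢false : ∀ {b} → b ≡ true → b ≡ false → ∀ {a} {A : Set a} → A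
true≢false refl ()

¬true⇒false : ∀ {b} → ¬ (b ≡ true) → b ≡ false
¬true⇒false {true} h = ⊥-elim (h refl)
¬true⇒false {false} h = refl

byBool : ∀ {a} {A : Set a} b → (b ≡ true → A) → (b ≡ false → A) → A
byBool true t f = t refl
byBool false t f = f refl

bit : Bool → ℕ
bit true = 1
bit false = 0

bit≤1 : ∀ b → bit b ≤ 1
bit≤1 true = ≤-refl
bit≤1 false = z≤n

bit-mono : ∀ {a b} → (a ≡ true → b ≡ true) → bit a ≤ bit b
bit-mono {true} h rewrite h refl = ≤-refl
bit-mono {false} h = z≤n

count : ∀ {n} → (Fin n → Bool) → ℕ
count S = sum (λ i → bit (S i))

_⊑_ : ∀ {n} → (Fin n → Bool) → (Fin n → Bool) → Set
S ⊑ T = ∀ i → S i ≡ true → T i ≡ true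

sum-mono : ∀ {n} {f g : Fin n → ℕ} → (∀ i → f i ≤ g i) → sum f ≤ sum g
sum-mono {zero} h = z≤n
sum-mono {suc n} h = +-mono-≤ (h zero) (sum-mono (h ∘ suc))

sum-zero : ∀ n → sum {n} (λ _ → 0) ≡ 0
sum-zero zero = refl
sum-zero (suc n) = sum-zero n

sum-const : ∀ n c → sum {n} (λ _ → c) ≡ n * c
sum-const zero c = refl
sum-const (suc n) c = cong (λ z → c + z) (sum-const n c)

term≤sum : ∀ {n} (f : Fin n → ℕ) i → f i ≤ sum f
term≤sum f zero = m≤m+n _ _
term≤sum f (suc i) = ≤-trans (term≤sum (f ∘ suc) i) (m≤n+m _ _)

sum-select : ∀ {n} (i : Fin n) (f : Fin n → ℕ) → sum (λ j → bit (does (i F.≟ j)) * f j) ≡ f i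
sum-select {suc n} zero f = trans (cong₂ _+_ (+-identityʳ (f zero)) (sum-zero n)) (+-identityʳ (f zero))
sum-select {suc n} (suc i) f = sum-select i (f ∘ suc)

count-single : ∀ {n} (i : Fin n) → sum (λ j → bit (does (i F.≟ j))) ≡ 1
count-single {n} i = trans (sum-cong-≗ {n} λ j → ≡-sym (*-identityʳ _)) (sum-select i (λ _ → 1))

count-mono : ∀ {n} {S T : Fin n → Bool} → S ⊑ T → count S ≤ count T
count-mono h = sum-mono λ i → bit-mono (h i)

count-mono-< : ∀ {n} {S T : Fin n → Bool} → S ⊑ T → ∀ i → S i ≡ false → T i ≡ true → count S < count T
count-mono-< {suc n} {S} {T} h zero p q rewrite p | q = s≤s (count-mono (h ∘ suc))
count-mono-< {suc n} {S} {T} h (suc i) p q =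
  ≤-trans (≤-reflexive (≡-sym (+-suc _ _))) (+-mono-≤ (bit-mono (h zero)) (count-mono-< (h ∘ suc) i p q))

count≤n : ∀ {n} (S : Fin n → Bool) → count S ≤ n
count≤n {n} S = ≤-trans (sum-mono {g = λ _ → 1} λ i → bit≤1 (S i)) (≤-reflexive (trans (sum-const n 1) (*-identityʳ n)))

0<count : ∀ {n} (S : Fin n → Bool) i → S i ≡ true → 0 < count S
0<count S i p = ≤-trans (≤-reflexive (cong bit (≡-sym p))) (term≤sum (bit ∘ S) i)

0<sum⇒ : ∀ {n} (f : Fin n → ℕ) → 0 < sum f → ∃ λ i → 0 < f i
0<sum⇒ {suc n} f h with f zero in eq
... | suc x = zero , ≤-trans (s≤s z≤n) (≤-reflexive (≡-sym eq))
... | zero with 0<sum⇒ (f ∘ suc) h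
...   | i , p = suc i , p

0<count⇒ : ∀ {n} (S : Fin n → Bool) → 0 < count S → ∃ λ i → S i ≡ true
0<count⇒ S h with 0<sum⇒ (bit ∘ S) h
... | i , p with S i in eq
...   | true = i , eq

sum-mono-< : ∀ {n} {f g : Fin n → ℕ} → 0 < n → (∀ i → f i < g i) → sum f < sum g
sum-mono-< {suc n} _ h = +-mono-<-≤ (h zero) (sum-mono (λ i → <⇒≤ (h (suc i))))

exceeds-somewhere : ∀ {n} (f g : Fin n → ℕ) → 0 < n → sum g ≤ sum f → ∃ λ i → g i ≤ f i
exceeds-somewhere f g 0<n h with F.any? (λ i → g i ≤? f i)
... | yes p = p
... | no ¬p = ⊥-elim (<⇒≱ (sum-mono-< 0<n λ i → ≰⇒> λ q → ¬p (i , q)) h)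

popular-value : ∀ {n c} (f : Fin n → ℕ) (nb : Fin n → Bool) → 0 < n → count nb ≤ c →
  (∀ y → 0 < f y → nb y ≡ true) → ∃ λ y → sum f ≤ c * f y
popular-value {n} {c} f nb 0<n nb≤c supp with max f 0<n
  where
  max : ∀ {n} (f : Fin n → ℕ) → 0 < n → ∃ λ y → ∀ x → f x ≤ f y
  max {suc zero} f _ = zero , λ { zero → ≤-refl }
  max {suc (suc n)} f _ with max (f ∘ suc) (s≤s z≤n)
  ... | y , h with f zero ≤? f (suc y)
  ...   | yes p = suc y , λ { zero → p ; (suc x) → h x }
  ...   | no p = zero , λ { zero → ≤-refl ; (suc x) → ≤-trans (h x) (<⇒≤ (≰⇒> p)) }
... | y , h = y , (begin
    sum f                         ≤⟨ sum-mono pointwise ⟩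
    sum (λ x → bit (nb x) * f y)  ≡⟨ *-distribʳ-sum (f y) (bit ∘ nb) ⟨
    count nb * f y                ≤⟨ *-monoˡ-≤ (f y) nb≤c ⟩
    c * f y                       ∎)
  where
  open ≤-Reasoning
  pointwise : ∀ x → f x ≤ bit (nb x) * f y
  pointwise x with f x in eq
  ... | zero = z≤n
  ... | suc k rewrite supp x (≤-trans (s≤s z≤n) (≤-reflexive (≡-sym eq))) =
    ≤-trans (≤-reflexive (≡-sym eq)) (≤-trans (h x) (≤-reflexive (≡-sym (+-identityʳ _))))

enumerate : ∀ {m} (S : Fin m → Bool) → Σ (Fin (count S) → Fin m) λ e →
  (∀ j → S (e j) ≡ true) × (∀ i j → e i ≡ e j → i ≡ j)
enumerate {zero} S = (λ ()) , (λ ()) , λ ()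
enumerate {suc m} S with S zero in eq | enumerate (S ∘ suc)
... | false | e , ok , inj = suc ∘ e , ok , λ i j p → inj i j (F.suc-injective p)
... | true  | e , ok , inj = e′ , ok′ , inj′
  where
  e′ : Fin (suc (count (S ∘ suc))) → Fin (suc m)
  e′ zero = zero
  e′ (suc j) = suc (e j)
  ok′ : ∀ j → S (e′ j) ≡ true
  ok′ zero = eq
  ok′ (suc j) = ok j
  inj′ : ∀ i j → e′ i ≡ e′ j → i ≡ j
  inj′ zero zero _ = refl
  inj′ (suc i) (suc j) p = cong suc (inj i j (F.suc-injective p))

-- Clique minors of dense graphs

fromRel : {R : Fin n → Fin n → Set} → (∀ x y → Dec (R x y)) →
  (∀ {x y} → R x y → R y x) → (∀ {x} → ¬ R x x) → Graph n
fromRel R? R-sym R-irrefl = record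
  { adj = λ x y → does (R? x y)
  ; sym = λ x y → does-⇔ (mk⇔ R-sym R-sym) (R? x y) (R? y x)
  ; irrefl = λ x → dec-false (R? x x) R-irrefl }

adj-sym : (G : Graph n) → ∀ {x y} → adj G x y ≡ true → adj G y x ≡ true
adj-sym G {x} {y} p = trans (Graph.sym G y x) p

adj⇒≢ : (G : Graph n) → ∀ {x y} → adj G x y ≡ true → x ≢ y
adj⇒≢ G p refl = true≢false p (irrefl G _)

deg : Graph n → Fin n → ℕ
deg G x = sum (λ y → bit (adj G x y))

degreeSum : Graph n → ℕ
degreeSum G = sum (deg G)

Reach-trans : {G : Graph n} {P : Fin n → Set} → ∀ {x y z} → Reach G P x y → Reach G P y z → Reach G P x z
Reach-trans here r = r
Reach-trans (step a p s) r = step a p (Reach-trans s r)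

Reach-map : {G G′ : Graph n} {P Q : Fin n → Set} → (∀ {x y} → adj G x y ≡ true → adj G′ x y ≡ true) →
  (∀ {x} → P x → Q x) → ∀ {x y} → Reach G P x y → Reach G′ Q x y
Reach-map f g here = here
Reach-map f g (step a p s) = step (f a) (g p) (Reach-map f g s)

-- All minors are kept on the vertex type `Fin n`. `act` marks the vertices that are still present,
-- and its count takes the place of the order of the graph.
record CliqueModel (l : ℕ) (G : Graph n) (act : Fin n → Bool) : Set where
  field
    branch    : Fin n → Maybe (Fin l)
    nonempty  : ∀ x → ∃ λ v → branch v ≡ just x
    connected : ∀ x u v → branch u ≡ just x → branch v ≡ just x → Reach G (λ w → branch w ≡ just x) u v
    adjacent  : ∀ x y → x ≢ y → ∃ λ u → ∃ λ v → branch u ≡ just x × branch v ≡ just y × adj G u v ≡ true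
    within    : ∀ {x v} → branch v ≡ just x → act v ≡ true

CliqueModel⇒IsMinor : (L : Graph l) {G : Graph n} {act : Fin n → Bool} → CliqueModel l G act → IsMinor L G
CliqueModel⇒IsMinor L M = branch , nonempty , connected , λ x y a → adjacent x y (adj⇒≢ L a)
  where open CliqueModel M

-- The branch sets are the fibres of `ρ`, named by vertices of `M`. Both the contraction of one edge
-- and that of the images of a set `D` of vertices of `H` take this form.
record Contraction (G M : Graph n) (actG actM : Fin n → Bool) : Set where
  field
    ρ         : Fin n → Maybe (Fin n)
    nonempty  : ∀ {x} → actM x ≡ true → ∃ λ v → ρ v ≡ just x
    connected : ∀ {x u v} → ρ u ≡ just x → ρ v ≡ just x → Reach G (λ w → ρ w ≡ just x) u v
    edge      : ∀ {x y} → adj M x y ≡ true → ∃ λ u → ∃ λ v → ρ u ≡ just x × ρ v ≡ just y × adj G u v ≡ true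
    within    : ∀ {x v} → ρ v ≡ just x → actG v ≡ true

-- Transitivity of minors: a walk inside a branch set in `M` is pulled back edge by edge, and the
-- gaps are filled inside the connected fibres of `ρ`.
lift-CliqueModel : {G M : Graph n} {actG actM : Fin n → Bool} →
  Contraction G M actG actM → CliqueModel l M actM → CliqueModel l G actG
lift-CliqueModel {n = n} {l = l} {G = G} {M} {actG} {actM} C K = record
  { branch = br
  ; nonempty = λ t → let (x , bx) = K.nonempty t ; (v , rv) = C.nonempty (K.within bx) in v , br-intro rv bx
  ; connected = conn
  ; adjacent = λ s t s≢t → let (x , y , bx , by , a) = K.adjacent s t s≢t
                               (u , v , ru , rv , e) = C.edge a
                           in u , v , br-intro ru bx , br-intro rv by , e
  ; within = λ p → C.within (proj₁ (proj₂ (br-elim p))) }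
  where
  module C = Contraction C
  module K = CliqueModel K
  br : Fin n → Maybe (Fin l)
  br v = C.ρ v Maybe.>>= K.branch
  br-intro : ∀ {v x t} → C.ρ v ≡ just x → K.branch x ≡ just t → br v ≡ just t
  br-intro p q rewrite p = q
  br-elim : ∀ {v t} → br v ≡ just t → ∃ λ x → C.ρ v ≡ just x × K.branch x ≡ just t
  br-elim {v} p with C.ρ v
  ... | just x = x , refl , p
  walk : ∀ {t x y u v} → C.ρ u ≡ just x → C.ρ v ≡ just y → K.branch x ≡ just t →
         Reach M (λ w → K.branch w ≡ just t) x y → Reach G (λ w → br w ≡ just t) u v
  walk ru rv bx here = Reach-map (λ a → a) (λ r → br-intro r bx) (C.connected ru rv)
  walk ru rv bx (step a bw r) with C.edge a
  ... | u₁ , v₁ , ru₁ , rv₁ , e =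
    Reach-trans (Reach-map (λ a → a) (λ r → br-intro r bx) (C.connected ru ru₁))
                (step e (br-intro rv₁ bw) (walk rv₁ rv bw r))
  conn : ∀ t u v → br u ≡ just t → br v ≡ just t → Reach G (λ w → br w ≡ just t) u v
  conn t u v p q with br-elim p | br-elim q
  ... | x , rx , bx | y , ry , by = walk rx ry bx (K.connected t x y bx by)

[_≐_] : Fin n → Fin n → ℕ
[ x ≐ y ] = bit (does (x ≟ y))

module _ {n : ℕ} where
  dsum : (Fin n → Fin n → ℕ) → ℕ
  dsum f = sum λ x → sum (f x)

  dsum-mono : {f g : Fin n → Fin n → ℕ} → (∀ x y → f x y ≤ g x y) → dsum f ≤ dsum g
  dsum-mono h = sum-mono λ x → sum-mono (h x)

  dsum-+ : (f g : Fin n → Fin n → ℕ) → dsum (λ x y → f x y + g x y) ≡ dsum f + dsum g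
  dsum-+ f g = trans (sum-cong-≗ {n} λ x → ∑-distrib-+ (f x) (g x)) (∑-distrib-+ (sum ∘ f) (sum ∘ g))

  dsum-selectˡ : (u : Fin n) (g : Fin n → ℕ) → dsum (λ x y → [ u ≐ x ] * g y) ≡ sum g
  dsum-selectˡ u g = trans (sum-cong-≗ {n} λ x → ≡-sym (*-distribˡ-sum [ u ≐ x ] g)) (sum-select u (λ _ → sum g))

  dsum-selectʳ : (u : Fin n) (g : Fin n → ℕ) → dsum (λ x y → [ u ≐ y ] * g x) ≡ sum g
  dsum-selectʳ u g = sum-cong-≗ {n} λ x → sum-select u (λ _ → g x)

-- The merged vertex keeps the name u, and v becomes isolated.
module _ (G : Graph n) (u v : Fin n) where

  ContractRel : Fin n → Fin n → Set
  ContractRel x y = x ≢ v × y ≢ v × x ≢ y ×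
    (adj G x y ≡ true ⊎ (u ≡ x × adj G v y ≡ true) ⊎ (u ≡ y × adj G v x ≡ true))

  contract : Graph n
  contract = fromRel {R = ContractRel}
    (λ x y → ¬? (x ≟ v) ×-dec ¬? (y ≟ v) ×-dec ¬? (x ≟ y) ×-dec
      ((adj G x y B.≟ true) ⊎-dec ((u ≟ x) ×-dec (adj G v y B.≟ true)) ⊎-dec ((u ≟ y) ×-dec (adj G v x B.≟ true))))
    (λ { (a , b , c , d) → b , a , c ∘ ≡-sym , flip d })
    (λ (_ , _ , c , _) → c refl)
    where
    flip : ∀ {x y} → adj G x y ≡ true ⊎ (u ≡ x × adj G v y ≡ true) ⊎ (u ≡ y × adj G v x ≡ true) →
           adj G y x ≡ true ⊎ (u ≡ y × adj G v x ≡ true) ⊎ (u ≡ x × adj G v y ≡ true)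
    flip (inj₁ p) = inj₁ (adj-sym G p)
    flip (inj₂ (inj₁ p)) = inj₂ (inj₂ p)
    flip (inj₂ (inj₂ p)) = inj₂ (inj₁ p)

  ContractRel? : ∀ x y → adj contract x y ≡ true → ContractRel x y
  ContractRel? x y = does-true (¬? (x ≟ v) ×-dec ¬? (y ≟ v) ×-dec ¬? (x ≟ y) ×-dec
      ((adj G x y B.≟ true) ⊎-dec ((u ≟ x) ×-dec (adj G v y B.≟ true)) ⊎-dec ((u ≟ y) ×-dec (adj G v x B.≟ true))))

  ContractRel! : ∀ {x y} → ContractRel x y → adj contract x y ≡ true
  ContractRel! {x} {y} = dec-true (¬? (x ≟ v) ×-dec ¬? (y ≟ v) ×-dec ¬? (x ≟ y) ×-dec
      ((adj G x y B.≟ true) ⊎-dec ((u ≟ x) ×-dec (adj G v y B.≟ true)) ⊎-dec ((u ≟ y) ×-dec (adj G v x B.≟ true))))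

  common : Fin n → ℕ
  common y = bit (adj G u y) * bit (adj G v y)

  private
    d e : Fin n → Fin n → ℕ
    d x y = bit (adj G x y)
    e x y = bit (adj contract x y)

    d0 : ∀ x → d x x ≡ 0
    d0 x = cong bit (irrefl G x)

    d-sym : ∀ x y → d x y ≡ d y x
    d-sym x y = cong bit (Graph.sym G x y)

    ∨-bound : ∀ {a b c} → (a ≡ true → c ≡ true) → (b ≡ true → c ≡ true) → bit a + bit b ≤ bit c + bit a * bit b
    ∨-bound {true} {true} h k rewrite h refl = ≤-refl
    ∨-bound {true} {false} {c} h k rewrite h refl = ≤-refl
    ∨-bound {false} {true} h k rewrite k refl = ≤-refl
    ∨-bound {false} {false} h k = z≤n

  -- Both sides sum to the same shifted terms, so that only the common neighbours
  -- and the two directions of uv itself are lost.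
  contract-pointwise : u ≢ v → ∀ x y (a : Dec (u ≡ x)) (b : Dec (v ≡ x)) (a′ : Dec (u ≡ y)) (b′ : Dec (v ≡ y)) →
    d x y + (bit (does a) * d v y + bit (does a′) * d v x) ≤
    e x y + (bit (does b) * d v y + bit (does b′) * d v x) +
      (bit (does a) * common y + bit (does a′) * common x) + bit (does a) * (bit (does a′) * 2)
  contract-pointwise u≢v x y (yes refl) (yes refl) a′ b′ = ⊥-elim (u≢v refl)
  contract-pointwise u≢v x y a b (yes refl) (yes refl) = ⊥-elim (u≢v refl)
  contract-pointwise u≢v x y (yes refl) (no _) (yes refl) (no _) rewrite d0 u =
    ≤-trans (+-mono-≤ (≤-trans (≤-reflexive (*-identityˡ _)) (bit≤1 (adj G v u))) (≤-trans (≤-reflexive (*-identityˡ _)) (bit≤1 (adj G v u))))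
            (m≤n+m 2 _)
  contract-pointwise u≢v x y (yes refl) (no _) (no _) (yes refl) rewrite d0 v | d-sym u v =
    lem (d v u) (e u v) _
    where
    lem : ∀ p q r → p + 0 ≤ q + (1 * p) + r + 0
    lem p q r = ≤-trans (m≤n+m (p + 0) (q + r)) (≤-reflexive (eq p q r))
      where eq : ∀ p q r → q + r + (p + 0) ≡ q + (1 * p) + r + 0
            eq = solve-∀
  contract-pointwise u≢v x y (yes refl) (no _) (no u≢y) (no v≢y) =
    lem (d u y) (d v y) (e u y) (∨-bound (λ p → ContractRel! (u≢v , v≢y ∘ ≡-sym , u≢y , inj₁ p))
      (λ p → ContractRel! (u≢v , v≢y ∘ ≡-sym , u≢y , inj₂ (inj₁ (refl , p)))))
    where
    lem : ∀ p q r → p + q ≤ r + p * q → p + (1 * q + 0) ≤ r + 0 + (1 * (p * q) + 0) + 0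
    lem p q r h = subst₂ _≤_ (e₁ p q) (e₂ p q r) h
      where e₁ : ∀ p q → p + q ≡ p + (1 * q + 0)
            e₁ = solve-∀
            e₂ : ∀ p q r → r + p * q ≡ r + 0 + (1 * (p * q) + 0) + 0
            e₂ = solve-∀
  contract-pointwise u≢v x y (no _) (yes refl) (yes refl) (no _) rewrite d0 v =
    lem (d v u) (e v u) _
    where
    lem : ∀ p q r → p + 0 ≤ q + (1 * p + 0) + r + 0
    lem p q r = ≤-trans (m≤n+m (p + 0) (q + r)) (≤-reflexive (eq p q r))
      where eq : ∀ p q r → q + r + (p + 0) ≡ q + (1 * p + 0) + r + 0
            eq = solve-∀
  contract-pointwise u≢v x y (no _) (yes refl) (no _) (yes refl) rewrite d0 v = z≤n
  contract-pointwise u≢v x y (no _) (yes refl) (no _) (no _) =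
    lem (d v y) (e v y)
    where
    lem : ∀ p q → p + 0 ≤ q + (1 * p + 0) + 0 + 0
    lem p q = ≤-trans (m≤n+m (p + 0) q) (≤-reflexive (eq p q))
      where eq : ∀ p q → q + (p + 0) ≡ q + (1 * p + 0) + 0 + 0
            eq = solve-∀
  contract-pointwise u≢v x y (no u≢x) (no v≢x) (yes refl) (no _) rewrite d-sym x u =
    lem (d u x) (d v x) (e x u) (∨-bound (λ p → ContractRel! (v≢x ∘ ≡-sym , u≢v , u≢x ∘ ≡-sym , inj₁ (adj-sym G p)))
      (λ p → ContractRel! (v≢x ∘ ≡-sym , u≢v , u≢x ∘ ≡-sym , inj₂ (inj₂ (refl , p)))))
    where
    lem : ∀ p q r → p + q ≤ r + p * q → p + 1 * q ≤ r + 0 + 1 * (p * q) + 0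
    lem p q r h = subst₂ _≤_ (e₁ p q) (e₂ p q r) h
      where e₁ : ∀ p q → p + q ≡ p + 1 * q
            e₁ = solve-∀
            e₂ : ∀ p q r → r + p * q ≡ r + 0 + 1 * (p * q) + 0
            e₂ = solve-∀
  contract-pointwise u≢v x y (no _) (no _) (no _) (yes refl) rewrite d-sym x v =
    lem (d v x) (e x v)
    where
    lem : ∀ p q → p + 0 ≤ q + 1 * p + 0 + 0
    lem p q = ≤-trans (m≤n+m (p + 0) q) (≤-reflexive (eq p q))
      where eq : ∀ p q → q + (p + 0) ≡ q + 1 * p + 0 + 0
            eq = solve-∀
  contract-pointwise u≢v x y (no u≢x) (no v≢x) (no u≢y) (no v≢y) =
    ≤-trans (≤-reflexive (+-identityʳ _)) (≤-trans (bit-mono λ p →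
      ContractRel! (v≢x ∘ ≡-sym , v≢y ∘ ≡-sym , adj⇒≢ G p , inj₁ p))
      (≤-reflexive (≡-sym (trans (+-identityʳ _) (trans (+-identityʳ _) (+-identityʳ _))))))

  degreeSum-contract : u ≢ v → degreeSum G ≤ degreeSum contract + (2 * sum common + 2)
  -- The edges of `v` move to `u`. After adding the degree `D` of `v` twice, they sit in the row and
  -- column of `u` on the left, and on the right in the row and column of `v`, which the contraction
  -- empties. `F` pays for `uv`, which would become a loop at `u`.
  degreeSum-contract u≢v = +-cancelʳ-≤ (D + D) _ _ (begin
    degreeSum G + (D + D)
      ≡⟨ cong (λ z → degreeSum G + z) (cong₂ _+_ (dsum-selectˡ u (d v)) (dsum-selectʳ u (d v))) ⟨
    degreeSum G + (dsum (λ x y → [ u ≐ x ] * d v y) + dsum (λ x y → [ u ≐ y ] * d v x))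
      ≡⟨ cong (λ z → degreeSum G + z) (dsum-+ (λ x y → [ u ≐ x ] * d v y) _) ⟨
    degreeSum G + dsum (λ x y → [ u ≐ x ] * d v y + [ u ≐ y ] * d v x)
      ≡⟨ dsum-+ d _ ⟨
    dsum (λ x y → d x y + ([ u ≐ x ] * d v y + [ u ≐ y ] * d v x))
      ≤⟨ dsum-mono (λ x y → contract-pointwise u≢v x y (u ≟ x) (v ≟ x) (u ≟ y) (v ≟ y)) ⟩
    dsum (λ x y → A x y + B x y + E x y + F x y)
      ≡⟨ dsum-+ (λ x y → A x y + B x y + E x y) F ⟩
    dsum (λ x y → A x y + B x y + E x y) + dsum F
      ≡⟨ cong₂ _+_ (dsum-+ (λ x y → A x y + B x y) E) (trans (dsum-selectˡ u _) (sum-select u (λ _ → 2))) ⟩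
    dsum (λ x y → A x y + B x y) + dsum E + 2
      ≡⟨ cong (_+ 2) (cong₂ _+_ (trans (dsum-+ A B) (cong (λ z → dsum A + z) (trans (dsum-+ (λ x y → [ v ≐ x ] * d v y) _)
            (cong₂ _+_ (dsum-selectˡ v (d v)) (dsum-selectʳ v (d v))))))
          (trans (dsum-+ (λ x y → [ u ≐ x ] * common y) _) (cong₂ _+_ (dsum-selectˡ u common) (dsum-selectʳ u common)))) ⟩
    dsum A + (D + D) + (sum common + sum common) + 2
      ≡⟨ eq (dsum A) D (sum common) ⟩
    degreeSum contract + (2 * sum common + 2) + (D + D) ∎)
    where
    open ≤-Reasoning
    D : ℕ
    D = sum (d v)
    A B E F : Fin n → Fin n → ℕ
    A = e
    B x y = [ v ≐ x ] * d v y + [ v ≐ y ] * d v x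
    E x y = [ u ≐ x ] * common y + [ u ≐ y ] * common x
    F x y = [ u ≐ x ] * ([ u ≐ y ] * 2)
    eq : ∀ a b c → a + (b + b) + (c + c) + 2 ≡ a + (2 * c + 2) + (b + b)
    eq = solve-∀

-- This is `2 ^ (l + 1) - 2`. Contracting an edge with at most `c` common neighbours lowers the
-- degree sum by at most `2 * c + 2` and the order by one, so a degree sum of `2 + 2 * c` per vertex
-- survives.
cliqueDensity : ℕ → ℕ
cliqueDensity zero = 0
cliqueDensity (suc l) = 2 + 2 * cliqueDensity l

module _ (G : Graph n) (act : Fin n → Bool) (act-adj : ∀ {x y} → adj G x y ≡ true → act x ≡ true) where

  without : Fin n → Fin n → Bool
  without v x = does ((act x B.≟ true) ×-dec ¬? (v ≟ x))

  module _ {u v : Fin n} (uv : adj G u v ≡ true) where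
    private
      act-v : act v ≡ true
      act-v = act-adj (adj-sym G uv)

      pickρ : ∀ y → Dec (v ≡ y) → Dec (act y ≡ true) → Maybe (Fin n)
      pickρ y (yes _) _ = just u
      pickρ y (no _) (yes _) = just y
      pickρ y (no _) (no _) = nothing

      ρ : Fin n → Maybe (Fin n)
      ρ y = pickρ y (v ≟ y) (act y B.≟ true)

      ρ-elim : ∀ {x y} → ρ y ≡ just x → (v ≡ y × u ≡ x) ⊎ (v ≢ y × act y ≡ true × y ≡ x)
      ρ-elim {x} {y} p with v ≟ y | act y B.≟ true
      ρ-elim refl | yes q | _ = inj₁ (q , refl)
      ρ-elim refl | no q | yes a = inj₂ (q , a , refl)

      ρ-v : ρ v ≡ just u
      ρ-v with v ≟ v
      ... | yes _ = refl
      ... | no q = ⊥-elim (q refl)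

      ρ-other : ∀ {y} → v ≢ y → act y ≡ true → ρ y ≡ just y
      ρ-other {y} q a with v ≟ y | act y B.≟ true
      ... | yes r | _ = ⊥-elim (q r)
      ... | no _ | yes _ = refl
      ... | no _ | no ¬a = ⊥-elim (¬a a)

      ρ-u : ρ u ≡ just u
      ρ-u = ρ-other (adj⇒≢ G uv ∘ ≡-sym) (act-adj uv)

      ρ-connected : ∀ {x y z} → ρ y ≡ just x → ρ z ≡ just x → Reach G (λ w → ρ w ≡ just x) y z
      ρ-connected p q with ρ-elim p | ρ-elim q
      ... | inj₁ (refl , refl) | inj₁ (refl , _) = here
      ... | inj₁ (refl , refl) | inj₂ (_ , _ , refl) = step (adj-sym G uv) ρ-u here
      ... | inj₂ (_ , _ , refl) | inj₁ (refl , refl) = step uv ρ-v here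
      ... | inj₂ (_ , _ , refl) | inj₂ (_ , _ , refl) = here

      ρ-edge : ∀ {x y} → adj (contract G u v) x y ≡ true →
        ∃ λ s → ∃ λ t → ρ s ≡ just x × ρ t ≡ just y × adj G s t ≡ true
      ρ-edge {x} {y} p with ContractRel? G u v x y p
      ... | x≢v , y≢v , _ , inj₁ a = x , y , ρ-other (x≢v ∘ ≡-sym) (act-adj a) , ρ-other (y≢v ∘ ≡-sym) (act-adj (adj-sym G a)) , a
      ... | x≢v , y≢v , _ , inj₂ (inj₁ (refl , a)) = v , y , ρ-v , ρ-other (y≢v ∘ ≡-sym) (act-adj (adj-sym G a)) , a
      ... | x≢v , y≢v , _ , inj₂ (inj₂ (refl , a)) = x , v , ρ-other (x≢v ∘ ≡-sym) (act-adj (adj-sym G a)) , ρ-v , adj-sym G a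

    without-true : ∀ {x} → act x ≡ true → v ≢ x → without v x ≡ true
    without-true {x} a q = dec-true ((act x B.≟ true) ×-dec ¬? (v ≟ x)) (a , q)

    without-elim : ∀ {x} → without v x ≡ true → act x ≡ true × v ≢ x
    without-elim {x} = does-true ((act x B.≟ true) ×-dec ¬? (v ≟ x))

    contraction : Contraction G (contract G u v) act (without v)
    contraction = record
      { ρ = ρ
      ; nonempty = λ {x} p → x , ρ-other (proj₂ (without-elim p)) (proj₁ (without-elim p))
      ; connected = ρ-connected
      ; edge = ρ-edge
      ; within = λ p → within (ρ-elim p) }
      where
      within : ∀ {x y} → (v ≡ y × u ≡ x) ⊎ (v ≢ y × act y ≡ true × y ≡ x) → act y ≡ true
      within (inj₁ (refl , _)) = act-v
      within (inj₂ (_ , a , _)) = a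

    contract-act : ∀ {x y} → adj (contract G u v) x y ≡ true → without v x ≡ true
    contract-act {x} {y} p with ContractRel? G u v x y p
    ... | x≢v , _ , _ , inj₁ a = without-true (act-adj a) (x≢v ∘ ≡-sym)
    ... | x≢v , _ , _ , inj₂ (inj₁ (refl , _)) = without-true (act-adj uv) (x≢v ∘ ≡-sym)
    ... | x≢v , _ , _ , inj₂ (inj₂ (refl , a)) = without-true (act-adj (adj-sym G a)) (x≢v ∘ ≡-sym)

    without-< : count (without v) < count act
    without-< = count-mono-< (λ x p → proj₁ (without-elim p)) v (¬true⇒false λ p → proj₂ (without-elim p) refl) act-v

    0<without : 0 < count (without v)
    0<without = 0<count (without v) u (without-true (act-adj uv) (adj⇒≢ G uv ∘ ≡-sym))

  neighbourhood : Fin n → Graph n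
  neighbourhood u = fromRel {R = λ x y → adj G u x ≡ true × adj G u y ≡ true × adj G x y ≡ true}
    (λ x y → (adj G u x B.≟ true) ×-dec (adj G u y B.≟ true) ×-dec (adj G x y B.≟ true))
    (λ (a , b , c) → b , a , adj-sym G c) (λ (_ , _ , c) → adj⇒≢ G c refl)

  neighbourhood-elim : ∀ {u x y} → adj (neighbourhood u) x y ≡ true → adj G u x ≡ true × adj G u y ≡ true × adj G x y ≡ true
  neighbourhood-elim {u} {x} {y} = does-true ((adj G u x B.≟ true) ×-dec (adj G u y B.≟ true) ×-dec (adj G x y B.≟ true))

  common≤deg-neighbourhood : ∀ {u x} → adj G u x ≡ true → sum (common G u x) ≤ deg (neighbourhood u) x
  common≤deg-neighbourhood {u} {x} a = sum-mono pointwise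
    where
    pointwise : ∀ y → common G u x y ≤ bit (adj (neighbourhood u) x y)
    pointwise y with adj G u y in p | adj G x y in q
    ... | false | _ = z≤n
    ... | true | false = z≤n
    ... | true | true rewrite a = ≤-refl

  -- The vertex `u` lies outside its neighbourhood and is adjacent to all of it, so the singleton of
  -- `u` is one more branch set, joined to all the others.
  add-apex : ∀ {u} → act u ≡ true → CliqueModel l (neighbourhood u) (adj G u) → CliqueModel (suc l) G act
  add-apex {l} {u} act-u K = record
    { branch = br
    ; nonempty = λ { zero → u , br-u ; (suc t) → let (v , p) = K.nonempty t in v , br-other p }
    ; connected = conn
    ; adjacent = adjc
    ; within = λ p → within (br-elim p) }
    where
    module K = CliqueModel K
    br : Fin _ → Maybe (Fin (suc l))
    br y with u ≟ y
    ... | yes _ = just zero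
    ... | no _ = Maybe.map suc (K.branch y)
    br-u : br u ≡ just zero
    br-u with u ≟ u
    ... | yes _ = refl
    ... | no q = ⊥-elim (q refl)
    br-other : ∀ {y t} → K.branch y ≡ just t → br y ≡ just (suc t)
    br-other {y} p with u ≟ y
    ... | yes refl = ⊥-elim (adj⇒≢ G (K.within p) refl)
    ... | no _ rewrite p = refl
    br-elim : ∀ {y t} → br y ≡ just t → (u ≡ y × t ≡ zero) ⊎ (∃ λ s → t ≡ suc s × K.branch y ≡ just s)
    br-elim {y} p with u ≟ y
    br-elim refl | yes q = inj₁ (q , refl)
    br-elim {y} p | no _ with K.branch y
    br-elim {y} refl | no _ | just s = inj₂ (s , refl , refl)
    within : ∀ {y t} → (u ≡ y × t ≡ zero) ⊎ (∃ λ s → t ≡ suc s × K.branch y ≡ just s) → act y ≡ true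
    within (inj₁ (refl , _)) = act-u
    within (inj₂ (_ , _ , q)) = act-adj (adj-sym G (K.within q))
    conn : ∀ t x y → br x ≡ just t → br y ≡ just t → Reach G (λ w → br w ≡ just t) x y
    conn t x y p q with br-elim p | br-elim q
    ... | inj₁ (refl , refl) | inj₁ (refl , _) = here
    ... | inj₂ (s , refl , p′) | inj₂ (s , refl , q′) =
      Reach-map (λ a → proj₂ (proj₂ (neighbourhood-elim a))) br-other (K.connected s x y p′ q′)
    adjc : ∀ s t → s ≢ t → ∃ λ x → ∃ λ y → br x ≡ just s × br y ≡ just t × adj G x y ≡ true
    adjc zero zero q = ⊥-elim (q refl)
    adjc zero (suc t) _ = let (v , p) = K.nonempty t in u , v , br-u , br-other p , K.within p
    adjc (suc s) zero _ = let (v , p) = K.nonempty s in v , u , br-other p , br-u , adj-sym G (K.within p)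
    adjc (suc s) (suc t) q = let (x , y , p , p′ , a) = K.adjacent s t (q ∘ cong suc)
                             in x , y , br-other p , br-other p′ , proj₂ (proj₂ (neighbourhood-elim a))

-- Mader: contract edges with few common neighbours, which keeps the density; once every edge
-- has many, the neighbourhood of a vertex is dense enough for a clique minor of one vertex less.
dense⇒CliqueModel : ∀ l (G : Graph n) (act : Fin n → Bool) → (∀ {x y} → adj G x y ≡ true → act x ≡ true) →
  0 < count act → cliqueDensity l * count act ≤ degreeSum G → CliqueModel l G act
dense⇒CliqueModel zero G act act-adj 0<act dense = record
  { branch = λ _ → nothing ; nonempty = λ () ; connected = λ () ; adjacent = λ () ; within = λ () }
dense⇒CliqueModel {n} (suc l) G₀ act₀ act-adj₀ 0<act₀ dense₀ = go (count act₀) G₀ act₀ act-adj₀ ≤-refl 0<act₀ dense₀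
  where
  c C : ℕ
  c = cliqueDensity l
  C = cliqueDensity (suc l)
  go : ∀ s (G : Graph n) (act : Fin n → Bool) → (∀ {x y} → adj G x y ≡ true → act x ≡ true) →
    count act ≤ s → 0 < count act → C * count act ≤ degreeSum G → CliqueModel (suc l) G act
  go zero G act act-adj act≤s 0<act dense = ⊥-elim (<⇒≱ 0<act act≤s)
  go (suc s) G act act-adj act≤s 0<act dense
    with F.any? (λ u → F.any? (λ v → (adj G u v B.≟ true) ×-dec (sum (common G u v) ≤? c)))
  ... | yes (u , v , uv , few) =
    lift-CliqueModel (contraction G act act-adj uv)
      (go s (contract G u v) (without G act act-adj v) (λ {x} {y} → contract-act G act act-adj uv {x} {y})
        (≤-pred (≤-trans (without-< G act act-adj uv) act≤s)) (0<without G act act-adj uv) dense′)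
    where
    open ≤-Reasoning
    act′ : Fin n → Bool
    act′ = without G act act-adj v
    dense′ : C * count act′ ≤ degreeSum (contract G u v)
    dense′ = +-cancelʳ-≤ C _ _ (begin
      C * count act′ + C                                        ≡⟨ +-comm _ C ⟩
      C + C * count act′                                        ≡⟨ *-suc C _ ⟨
      C * suc (count act′)                                      ≤⟨ *-monoʳ-≤ C (without-< G act act-adj uv) ⟩
      C * count act                                             ≤⟨ dense ⟩
      degreeSum G                                               ≤⟨ degreeSum-contract G u v (adj⇒≢ G uv) ⟩
      degreeSum (contract G u v) + (2 * sum (common G u v) + 2) ≤⟨ +-monoʳ-≤ (degreeSum (contract G u v)) (+-monoˡ-≤ 2 (*-monoʳ-≤ 2 few)) ⟩
      degreeSum (contract G u v) + (2 * c + 2)                  ≡⟨ cong (λ z → degreeSum (contract G u v) + z) (+-comm (2 * c) 2) ⟩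
      degreeSum (contract G u v) + C                            ∎)
  -- As `C` is positive, the density yields a vertex `u` with a neighbour, so the neighbourhood
  -- handed to the induction is nonempty.
  ... | no many with 0<sum⇒ (deg G) (≤-trans (*-mono-≤ {1} {C} (s≤s z≤n) 0<act) dense)
  ...   | u , 0<deg with 0<count⇒ (adj G u) 0<deg
  ...     | v , uv = add-apex G act act-adj (act-adj uv)
    (dense⇒CliqueModel l (neighbourhood G act act-adj u) (adj G u)
      (λ p → proj₁ (neighbourhood-elim G act act-adj p)) 0<deg dense′)
    where
    pointwise : ∀ x → c * bit (adj G u x) ≤ deg (neighbourhood G act act-adj u) x
    pointwise x = byBool (adj G u x)
      (λ p → ≤-trans (≤-trans (*-monoʳ-≤ c (bit≤1 _)) (≤-reflexive (*-identityʳ c)))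
               (≤-trans (<⇒≤ (≰⇒> λ q → many (u , x , p , q))) (common≤deg-neighbourhood G act act-adj p)))
      (λ p → ≤-trans (≤-reflexive (trans (cong (λ b → c * bit b) p) (*-zeroʳ c))) z≤n)
    dense′ : c * count (adj G u) ≤ degreeSum (neighbourhood G act act-adj u)
    dense′ = ≤-trans (≤-reflexive (*-distribˡ-sum c (bit ∘ adj G u))) (sum-mono pointwise)

-- If every active vertex exceeded the bound, `M` would be dense enough for a clique minor. The
-- vertex has to be active, since only such a vertex is a value at which members of the family can
-- be peeled off.
MinorFree⇒small-degree : (M : Graph n) (act : Fin n → Bool) → (∀ {x y} → adj M x y ≡ true → act x ≡ true) →
  0 < count act → ¬ CliqueModel l M act → ∃ λ x → act x ≡ true × deg M x ≤ cliqueDensity l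
MinorFree⇒small-degree {l = l} M act act-adj 0<act free
  with F.any? (λ x → (act x B.≟ true) ×-dec (deg M x ≤? cliqueDensity l))
... | yes p = p
... | no big = ⊥-elim (free (dense⇒CliqueModel l M act act-adj 0<act
        (≤-trans (≤-reflexive (*-distribˡ-sum (cliqueDensity l) (bit ∘ act))) (sum-mono pointwise))))
  where
  pointwise : ∀ x → cliqueDensity l * bit (act x) ≤ deg M x
  pointwise x with act x in p
  ... | false = ≤-trans (≤-reflexive (*-zeroʳ (cliqueDensity l))) z≤n
  ... | true = ≤-trans (≤-reflexive (*-identityʳ _)) (<⇒≤ (≰⇒> λ q → big (x , p , q)))

-- Single degrees are not bounded, but pruning is charged against their sum only.
MinorFree⇒degreeSum≤ : (L : Graph l) (G : Graph n) → MinorFree L G → degreeSum G ≤ cliqueDensity l * n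
MinorFree⇒degreeSum≤ {n = zero} L G free = z≤n
MinorFree⇒degreeSum≤ {l} {suc n} L G free with degreeSum G ≤? cliqueDensity l * suc n
... | yes p = p
... | no p = ⊥-elim (free (CliqueModel⇒IsMinor L (dense⇒CliqueModel l G (λ _ → true) (λ _ → refl) (s≤s z≤n)
        (≤-trans (*-monoʳ-≤ (cliqueDensity l) (count≤n {suc n} (λ _ → true))) (<⇒≤ (≰⇒> p))))))

-- Functional dependencies between the vertices of H

restrict : {P : Fin m → Set} → (Fin m → Bool) → (∀ i → Dec (P i)) → Fin m → Bool
restrict S P? i = does ((S i B.≟ true) ×-dec P? i)

restrict-intro : {P : Fin m → Set} (S : Fin m → Bool) (P? : ∀ i → Dec (P i)) → ∀ {i} → S i ≡ true → P i → restrict S P? i ≡ true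
restrict-intro S P? {i} s p = dec-true ((S i B.≟ true) ×-dec P? i) (s , p)

restrict-elim : {P : Fin m → Set} (S : Fin m → Bool) (P? : ∀ i → Dec (P i)) → ∀ {i} → restrict S P? i ≡ true → S i ≡ true × P i
restrict-elim S P? {i} = does-true ((S i B.≟ true) ×-dec P? i)

count-split : {P : Fin m → Set} (S : Fin m → Bool) (P? : ∀ i → Dec (P i)) →
  count S ≡ count (restrict S P?) + count (restrict S (λ i → ¬? (P? i)))
count-split {m} S P? = trans (sum-cong-≗ {m} pointwise) (∑-distrib-+ (bit ∘ restrict S P?) _)
  where
  pointwise : ∀ i → bit (S i) ≡ bit (restrict S P? i) + bit (restrict S (λ i → ¬? (P? i)) i)
  pointwise i with S i | does (P? i)
  ... | true | true = refl
  ... | true | false = refl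
  ... | false | _ = refl

-- A functional dependency in the sense of relational databases. It passes to subfamilies, so
-- dependencies can be gathered one after another while the family shrinks.
Det : (α β : Fin m → Fin n) → (Fin m → Bool) → Set
Det α β S = ∀ i j → S i ≡ true → S j ≡ true → α i ≡ α j → β i ≡ β j

Det-⊑ : {α β : Fin m → Fin n} {S T : Fin m → Bool} → S ⊑ T → Det α β T → Det α β S
Det-⊑ sub det i j p q = det i j (sub i p) (sub j q)

⊑-trans : {S T U : Fin m → Bool} → S ⊑ T → T ⊑ U → S ⊑ U
⊑-trans f g i p = g i (f i p)

-- `nb` may exceed the set of partners of `a`, so that the whole neighbourhood of a vertex of small
-- degree can serve.
Thin : ℕ → (α β : Fin m → Fin n) → (Fin m → Bool) → Set
Thin {m} {n} C α β S = ∃ λ a → (∃ λ i → S i ≡ true × α i ≡ a) ×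
  Σ (Fin n → Bool) λ nb → count nb ≤ C × (∀ i → S i ≡ true → α i ≡ a → nb (β i) ≡ true)

-- Among the members with value `a`, those with the most popular partner make up at least a fraction
-- `1 / C`. They can be added to any `F′` found later without spoiling determinacy, because `F′`
-- avoids `a`. The size bound compares the members lost with `C` times the members gained, so that
-- it telescopes over the rounds.
peel : ∀ C (α β : Fin m → Fin n) (S : Fin m → Bool) → Thin C α β S →
  Σ (Fin m → Bool) λ S′ → S′ ⊑ S × count S′ < count S ×
    (∀ F′ → F′ ⊑ S′ → Det α β F′ →
      Σ (Fin m → Bool) λ F → F ⊑ S × Det α β F × count S + C * count F′ ≤ count S′ + C * count F)
peel {m} {n} C α β S (a , (i₀ , Si₀ , αi₀) , nb , nb≤C , nb-β)
  with popular-value f nb (≤-trans (s≤s z≤n) (F.toℕ<n a)) nb≤C supp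
  where
  f : Fin n → ℕ
  f y = sum λ i → bit (restrict S (λ i → α i ≟ a) i) * [ β i ≐ y ]
  supp : ∀ y → 0 < f y → nb y ≡ true
  supp y p with 0<sum⇒ _ p
  ... | i , q with S i in Si | α i ≟ a | β i ≟ y
  ...   | true | yes αi | yes refl = nb-β i Si αi
... | y , popular = S′ , (λ i p → proj₁ (restrict-elim S (λ i → ¬? (α i ≟ a)) p))
      , count-mono-< (λ i p → proj₁ (restrict-elim S (λ i → ¬? (α i ≟ a)) p)) i₀
          (¬true⇒false λ p → proj₂ (restrict-elim S (λ i → ¬? (α i ≟ a)) p) αi₀) Si₀
      , extend
  where
  A S′ : Fin m → Bool
  A = restrict S (λ i → α i ≟ a)
  S′ = restrict S (λ i → ¬? (α i ≟ a))
  f : Fin n → ℕ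
  f y = sum λ i → bit (A i) * [ β i ≐ y ]
  sum-f : sum f ≡ count A
  sum-f = trans (∑-comm λ y i → bit (A i) * [ β i ≐ y ])
    (sum-cong-≗ {m} λ i → trans (≡-sym (*-distribˡ-sum (bit (A i)) (λ y → [ β i ≐ y ])))
      (trans (cong (bit (A i) *_) (count-single (β i))) (*-identityʳ _)))
  extend : ∀ F′ → F′ ⊑ S′ → Det α β F′ →
    Σ (Fin m → Bool) λ F → F ⊑ S × Det α β F × count S + C * count F′ ≤ count S′ + C * count F
  extend F′ F′⊑ det = F , (λ i p → F⊑S i (F-elim i p)) , det′ , size
    where
    F? : ∀ i → Dec ((A i ≡ true × β i ≡ y) ⊎ F′ i ≡ true)
    F? i = ((A i B.≟ true) ×-dec (β i ≟ y)) ⊎-dec (F′ i B.≟ true)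
    F : Fin m → Bool
    F i = does (F? i)
    F-elim : ∀ i → F i ≡ true → (A i ≡ true × β i ≡ y) ⊎ F′ i ≡ true
    F-elim i = does-true (F? i)
    A-elim : ∀ {i} → A i ≡ true → S i ≡ true × α i ≡ a
    A-elim = restrict-elim S (λ i → α i ≟ a)
    F′-elim : ∀ {i} → F′ i ≡ true → S i ≡ true × α i ≢ a
    F′-elim {i} p = restrict-elim S (λ i → ¬? (α i ≟ a)) (F′⊑ i p)
    F⊑S : ∀ i → (A i ≡ true × β i ≡ y) ⊎ F′ i ≡ true → S i ≡ true
    F⊑S i (inj₁ (p , _)) = proj₁ (A-elim p)
    F⊑S i (inj₂ p) = proj₁ (F′-elim p)
    det′ : Det α β F
    det′ i j p q e with F-elim i p | F-elim j q
    ... | inj₁ (_ , x) | inj₁ (_ , y) = trans x (≡-sym y)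
    ... | inj₁ (x , _) | inj₂ y = ⊥-elim (proj₂ (F′-elim y) (trans (≡-sym e) (proj₂ (A-elim x))))
    ... | inj₂ x | inj₁ (y , _) = ⊥-elim (proj₂ (F′-elim x) (trans e (proj₂ (A-elim y))))
    ... | inj₂ x | inj₂ y = det i j x y e
    pointwise : ∀ i → bit (A i) * [ β i ≐ y ] + bit (F′ i) ≤ bit (F i)
    pointwise i with A i in Ai | does (β i ≟ y) | F′ i in F′i
    ... | true | _ | true = ⊥-elim (proj₂ (F′-elim F′i) (proj₂ (A-elim Ai)))
    ... | true | true | false = ≤-refl
    ... | true | false | false = z≤n
    ... | false | _ | true = ≤-refl
    ... | false | _ | false = z≤n
    open ≤-Reasoning
    size : count S + C * count F′ ≤ count S′ + C * count F
    size = begin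
      count S + C * count F′                   ≡⟨ cong (_+ C * count F′) (count-split S (λ i → α i ≟ a)) ⟩
      count A + count S′ + C * count F′        ≤⟨ +-monoˡ-≤ (C * count F′) (+-monoˡ-≤ (count S′)
                                                    (≤-trans (≤-reflexive (≡-sym sum-f)) popular)) ⟩
      C * f y + count S′ + C * count F′        ≡⟨ eq C (f y) (count S′) (count F′) ⟩
      count S′ + C * (f y + count F′)          ≡⟨ cong (λ z → count S′ + C * z) (∑-distrib-+ (λ i → bit (A i) * [ β i ≐ y ]) (bit ∘ F′)) ⟨
      count S′ + C * sum (λ i → bit (A i) * [ β i ≐ y ] + bit (F′ i))
                                               ≤⟨ +-monoʳ-≤ (count S′) (*-monoʳ-≤ C (sum-mono pointwise)) ⟩
      count S′ + C * count F                   ∎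
      where
      eq : ∀ c x s t → c * x + s + c * t ≡ s + c * (x + t)
      eq = solve-∀

-- Peel off the values with few partners, keeping for each only its most popular partner.
functional-subfamily : ∀ C (α β : Fin m → Fin n) (S : Fin m → Bool) →
  (∀ S′ → S′ ⊑ S → 0 < count S′ → Thin C α β S′ ⊎ Thin C β α S′) →
  Σ (Fin m → Bool) λ F → F ⊑ S × (Det α β F ⊎ Det β α F) × count S ≤ 2 * C * count F
functional-subfamily {m} C α β S₀ thin = choose (go (count S₀) S₀ (λ _ p → p) ≤-refl)
  where
  -- In each round either side may be the thin one, so one family is built for each direction.
  -- Keeping the larger of the two costs the factor 2.
  Split : (Fin m → Bool) → Set
  Split S = Σ (Fin m → Bool) λ F₁ → Σ (Fin m → Bool) λ F₂ → F₁ ⊑ S × F₂ ⊑ S × Det α β F₁ × Det β α F₂ ×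
    count S ≤ C * (count F₁ + count F₂)
  arith : ∀ {s s′ x x′ z} → s + C * x′ ≤ s′ + C * x → s′ ≤ C * (x′ + z) → s ≤ C * (x + z)
  arith {s} {s′} {x} {x′} {z} p q = +-cancelʳ-≤ (C * x′) _ _
    (≤-trans p (≤-trans (+-monoˡ-≤ (C * x) q) (≤-reflexive (eq C x x′ z))))
    where eq : ∀ c x x′ z → c * (x′ + z) + c * x ≡ c * (x + z) + c * x′
          eq = solve-∀
  go : ∀ s S → S ⊑ S₀ → count S ≤ s → Split S
  go s S sub S≤s with 0 <? count S
  ... | no p = S , S , (λ _ q → q) , (λ _ q → q) , vac , (λ i j q → vac i j q) , ≤-trans (≮⇒≥ p) z≤n
    where
    vac : ∀ {γ δ : Fin m → Fin _} → Det γ δ S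
    vac i j q = ⊥-elim (p (0<count S i q))
  go zero S sub S≤s | yes p = ⊥-elim (<⇒≱ p S≤s)
  go (suc s) S sub S≤s | yes p with thin S sub p
  ... | inj₁ t = let (S′ , S′⊑ , S′< , extend) = peel C α β S t
                     (F₁′ , F₂ , F₁′⊑ , F₂⊑ , d₁ , d₂ , b) = go s S′ (⊑-trans {S = S′} S′⊑ sub) (≤-pred (≤-trans S′< S≤s))
                     (F₁ , F₁⊑ , d , b′) = extend F₁′ F₁′⊑ d₁
                 in F₁ , F₂ , F₁⊑ , ⊑-trans {S = F₂} F₂⊑ S′⊑ , d , d₂ , arith {count S} {count S′} {count F₁} {count F₁′} b′ b
  ... | inj₂ t = let (S′ , S′⊑ , S′< , extend) = peel C β α S t
                     (F₁ , F₂′ , F₁⊑ , F₂′⊑ , d₁ , d₂ , b) = go s S′ (⊑-trans {S = S′} S′⊑ sub) (≤-pred (≤-trans S′< S≤s))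
                     (F₂ , F₂⊑ , d , b′) = extend F₂′ F₂′⊑ d₂
                 in F₁ , F₂ , ⊑-trans {S = F₁} F₁⊑ S′⊑ , F₂⊑ , d₁ , d ,
                    ≤-trans (arith {count S} {count S′} {count F₂} {count F₂′} b′ (≤-trans b (≤-reflexive (cong (C *_) (+-comm (count F₁) _)))))
                            (≤-reflexive (cong (C *_) (+-comm (count F₂) _)))
  double : ∀ {x y s} → x ≤ y → s ≤ C * (x + y) → s ≤ 2 * C * y
  double {x} {y} x≤y p = ≤-trans p (≤-trans (*-monoʳ-≤ C (+-monoˡ-≤ y x≤y)) (≤-reflexive (eq C y)))
    where eq : ∀ c y → c * (y + y) ≡ 2 * c * y
          eq = solve-∀
  choose : Split S₀ → Σ (Fin m → Bool) λ F → F ⊑ S₀ × (Det α β F ⊎ Det β α F) × count S₀ ≤ 2 * C * count F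
  choose (F₁ , F₂ , s₁ , s₂ , d₁ , d₂ , b) with ≤-total (count F₁) (count F₂)
  ... | inj₁ p = F₂ , s₂ , inj₂ d₂ , double {count F₁} p b
  ... | inj₂ p = F₁ , s₁ , inj₁ d₁ , double {count F₂} p (≤-trans b (≤-reflexive (cong (C *_) (+-comm (count F₁) _))))

-- `b` is only an upper bound on the length, as `stop` accepts every `b`. It is recorded because
-- each hop will cost one level of the search.
data Walk {k : ℕ} (H : Graph k) (D : Fin k → Bool) : ℕ → Fin k → Fin k → Set where
  stop : ∀ {b x} → Walk H D b x x
  hop   : ∀ {b x w y} → adj H x w ≡ true → D w ≡ true → Walk H D b w y → Walk H D (suc b) x y

module _ {k : ℕ} {H : Graph k} where

  Walk-suc : {D : Fin k → Bool} → ∀ {b x y} → Walk H D b x y → Walk H D (suc b) x y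
  Walk-suc stop = stop
  Walk-suc (hop a d w) = hop a d (Walk-suc w)

  Walk-map : {D E : Fin k → Bool} → D ⊑ E → ∀ {b x y} → Walk H D b x y → Walk H E b x y
  Walk-map h stop = stop
  Walk-map h (hop a d w) = hop a (h _ d) (Walk-map h w)

  Walk-snoc : {D : Fin k → Bool} → ∀ {b x y z} → Walk H D b x y → adj H y z ≡ true → D z ≡ true → Walk H D (suc b) x z
  Walk-snoc stop a d = hop a d stop
  Walk-snoc (hop a d w) a′ d′ = hop a d (Walk-snoc w a′ d′)

Dep : {k m n : ℕ} (Φ : Fin m → Fin k → Fin n) → (Fin m → Bool) → Fin k → Fin k → Set
Dep Φ S p q = Det (λ i → Φ i p) (λ i → Φ i q) S

-- The factor `2 * C` of `functional-subfamily`, plus one to make it positive for `l = 0` as well.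
depFactor : ℕ → ℕ
depFactor l = suc (2 * cliqueDensity l)

module Dependencies {l n k m : ℕ} (L : Graph l) (G : Graph n) (free : MinorFree L G) (H : Graph k)
  (Φ : Fin m → Fin k → Fin n) (hom : ∀ i u w → adj H u w ≡ true → adj G (Φ i u) (Φ i w) ≡ true)
  (χ : Fin n → Fin k) (col : ∀ i u → χ (Φ i u) ≡ u) where

  module _ (S : Fin m → Bool) (D : Fin k → Bool) (q w : Fin k) (Dq : D q ≡ true) (¬Dw : D w ≡ false)
    (dep : ∀ s → D s ≡ true → Dep Φ S s q)
    (conn : ∀ s t → D s ≡ true → D t ≡ true → ∃ λ b → Walk H D b s t)
    {u : Fin k} (Du : D u ≡ true) (uw : adj H u w ≡ true) (0<S : 0 < count S) where

    private
      q≢w : q ≢ w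
      q≢w refl = true≢false Dq ¬Dw

      Φ-color : ∀ {i j s t} → Φ i s ≡ Φ j t → s ≡ t
      Φ-color {i} {j} {s} {t} e = trans (≡-sym (col i s)) (trans (cong χ e) (col j t))

      MRel : Fin n → Fin n → Set
      MRel x y = ∃ λ i → S i ≡ true × ((Φ i q ≡ x × Φ i w ≡ y) ⊎ (Φ i q ≡ y × Φ i w ≡ x))

      MRel? : ∀ x y → Dec (MRel x y)
      MRel? x y = F.any? λ i → (S i B.≟ true) ×-dec
        (((Φ i q ≟ x) ×-dec (Φ i w ≟ y)) ⊎-dec ((Φ i q ≟ y) ×-dec (Φ i w ≟ x)))

      M : Graph n
      M = fromRel MRel?
        (λ { (i , s , inj₁ p) → i , s , inj₂ p ; (i , s , inj₂ p) → i , s , inj₁ p })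
        (λ { (i , s , inj₁ (p , r)) → q≢w (Φ-color (trans p (≡-sym r)))
           ; (i , s , inj₂ (p , r)) → q≢w (Φ-color (trans p (≡-sym r))) })

      Act : Fin n → Set
      Act x = ∃ λ i → S i ≡ true × (Φ i q ≡ x ⊎ Φ i w ≡ x)

      Act? : ∀ x → Dec (Act x)
      Act? x = F.any? λ i → (S i B.≟ true) ×-dec ((Φ i q ≟ x) ⊎-dec (Φ i w ≟ x))

      act : Fin n → Bool
      act x = does (Act? x)

      act-adj : ∀ {x y} → adj M x y ≡ true → act x ≡ true
      act-adj {x} {y} a with does-true (MRel? x y) a
      ... | i , s , inj₁ (p , _) = dec-true (Act? x) (i , s , inj₁ p)
      ... | i , s , inj₂ (_ , p) = dec-true (Act? x) (i , s , inj₂ p)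

      0<act : 0 < count act
      0<act with 0<count⇒ S 0<S
      ... | i , s = 0<count act (Φ i q) (dec-true (Act? _) (i , s , inj₁ refl))

      Hit : Fin n → Set
      Hit v = ∃ λ i → S i ≡ true × Φ i (χ v) ≡ v

      Hit? : ∀ v → Dec (Hit v)
      Hit? v = F.any? λ i → (S i B.≟ true) ×-dec (Φ i (χ v) ≟ v)

      pickρ : ∀ v → Dec (D (χ v) ≡ true × Hit v) → Dec (χ v ≡ w) → Maybe (Fin n)
      pickρ v (yes (_ , i , _)) _ = just (Φ i q)
      pickρ v (no _) (yes _) = just v
      pickρ v (no _) (no _) = nothing

      D? : ∀ v → Dec (D (χ v) ≡ true × Hit v)
      D? v = (D (χ v) B.≟ true) ×-dec Hit? v

      -- The bag of Φ i q consists of the images of D; the vertices of color w stay singletons.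
      ρ : Fin n → Maybe (Fin n)
      ρ v = pickρ v (D? v) (χ v ≟ w)

      ρ-elim : ∀ {v x} → ρ v ≡ just x →
        (∃ λ i → ∃ λ s → S i ≡ true × D s ≡ true × Φ i s ≡ v × Φ i q ≡ x) ⊎ (χ v ≡ w × v ≡ x)
      ρ-elim {v} p with D? v | χ v ≟ w
      ρ-elim {v} refl | yes (d , i , s , e) | _ = inj₁ (i , χ v , s , d , e , refl)
      ρ-elim refl | no _ | yes e = inj₂ (e , refl)

      -- `Hit?` may return another member `j` through the same vertex. Since `s` determines `q`,
      -- both members name the same bag; without `dep` the bags would overlap.
      ρ-D : ∀ {i s} → S i ≡ true → D s ≡ true → ρ (Φ i s) ≡ just (Φ i q)
      ρ-D {i} {s} Si Ds with D? (Φ i s) | χ (Φ i s) ≟ w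
      ... | yes (_ , j , Sj , e) | _ = cong just (dep s Ds j i Sj Si
              (trans (cong (Φ j) (≡-sym (col i s))) e))
      ... | no ¬d | _ = ⊥-elim (¬d (trans (cong D (col i s)) Ds , i , Si , cong (Φ i) (col i s)))

      ρ-w : ∀ i → ρ (Φ i w) ≡ just (Φ i w)
      ρ-w i with D? (Φ i w) | χ (Φ i w) ≟ w
      ... | yes (d , _) | _ = true≢false (trans (cong D (≡-sym (col i w))) d) ¬Dw
      ... | no _ | yes _ = refl
      ... | no _ | no ¬e = ⊥-elim (¬e (col i w))

      image-walk : ∀ {i b s t} → S i ≡ true → Walk H D b s t → Reach G (λ v → ρ v ≡ just (Φ i q)) (Φ i s) (Φ i t)
      image-walk Si stop = here
      image-walk {i} Si (hop a d r) = step (hom i _ _ a) (ρ-D Si d) (image-walk Si r)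

      ρ-connected : ∀ {x y z} → ρ y ≡ just x → ρ z ≡ just x → Reach G (λ v → ρ v ≡ just x) y z
      ρ-connected p r with ρ-elim p | ρ-elim r
      ... | inj₁ (i , s , Si , Ds , refl , refl) | inj₁ (j , t , Sj , Dt , refl , e) =
        Reach-trans (image-walk Si (proj₂ (conn s q Ds Dq)))
          (subst (λ x → Reach G (λ v → ρ v ≡ just x) x (Φ j t)) e (image-walk Sj (proj₂ (conn q t Dq Dt))))
      ... | inj₁ (i , s , Si , Ds , refl , refl) | inj₂ (c , refl) = ⊥-elim (q≢w (trans (≡-sym (col i q)) c))
      ... | inj₂ (c , refl) | inj₁ (i , s , Si , Ds , refl , e) = ⊥-elim (q≢w (trans (≡-sym (col i q)) (trans (cong χ e) c)))
      ... | inj₂ (_ , refl) | inj₂ (_ , refl) = here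

      contraction-M : Contraction G M (λ _ → true) act
      contraction-M = record
        { ρ = ρ
        ; nonempty = λ {x} p → nonempty (does-true (Act? x) p)
        ; connected = ρ-connected
        ; edge = λ {x} {y} p → edge (does-true (MRel? x y) p)
        ; within = λ _ → refl }
        where
        nonempty : ∀ {x} → Act x → ∃ λ v → ρ v ≡ just x
        nonempty (i , s , inj₁ refl) = Φ i q , ρ-D s Dq
        nonempty (i , s , inj₂ refl) = Φ i w , ρ-w i
        edge : ∀ {x y} → MRel x y → ∃ λ s → ∃ λ t → ρ s ≡ just x × ρ t ≡ just y × adj G s t ≡ true
        edge (i , s , inj₁ (refl , refl)) = Φ i u , Φ i w , ρ-D s Du , ρ-w i , hom i u w uw
        edge (i , s , inj₂ (refl , refl)) = Φ i w , Φ i u , ρ-w i , ρ-D s Du , adj-sym G (hom i u w uw)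

    -- `M` is a minor of `G`, so some active vertex has few neighbours in `M`. That vertex is an
    -- image of `q` or of `w`, which decides the side, and all its partners are among these
    -- neighbours.
    thin : Thin (cliqueDensity l) (λ i → Φ i q) (λ i → Φ i w) S ⊎ Thin (cliqueDensity l) (λ i → Φ i w) (λ i → Φ i q) S
    thin with MinorFree⇒small-degree {l = l} M act (λ {x} {y} → act-adj {x} {y}) 0<act
                (λ K → free (CliqueModel⇒IsMinor L (lift-CliqueModel contraction-M K)))
    ... | x , a , small with does-true (Act? x) a
    ...   | i , s , inj₁ e = inj₁ (x , (i , s , e) , adj M x , small ,
              λ j Sj e′ → dec-true (MRel? x _) (j , Sj , inj₁ (e′ , refl)))
    ...   | i , s , inj₂ e = inj₂ (x , (i , s , e) , adj M x , small ,
              λ j Sj e′ → dec-true (MRel? x _) (j , Sj , inj₂ (refl , e′)))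

  -- The hypotheses on `D` and `q` are inherited by every subfamily, so a thin value is available in
  -- each round of the peeling.
  dependency : (S : Fin m → Bool) (D : Fin k → Bool) (q w : Fin k) → D q ≡ true → D w ≡ false →
    (∀ s → D s ≡ true → Dep Φ S s q) →
    (∀ s t → D s ≡ true → D t ≡ true → ∃ λ b → Walk H D b s t) →
    ∀ {u} → D u ≡ true → adj H u w ≡ true →
    Σ (Fin m → Bool) λ S′ → S′ ⊑ S × (Dep Φ S′ q w ⊎ Dep Φ S′ w q) × count S ≤ depFactor l * count S′
  dependency S D q w Dq ¬Dw dep conn Du uw =
    let (S′ , sub , d , size) = functional-subfamily (cliqueDensity l) (λ i → Φ i q) (λ i → Φ i w) S
          (λ S′ sub 0<S′ → thin S′ D q w Dq ¬Dw (λ s Ds → Det-⊑ sub (dep s Ds)) conn Du uw 0<S′)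
    in S′ , sub , d , ≤-trans size (m≤n+m _ (count S′))

-- Elimination forests

module _ {k : ℕ} where

  remove : Fin k → (Fin k → Bool) → Fin k → Bool
  remove q D = restrict D (λ x → ¬? (q ≟ x))

  minus : (Fin k → Bool) → (Fin k → Bool) → Fin k → Bool
  minus Z D = restrict Z (λ x → ¬? (D x B.≟ true))

  remove-elim : ∀ q D {x} → remove q D x ≡ true → D x ≡ true × q ≢ x
  remove-elim q D = restrict-elim D (λ x → ¬? (q ≟ x))

  minus-elim : ∀ Z D {x} → minus Z D x ≡ true → Z x ≡ true × D x ≢ true
  minus-elim Z D = restrict-elim Z (λ x → ¬? (D x B.≟ true))

  remove-intro : ∀ q D {x} → D x ≡ true → q ≢ x → remove q D x ≡ true
  remove-intro q D = restrict-intro D (λ x → ¬? (q ≟ x))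

  minus-intro : ∀ Z D {x} → Z x ≡ true → D x ≢ true → minus Z D x ≡ true
  minus-intro Z D = restrict-intro Z (λ x → ¬? (D x B.≟ true))

  insert? : ∀ (w : Fin k) (D : Fin k → Bool) x → Dec (D x ≡ true ⊎ w ≡ x)
  insert? w D x = (D x B.≟ true) ⊎-dec (w ≟ x)

  insert : Fin k → (Fin k → Bool) → Fin k → Bool
  insert w D x = does (insert? w D x)

-- An elimination forest of H[Z]: D is a component of H[Z] and q its root.
data Forest {k m n : ℕ} (H : Graph k) (Φ : Fin m → Fin k → Fin n) (S : Fin m → Bool) : (Fin k → Bool) → Set where
  empty : ∀ {Z} → (∀ x → Z x ≡ false) → Forest H Φ S Z
  tree  : ∀ {Z} q D → D ⊑ Z → D q ≡ true →
    (∀ x y → D x ≡ true → D y ≡ true → Walk H D k x y) →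
    (∀ s → D s ≡ true → Dep Φ S s q) →
    (∀ u w → D u ≡ true → Z w ≡ true → adj H u w ≡ true → D w ≡ true) →
    Forest H Φ S (remove q D) → Forest H Φ S (minus Z D) → Forest H Φ S Z

Forest-⊑ : {k m n : ℕ} {H : Graph k} {Φ : Fin m → Fin k → Fin n} {S T : Fin m → Bool} → S ⊑ T →
  ∀ {Z} → Forest H Φ T Z → Forest H Φ S Z
Forest-⊑ sub (empty e) = empty e
Forest-⊑ sub (tree q D D⊑Z Dq conn dep closed children rest) =
  tree q D D⊑Z Dq conn (λ s Ds → Det-⊑ sub (dep s Ds)) closed (Forest-⊑ sub children) (Forest-⊑ sub rest)

-- Growing one component takes at most `k` dependencies. The family then pays once for the forest
-- below the root and once for that of the other components, each on fewer vertices.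
forestFactor : ℕ → ℕ → ℕ → ℕ
forestFactor l k zero = 1
forestFactor l k (suc s) = depFactor l ^ k * (forestFactor l k s * forestFactor l k s)

1≤depFactor^ : ∀ l f → 1 ≤ depFactor l ^ f
1≤depFactor^ l f = m^n>0 (depFactor l) f

1≤forestFactor : ∀ l k s → 1 ≤ forestFactor l k s
1≤forestFactor l k zero = ≤-refl
1≤forestFactor l k (suc s) = *-mono-≤ (1≤depFactor^ l k) (*-mono-≤ (1≤forestFactor l k s) (1≤forestFactor l k s))

module Forests {l n k m : ℕ} (L : Graph l) (G : Graph n) (free : MinorFree L G) (H : Graph k)
  (Φ : Fin m → Fin k → Fin n) (hom : ∀ i u w → adj H u w ≡ true → adj G (Φ i u) (Φ i w) ≡ true)
  (χ : Fin n → Fin k) (col : ∀ i u → χ (Φ i u) ≡ u) where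

  open Dependencies L G free H Φ hom χ col

  -- `closed` makes `D` a full component of `H[Z]`. `c` is the price paid in members, and `b` bounds
  -- the walks that the search will have to follow.
  record Component (c b : ℕ) (S : Fin m → Bool) (Z : Fin k → Bool) : Set where
    field
      S′     : Fin m → Bool
      root   : Fin k
      D      : Fin k → Bool
      sub    : S′ ⊑ S
      D⊑Z    : D ⊑ Z
      Droot  : D root ≡ true
      conn   : ∀ x y → D x ≡ true → D y ≡ true → Walk H D b x y
      dep    : ∀ s → D s ≡ true → Dep Φ S′ s root
      closed : ∀ u w → D u ≡ true → Z w ≡ true → adj H u w ≡ true → D w ≡ true
      size   : count S ≤ c * count S′

  private
    m≤c*m : ∀ {c} m → 1 ≤ c → m ≤ c * m
    m≤c*m m p = ≤-trans (≤-reflexive (≡-sym (*-identityˡ m))) (*-monoˡ-≤ m p)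

  -- The root moves to the new vertex w whenever it is the old root that determines w.
  grow : ∀ f b (S : Fin m → Bool) (Z D : Fin k → Bool) q → D ⊑ Z → D q ≡ true →
    (∀ x y → D x ≡ true → D y ≡ true → Walk H D b x y) → (∀ s → D s ≡ true → Dep Φ S s q) →
    count (minus Z D) ≤ f → Component (depFactor l ^ f) (f + b) S Z
  grow f b S Z D q D⊑Z Dq conn dep small
    with F.any? (λ u → F.any? (λ w → (D u B.≟ true) ×-dec (minus Z D w B.≟ true) ×-dec (adj H u w B.≟ true)))
  ... | no maximal = record
    { S′ = S ; root = q ; D = D ; sub = λ _ p → p ; D⊑Z = D⊑Z ; Droot = Dq
    ; conn = λ x y p r → pad f (conn x y p r) ; dep = dep ; closed = closed
    ; size = m≤c*m _ (1≤depFactor^ l f) }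
    where
    pad : ∀ f {x y} → Walk H D b x y → Walk H D (f + b) x y
    pad zero w = w
    pad (suc f) w = Walk-suc (pad f w)
    closed : ∀ u w → D u ≡ true → Z w ≡ true → adj H u w ≡ true → D w ≡ true
    closed u w Du Zw a = byBool (D w) (λ p → p)
      (λ p → ⊥-elim (maximal (u , w , Du , minus-intro Z D Zw (λ r → true≢false r p) , a)))
  grow zero b S Z D q D⊑Z Dq conn dep small | yes (u , w , Du , Rw , uw) = ⊥-elim (<⇒≱ (0<count (minus Z D) w Rw) small)
  grow (suc f) b S Z D q D⊑Z Dq conn dep small | yes (u , w , Du , Rw , uw) = extend
    (dependency S D q w Dq (¬true⇒false (proj₂ (minus-elim Z D Rw))) dep (λ s t p r → b , conn s t p r) Du uw)
    where
    E : Fin k → Bool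
    E = insert w D
    E-elim : ∀ x → E x ≡ true → D x ≡ true ⊎ w ≡ x
    E-elim x = does-true (insert? w D x)
    D⊑E : D ⊑ E
    D⊑E x p = dec-true (insert? w D x) (inj₁ p)
    Ew : E w ≡ true
    Ew = dec-true (insert? w D w) (inj₂ refl)
    E⊑Z : E ⊑ Z
    E⊑Z x p with E-elim x p
    ... | inj₁ d = D⊑Z x d
    ... | inj₂ refl = proj₁ (minus-elim Z D Rw)
    conn′ : ∀ x y → E x ≡ true → E y ≡ true → Walk H E (suc b) x y
    conn′ x y p r with E-elim x p | E-elim y r
    ... | inj₁ Dx | inj₁ Dy = Walk-suc (Walk-map D⊑E (conn x y Dx Dy))
    ... | inj₁ Dx | inj₂ refl = Walk-snoc (Walk-map D⊑E (conn x u Dx Du)) uw Ew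
    ... | inj₂ refl | inj₁ Dy = hop (adj-sym H uw) (D⊑E u Du) (Walk-map D⊑E (conn u y Du Dy))
    ... | inj₂ refl | inj₂ refl = stop
    small′ : count (minus Z E) ≤ f
    small′ = ≤-pred (≤-trans (count-mono-<
      (λ x p → let (z , ¬e) = minus-elim Z E p in minus-intro Z D z (λ d → ¬e (D⊑E x d)))
      w (¬true⇒false λ p → proj₂ (minus-elim Z E p) Ew) Rw) small)
    weaken : ∀ {S₁} → S₁ ⊑ S → count S ≤ depFactor l * count S₁ →
      Component (depFactor l ^ f) (f + suc b) S₁ Z → Component (depFactor l ^ suc f) (suc f + b) S Z
    weaken {S₁} sub₁ size₁ C = record
      { S′ = C.S′ ; root = C.root ; D = C.D ; sub = ⊑-trans {S = C.S′} C.sub sub₁ ; D⊑Z = C.D⊑Z ; Droot = C.Droot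
      ; conn = λ x y p r → subst (λ b → Walk H C.D b x y) (+-suc f b) (C.conn x y p r)
      ; dep = C.dep ; closed = C.closed
      ; size = ≤-trans size₁ (≤-trans (*-monoʳ-≤ (depFactor l) C.size) (≤-reflexive (≡-sym (*-assoc (depFactor l) (depFactor l ^ f) (count C.S′))))) }
      where module C = Component C
    extend : (Σ (Fin m → Bool) λ S₁ → S₁ ⊑ S × (Dep Φ S₁ q w ⊎ Dep Φ S₁ w q) × count S ≤ depFactor l * count S₁) →
      Component (depFactor l ^ suc f) (suc f + b) S Z
    extend (S₁ , sub₁ , inj₁ q⇒w , size₁) = weaken sub₁ size₁
      (grow f (suc b) S₁ Z E w E⊑Z Ew conn′ dep′ small′)
      where
      dep′ : ∀ s → E s ≡ true → Dep Φ S₁ s w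
      dep′ s p i j Si Sj e with E-elim s p
      ... | inj₁ Ds = q⇒w i j Si Sj (dep s Ds i j (sub₁ i Si) (sub₁ j Sj) e)
      ... | inj₂ refl = e
    extend (S₁ , sub₁ , inj₂ w⇒q , size₁) = weaken sub₁ size₁
      (grow f (suc b) S₁ Z E q E⊑Z (D⊑E q Dq) conn′ dep′ small′)
      where
      dep′ : ∀ s → E s ≡ true → Dep Φ S₁ s q
      dep′ s p i j Si Sj e with E-elim s p
      ... | inj₁ Ds = dep s Ds i j (sub₁ i Si) (sub₁ j Sj) e
      ... | inj₂ refl = w⇒q i j Si Sj e

  component : (S : Fin m → Bool) (Z : Fin k → Bool) → ∀ z → Z z ≡ true → Component (depFactor l ^ k) k S Z
  component S Z z Zz = subst (λ b → Component (depFactor l ^ k) b S Z) (+-identityʳ k)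
    (grow k 0 S Z (λ x → does (z ≟ x)) z single⊑Z (dec-true (z ≟ z) refl) conn dep (count≤n _))
    where
    single⊑Z : (λ x → does (z ≟ x)) ⊑ Z
    single⊑Z x p with does-true (z ≟ x) p
    ... | refl = Zz
    conn : ∀ x y → does (z ≟ x) ≡ true → does (z ≟ y) ≡ true → Walk H (λ x → does (z ≟ x)) 0 x y
    conn x y p r with does-true (z ≟ x) p | does-true (z ≟ y) r
    ... | refl | refl = stop
    dep : ∀ s → does (z ≟ s) ≡ true → Dep Φ S s z
    dep s p i j _ _ e with does-true (z ≟ s) p
    ... | refl = e

  -- Both `remove` and `minus` lose the root, so `s` drops in both calls. They work on successive
  -- subfamilies, to which what was found before is restricted.
  forest : ∀ s (S : Fin m → Bool) (Z : Fin k → Bool) → count Z ≤ s →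
    Σ (Fin m → Bool) λ S′ → S′ ⊑ S × Forest H Φ S′ Z × count S ≤ forestFactor l k s * count S′
  forest s S Z small with F.any? (λ z → Z z B.≟ true)
  ... | no none = S , (λ _ p → p) , empty (λ x → ¬true⇒false λ p → none (x , p)) , m≤c*m _ (1≤forestFactor l k s)
  forest zero S Z small | yes (z , Zz) = ⊥-elim (<⇒≱ (0<count Z z Zz) small)
  forest (suc s) S Z small | yes (z , Zz) = assemble (component S Z z Zz)
    where
    assemble : Component (depFactor l ^ k) k S Z →
      Σ (Fin m → Bool) λ S′ → S′ ⊑ S × Forest H Φ S′ Z × count S ≤ forestFactor l k (suc s) * count S′
    assemble C =
      let module C = Component C
          (S₁ , sub₁ , children , size₁) = forest s C.S′ (remove C.root C.D)
            (≤-pred (≤-trans (count-mono-< (λ x p → C.D⊑Z x (proj₁ (remove-elim C.root C.D p))) C.root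
              (¬true⇒false λ p → proj₂ (remove-elim C.root C.D p) refl) (C.D⊑Z C.root C.Droot)) small))
          (S₂ , sub₂ , rest , size₂) = forest s S₁ (minus Z C.D)
            (≤-pred (≤-trans (count-mono-< (λ x p → proj₁ (minus-elim Z C.D p)) C.root
              (¬true⇒false λ p → proj₂ (minus-elim Z C.D p) C.Droot) (C.D⊑Z C.root C.Droot)) small))
          sub = ⊑-trans {S = S₂} sub₂ sub₁
      in S₂ , ⊑-trans {S = S₂} sub C.sub
         , tree C.root C.D C.D⊑Z C.Droot C.conn (λ x Dx → Det-⊑ sub (C.dep x Dx)) C.closed (Forest-⊑ sub₂ children) rest
         , ≤-trans C.size (≤-trans (*-monoʳ-≤ (depFactor l ^ k) (≤-trans size₁ (*-monoʳ-≤ (forestFactor l k s) size₂)))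
             (≤-reflexive (eq (depFactor l ^ k) (forestFactor l k s) (count S₂))))
      where
      eq : ∀ a b c → a * (b * (b * c)) ≡ a * (b * b) * c
      eq = solve-∀

-- Assembling a copy of H

-- One level of the forest costs a step from the parent into the component and at most `k` steps to
-- its root. The final 1 lets the last vertex reached still be queried.
budget : ℕ → ℕ → ℕ
budget k s = s * suc k + 1

-- Found b a: the vertex a is discovered with at least b levels of the search left, so that for
-- b > 0 its queries have revealed, for each H-edge at it, the image of some member of S through it.
module Explore {n k m : ℕ} (H : Graph k) (Φ : Fin m → Fin k → Fin n) (S : Fin m → Bool)
  (Found : ℕ → Fin n → Set) (Edge : Fin n → Fin n → Set)
  (Found-pred : ∀ {b a} → Found (suc b) a → Found b a)
  (advance : ∀ {b i} u w → S i ≡ true → Found (suc b) (Φ i u) → adj H u w ≡ true →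
    ∃ λ j → S j ≡ true × Φ j u ≡ Φ i u × Found b (Φ j w) × Edge (Φ i u) (Φ j w)) where

  Agree : (Fin k → Bool) → Fin m → Fin m → Set
  Agree Anc i j = ∀ a → Anc a ≡ true → Φ j a ≡ Φ i a

  Found-drop : ∀ c {b a} → Found (c + b) a → Found b a
  Found-drop zero f = f
  Found-drop (suc c) f = Found-drop c (Found-pred f)

  -- A hop passes to a member `j` that is only known to share the image of the current vertex. That
  -- vertex lies in `D` and hence determines everything in `Anc`, so `j` agrees there with the
  -- member before.
  follow : (D Anc : Fin k → Bool) → (∀ s a → D s ≡ true → Anc a ≡ true → Dep Φ S s a) →
    ∀ {c b i x y} → D x ≡ true → S i ≡ true → Found (c + b) (Φ i x) → Walk H D c x y →
    ∃ λ j → S j ≡ true × Found b (Φ j y) × Agree Anc i j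
  follow D Anc dep {c} {i = i} Dx Si f stop = i , Si , Found-drop c f , λ _ _ → refl
  follow D Anc dep {i = i} {x = x} Dx Si f (hop {w = w} a Dw r) with advance x w Si f a
  ... | j , Sj , e , f′ , _ with follow D Anc dep Dw Sj f′ r
  ...   | j′ , Sj′ , f″ , agree = j′ , Sj′ , f″ , λ t At → trans (agree t At) (dep x t Dx At j i Sj Si e)

  -- Different vertices may come from different members; these are tied to `i` on the ancestors
  -- only. `Found 1` guarantees that the queries at `ψ z` have been made, which is needed to find
  -- its edges to ancestors placed later.
  record Placement (Z Anc : Fin k → Bool) (i : Fin m) : Set where
    field
      ψ      : Fin k → Fin n
      source : ∀ z → Z z ≡ true → ∃ λ j → S j ≡ true × ψ z ≡ Φ j z × Found 1 (ψ z) × Agree Anc i j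
      edges  : ∀ y z → Z y ≡ true → Z z ≡ true → adj H y z ≡ true → Edge (ψ y) (ψ z) ⊎ Edge (ψ z) (ψ y)

  module _ (q : Fin k) (D Anc : Fin k → Bool) (j : Fin m) (Sj : S j ≡ true) (found : Found 1 (Φ j q))
    (dep : ∀ s → D s ≡ true → Dep Φ S s q) (P : Placement (remove q D) (insert q Anc) j) where
    private
      module P = Placement P

      pick′ : ∀ z → Dec (q ≡ z) → Fin n
      pick′ z (yes _) = Φ j z
      pick′ z (no _) = P.ψ z

      ψ : Fin k → Fin n
      ψ z = pick′ z (q ≟ z)

      classify : ∀ z → D z ≡ true → (q ≡ z × ψ z ≡ Φ j z) ⊎ (remove q D z ≡ true × ψ z ≡ P.ψ z)
      classify z Dz = on (q ≟ z)
        where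
        on : (d : Dec (q ≡ z)) → (q ≡ z × pick′ z d ≡ Φ j z) ⊎ (remove q D z ≡ true × pick′ z d ≡ P.ψ z)
        on (yes e) = inj₁ (e , refl)
        on (no e) = inj₂ (remove-intro q D Dz e , refl)

      -- Here the copy closes up. The queries at the image of `z` reveal `Φ i′ q` for some `i′`
      -- sharing that image with `i`. As `z` determines `q`, this is `Φ i q`, and it equals `Φ j q`
      -- because `q` was counted among the ancestors when `z` was placed.
      root-edge : ∀ z → remove q D z ≡ true → adj H z q ≡ true → Edge (P.ψ z) (Φ j q)
      root-edge z Rz a with P.source z Rz
      ... | i , Si , e , f , agree with advance z q Si (subst (Found 1) e f) a
      ...   | i′ , Si′ , e′ , _ , edge = subst₂ Edge (≡-sym e)
              (trans (dep z (proj₁ (remove-elim q D Rz)) i′ i Si′ Si e′)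
                     (agree q (dec-true (insert? q Anc q) (inj₂ refl)))) edge

      source : ∀ z → D z ≡ true → ∃ λ i → S i ≡ true × ψ z ≡ Φ i z × Found 1 (ψ z) × Agree Anc j i
      source z Dz with classify z Dz
      ... | inj₁ (refl , e) = j , Sj , e , subst (Found 1) (≡-sym e) found , λ _ _ → refl
      ... | inj₂ (Rz , e) with P.source z Rz
      ...   | i , Si , e′ , f , agree = i , Si , trans e e′ , subst (Found 1) (≡-sym e) f ,
              λ a Aa → agree a (dec-true (insert? q Anc a) (inj₁ Aa))

      edges : ∀ y z → D y ≡ true → D z ≡ true → adj H y z ≡ true → Edge (ψ y) (ψ z) ⊎ Edge (ψ z) (ψ y)
      edges y z Dy Dz a with classify y Dy | classify z Dz
      ... | inj₁ (refl , _) | inj₁ (refl , _) = true≢false a (irrefl H q)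
      ... | inj₁ (refl , e) | inj₂ (Rz , e′) = inj₂ (subst₂ Edge (≡-sym e′) (≡-sym e) (root-edge z Rz (adj-sym H a)))
      ... | inj₂ (Ry , e) | inj₁ (refl , e′) = inj₁ (subst₂ Edge (≡-sym e) (≡-sym e′) (root-edge y Ry a))
      ... | inj₂ (Ry , e) | inj₂ (Rz , e′) = subst₂ (λ s t → Edge s t ⊎ Edge t s) (≡-sym e) (≡-sym e′) (P.edges y z Ry Rz a)

    place-root : Placement D Anc j
    place-root = record { ψ = ψ ; source = source ; edges = edges }

  module _ (Z D Anc : Fin k → Bool) (i : Fin m) (closed : ∀ u w → D u ≡ true → Z w ≡ true → adj H u w ≡ true → D w ≡ true)
    (P : Placement D Anc i) (Q : Placement (minus Z D) Anc i) where
    private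
      module P = Placement P
      module Q = Placement Q

      pick′ : ∀ z → Dec (D z ≡ true) → Fin n
      pick′ z (yes _) = P.ψ z
      pick′ z (no _) = Q.ψ z

      ψ : Fin k → Fin n
      ψ z = pick′ z (D z B.≟ true)

      classify : ∀ z → Z z ≡ true → (D z ≡ true × ψ z ≡ P.ψ z) ⊎ (minus Z D z ≡ true × ψ z ≡ Q.ψ z)
      classify z Zz = on (D z B.≟ true)
        where
        on : (d : Dec (D z ≡ true)) → (D z ≡ true × pick′ z d ≡ P.ψ z) ⊎ (minus Z D z ≡ true × pick′ z d ≡ Q.ψ z)
        on (yes e) = inj₁ (e , refl)
        on (no e) = inj₂ (minus-intro Z D Zz e , refl)

      source : ∀ z → Z z ≡ true → ∃ λ j → S j ≡ true × ψ z ≡ Φ j z × Found 1 (ψ z) × Agree Anc i j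
      source z Zz with classify z Zz
      ... | inj₁ (Dz , e) = subst (λ a → ∃ λ j → S j ≡ true × a ≡ Φ j z × Found 1 a × Agree Anc i j) (≡-sym e) (P.source z Dz)
      ... | inj₂ (Rz , e) = subst (λ a → ∃ λ j → S j ≡ true × a ≡ Φ j z × Found 1 a × Agree Anc i j) (≡-sym e) (Q.source z Rz)

      edges : ∀ y z → Z y ≡ true → Z z ≡ true → adj H y z ≡ true → Edge (ψ y) (ψ z) ⊎ Edge (ψ z) (ψ y)
      edges y z Zy Zz a with classify y Zy | classify z Zz
      ... | inj₁ (Dy , e) | inj₁ (Dz , e′) = subst₂ (λ s t → Edge s t ⊎ Edge t s) (≡-sym e) (≡-sym e′) (P.edges y z Dy Dz a)
      ... | inj₁ (Dy , _) | inj₂ (Rz , _) = ⊥-elim (proj₂ (minus-elim Z D Rz) (closed y z Dy Zz a))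
      ... | inj₂ (Ry , _) | inj₁ (Dz , _) = ⊥-elim (proj₂ (minus-elim Z D Ry) (closed z y Dz Zy (adj-sym H a)))
      ... | inj₂ (Ry , e) | inj₂ (Rz , e′) = subst₂ (λ s t → Edge s t ⊎ Edge t s) (≡-sym e) (≡-sym e′) (Q.edges y z Ry Rz a)

    -- No edge of `H` joins `D` to the rest of `Z`, so the two placements need not be compatible
    -- beyond agreeing with the same `i` on the ancestors.
    place-both : Placement Z Anc i
    place-both = record { ψ = ψ ; source = source ; edges = edges }

  Placement-agree : ∀ {Z Anc i j} → Agree Anc i j → Placement Z Anc j → Placement Z Anc i
  Placement-agree ag P = record
    { ψ = P.ψ
    ; source = λ z Zz → let (j , Sj , e , f , ag′) = P.source z Zz in j , Sj , e , f , λ a Aa → trans (ag′ a Aa) (ag a Aa)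
    ; edges = P.edges }
    where module P = Placement P

  -- Every component of `H[Z]` contains a neighbour of `p`, so the search can enter each of them
  -- from the image of `p`.
  Touches : Fin k → (Fin k → Bool) → Set
  Touches p Z = ∀ z → Z z ≡ true → ∃ λ b → ∃ λ w → Walk H Z b z w × adj H p w ≡ true

  walk-closed : ∀ {Z D : Fin k → Bool} → (∀ u w → D u ≡ true → Z w ≡ true → adj H u w ≡ true → D w ≡ true) →
    ∀ {b x y} → D x ≡ true → Walk H Z b x y → D y ≡ true
  walk-closed closed Dx stop = Dx
  walk-closed closed Dx (hop a Zw r) = walk-closed closed (closed _ _ Dx Zw a) r

  walk-avoids : ∀ {Z D : Fin k → Bool} → (∀ u w → D u ≡ true → Z w ≡ true → adj H u w ≡ true → D w ≡ true) →
    ∀ {b x y} → Z x ≡ true → D x ≢ true → Walk H Z b x y → Walk H (minus Z D) b x y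
  walk-avoids closed Zx ¬Dx stop = stop
  walk-avoids {Z} {D} closed {x = x} Zx ¬Dx (hop {w = w} a Zw r) =
    hop a (minus-intro Z D Zw ¬Dw) (walk-avoids closed Zw ¬Dw r)
    where
    ¬Dw : D w ≢ true
    ¬Dw Dw = ¬Dx (closed w x Dw Zx (adj-sym H a))

  -- The walk is cut just before it first reaches `q`.
  walk-until : ∀ {D : Fin k → Bool} {q b z} → z ≢ q → Walk H D b z q → ∃ λ b → ∃ λ w → Walk H (remove q D) b z w × adj H q w ≡ true
  walk-until z≢q stop = ⊥-elim (z≢q refl)
  walk-until {D} {q} z≢q (hop {w = w} a Dw r) with q ≟ w
  ... | yes refl = 0 , _ , stop , adj-sym H a
  ... | no q≢w with walk-until (q≢w ∘ ≡-sym) r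
  ...   | b , t , r′ , a′ = suc b , t , hop a (remove-intro q D Dw q≢w) r′ , a′

  module _ (q : Fin k) (D Anc : Fin k → Bool)
    (conn : ∀ x y → D x ≡ true → D y ≡ true → Walk H D k x y)
    (depq : ∀ s → D s ≡ true → Dep Φ S s q)
    (dep : ∀ s a → D s ≡ true → Anc a ≡ true → Dep Φ S s a) where

    children-touch : D q ≡ true → Touches q (remove q D)
    children-touch Dq z Rz = walk-until (proj₂ (remove-elim q D Rz) ∘ ≡-sym) (conn z q (proj₁ (remove-elim q D Rz)) Dq)

    insert-dep : ∀ s a → D s ≡ true → insert q Anc a ≡ true → Dep Φ S s a
    insert-dep s a Ds p with does-true (insert? q Anc a) p
    ... | inj₁ Aa = dep s a Ds Aa
    ... | inj₂ refl = depq s Ds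

  -- Here `p` is the parent of the trees in `Z`. The step from `p` into a component changes the
  -- member, but `p` determines the ancestors, and the walk on to the root `q` preserves them. From
  -- `q`, now an ancestor itself, the children are explored with one forest level less.
  explore : ∀ {Z} → Forest H Φ S Z → ∀ s → count Z ≤ s → (Anc : Fin k → Bool) →
    (∀ z a → Z z ≡ true → Anc a ≡ true → Dep Φ S z a) → ∀ p → Touches p Z →
    (∀ a → Anc a ≡ true → Dep Φ S p a) →
    ∀ {i} → S i ≡ true → Found (budget k s) (Φ i p) → Placement Z Anc i
  explore (empty e) s _ Anc dep p touch pdep {i} Si f = record
    { ψ = Φ i ; source = λ z Zz → true≢false Zz (e z) ; edges = λ y z Zy → true≢false Zy (e y) }
  explore {Z} (tree q D D⊑Z Dq conn depq closed children rest) zero small Anc dep p touch pdep Si f =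
    ⊥-elim (<⇒≱ (0<count Z q (D⊑Z q Dq)) small)
  explore {Z} (tree q D D⊑Z Dq conn depq closed children rest) (suc s) small Anc dep p touch pdep {i} Si f
    with touch q (D⊑Z q Dq)
  ... | b , w , r , pw with advance p w Si f pw
  ...   | j₁ , Sj₁ , e₁ , f₁ , _
    -- The walk `r` may be long and only shows that `w` lies in `D`; the walk to the root is the one
    -- from `conn`, of length at most `k`.
    with follow D Anc (λ x a Dx → dep x a (D⊑Z x Dx)) (walk-closed closed Dq r) Sj₁
           (subst (λ b → Found b (Φ j₁ w)) (+-assoc k (s * suc k) 1) f₁) (conn w q (walk-closed closed Dq r) Dq)
  ...     | j₂ , Sj₂ , f₂ , agree = place-both Z D Anc i closed
    (Placement-agree (λ a Aa → trans (agree a Aa) (pdep a Aa j₁ i Sj₁ Si e₁))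
      (place-root q D Anc j₂ Sj₂ (Found-drop (s * suc k) f₂) depq
        (explore children s small′ (insert q Anc)
          (λ z a Rz → insert-dep q D Anc conn depq depD z a (proj₁ (remove-elim q D Rz)))
          q (children-touch q D Anc conn depq depD Dq)
          (λ a → insert-dep q D Anc conn depq depD q a Dq) Sj₂ f₂)))
    -- The other components start again from `p` with the full budget: the levels of the search
    -- serve all branches at once.
    (explore rest (suc s) (≤-trans (count-mono {S = minus Z D} {Z} (λ x p → proj₁ (minus-elim Z D p))) small) Anc
      (λ z a Rz → dep z a (proj₁ (minus-elim Z D Rz))) p
      (λ z Rz → let (Zz , ¬Dz) = minus-elim Z D Rz ; (b , w , r , a) = touch z Zz in b , w , walk-avoids closed Zz ¬Dz r , a)
      pdep Si f)
    where
    depD : ∀ x a → D x ≡ true → Anc a ≡ true → Dep Φ S x a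
    depD x a Dx = dep x a (D⊑Z x Dx)
    small′ : count (remove q D) ≤ s
    small′ = ≤-pred (≤-trans (count-mono-< (λ x p → D⊑Z x (proj₁ (remove-elim q D p))) q
      (¬true⇒false λ p → proj₂ (remove-elim q D p) refl) (D⊑Z q Dq)) small)

  Reach-closed : {P : Fin k → Set} {D : Fin k → Bool} → (∀ u w → D u ≡ true → adj H u w ≡ true → D w ≡ true) →
    ∀ {x y} → Reach H P x y → D x ≡ true → D y ≡ true
  Reach-closed closed here Dx = Dx
  Reach-closed closed (step a _ r) Dx = Reach-closed closed r (closed _ _ Dx a)

  -- As `H` is connected, the first component is all of `H`. The search may start at the image of
  -- any `u₀`: the first `k` levels lead to the root, and there are no ancestors to preserve yet.
  explore-all : Connected H → Forest H Φ S (λ _ → true) → ∀ u₀ {i} → S i ≡ true → Found (k + budget k k) (Φ i u₀) →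
    Σ (Fin k → Fin n) λ ψ → (∀ z → ∃ λ j → ψ z ≡ Φ j z × Found 1 (ψ z)) ×
      (∀ y z → adj H y z ≡ true → Edge (ψ y) (ψ z) ⊎ Edge (ψ z) (ψ y))
  explore-all _ (empty e) u₀ Si f = true≢false refl (e u₀)
  explore-all (_ , reach) (tree q D D⊑Z Dq conn depq closed children _) u₀ Si f
    with follow D (λ _ → false) (λ _ _ _ ()) (all u₀) Si f (conn u₀ q (all u₀) Dq)
    where
    all : ∀ x → D x ≡ true
    all x = Reach-closed (λ u w Du → closed u w Du refl) (reach q x) Dq
  ... | j , Sj , f₂ , _ = P.ψ , (λ z → let (j , _ , e , f , _) = P.source z (all z) in j , e , f) , λ y z → P.edges y z (all y) (all z)
    where
    all : ∀ x → D x ≡ true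
    all x = Reach-closed (λ u w Du → closed u w Du refl) (reach q x) Dq
    P : Placement D (λ _ → false) j
    P = place-root q D (λ _ → false) j Sj (Found-drop (k * suc k) f₂) depq
      (explore children k (count≤n _) (insert q (λ _ → false))
        (λ z a Rz → insert-dep q D (λ _ → false) conn depq (λ _ _ _ ()) z a (proj₁ (remove-elim q D Rz)))
        q (children-touch q D (λ _ → false) conn depq (λ _ _ _ ()) Dq)
        (λ a → insert-dep q D (λ _ → false) conn depq (λ _ _ _ ()) q a Dq) Sj f₂)
    module P = Placement P

-- Packing, coloring and pruning copies

-- Conditional expectations: the vertices are colored one after another, keeping the total weight
-- of the surviving members, where a member weighs k for each of its vertices colored so far.
module _ {m n k : ℕ} (Φ : Fin m → Fin k → Fin n) (inj : ∀ i u w → Φ i u ≡ Φ i w → u ≡ w) (0<k : 0 < k) where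
  private
    decided? : ∀ j i u → Dec (toℕ (Φ i u) < j)
    decided? j i u = toℕ (Φ i u) <? j

    decided : ℕ → Fin m → ℕ
    decided j i = count (λ u → does (decided? j i u))

    k^-mono : ∀ {a b} → a ≤ b → k ^ a ≤ k ^ b
    k^-mono = ^-monoʳ-≤ k {{>-nonZero 0<k}}

    weight : ℕ → (Fin m → Bool) → Fin m → ℕ
    weight j S i = bit (S i) * k ^ decided j i

    record Partial (j : ℕ) : Set where
      field
        χ     : Fin n → Fin k
        S     : Fin m → Bool
        right : ∀ i u → S i ≡ true → toℕ (Φ i u) < j → χ (Φ i u) ≡ u
        heavy : m ≤ sum (weight j S)

    start : Partial 0
    start = record
      { χ = λ _ → fromℕ< 0<k ; S = λ _ → true ; right = λ _ _ _ ()
      ; heavy = ≤-trans (≤-reflexive (≡-sym (trans (sum-const m 1) (*-identityʳ m))))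
                  (sum-mono λ i → ≤-trans (m^n>0 k {{>-nonZero 0<k}} (decided 0 i)) (≤-reflexive (≡-sym (*-identityˡ _)))) }

    extend : ∀ {j} → j < n → Partial j → Partial (suc j)
    extend {j} j<n P = record { χ = χ′ ; S = S′ c ; right = right′ ; heavy = ≤-trans P.heavy (proj₂ best) }
      where
      module P = Partial P
      v : Fin n
      v = fromℕ< j<n
      Fits : Fin k → Fin m → Set
      Fits c i = ∀ u → Φ i u ≡ v → u ≡ c
      fits? : ∀ c i → Dec (Fits c i)
      fits? c i = F.all? λ u → (Φ i u ≟ v) →-dec (u ≟ c)
      S′ : Fin k → Fin m → Bool
      S′ c = restrict P.S (fits? c)
      S′-intro : ∀ c i → Fits c i → bit (P.S i) ≤ bit (S′ c i)
      S′-intro c i f = bit-mono λ p → restrict-intro P.S (fits? c) p f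
      decided-mono : ∀ i → decided j i ≤ decided (suc j) i
      decided-mono i = count-mono λ u p → dec-true (decided? (suc j) i u) (m≤n⇒m≤1+n (does-true (decided? j i u) p))
      toℕ-v : toℕ v ≡ j
      toℕ-v = F.toℕ-fromℕ< j<n
      pointwise : ∀ i → k * weight j P.S i ≤ sum (λ c → weight (suc j) (S′ c) i)
      pointwise i with F.any? (λ u → Φ i u ≟ v)
      -- A member through `v` survives for the color `u` out of the `k` choices, but one more of its
      -- vertices is then decided, which multiplies its weight by `k`.
      ... | yes (u , e) = ≤-trans (≤-reflexive (eq k (bit (P.S i)) (k ^ decided j i)))
              (≤-trans (*-mono-≤ (S′-intro u i λ w e′ → inj i w u (trans e′ (≡-sym e)))
                                 (k^-mono {suc (decided j i)} (count-mono-<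
                                   (λ w p → dec-true (decided? (suc j) i w) (m≤n⇒m≤1+n (does-true (decided? j i w) p))) u
                                   (dec-false (decided? j i u) (λ p → <-irrefl (trans (cong toℕ e) toℕ-v) p))
                                   (dec-true (decided? (suc j) i u) (≤-reflexive (cong suc (trans (cong toℕ e) toℕ-v)))))))
                (term≤sum (λ c → weight (suc j) (S′ c) i) u))
        where eq : ∀ k b x → k * (b * x) ≡ b * (k * x)
              eq = solve-∀
      ... | no none = ≤-trans (≤-reflexive (≡-sym (sum-const k _)))
              (sum-mono λ c → *-mono-≤ (S′-intro c i λ w e → ⊥-elim (none (w , e))) (k^-mono (decided-mono i)))
      best : ∃ λ c → sum (weight j P.S) ≤ sum (weight (suc j) (S′ c))
      best = exceeds-somewhere (λ c → sum (weight (suc j) (S′ c))) (λ _ → sum (weight j P.S)) 0<k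
        (≤-trans (≤-reflexive (trans (sum-const k _) (*-distribˡ-sum k (weight j P.S))))
          (≤-trans (sum-mono pointwise) (≤-reflexive (∑-comm (λ i c → weight (suc j) (S′ c) i)))))
      c : Fin k
      c = proj₁ best
      χ′ : Fin n → Fin k
      χ′ x with x ≟ v
      ... | yes _ = c
      ... | no _ = P.χ x
      right′ : ∀ i u → S′ c i ≡ true → toℕ (Φ i u) < suc j → χ′ (Φ i u) ≡ u
      right′ i u p q with Φ i u ≟ v
      ... | yes e = ≡-sym (proj₂ (restrict-elim P.S (fits? c) {i} p) u e)
      ... | no ¬e = P.right i u (proj₁ (restrict-elim P.S (fits? c) {i} p))
              (≤∧≢⇒< (≤-pred q) λ e → ¬e (F.toℕ-injective (trans e (≡-sym toℕ-v))))

    upTo : ∀ j → j ≤ n → Partial j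
    upTo zero _ = start
    upTo (suc j) j<n = extend j<n (upTo j (<⇒≤ j<n))

  coloring : Σ (Fin n → Fin k) λ χ → Σ (Fin m → Bool) λ S →
    (∀ i u → S i ≡ true → χ (Φ i u) ≡ u) × m ≤ k ^ k * count S
  coloring = P.χ , P.S , (λ i u s → P.right i u s (F.toℕ<n (Φ i u))) ,
    ≤-trans P.heavy (≤-trans (sum-mono λ i → ≤-trans (*-monoʳ-≤ (bit (P.S i)) (k^-mono {decided n i} {k} (count≤n (λ u → does (decided? n i u))))) (≤-reflexive (*-comm (bit (P.S i)) _)))
      (≤-reflexive (≡-sym (*-distribˡ-sum (k ^ k) (bit ∘ P.S)))))
    where
    module P = Partial (upTo n ≤-refl)

-- `resp` is required because a function rebuilt from its values agrees with the original only
-- pointwise.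
anyFunction? : (P : (Fin k → Fin n) → Set) → (∀ f → Dec (P f)) → (∀ {f g} → (∀ x → f x ≡ g x) → P f → P g) → Dec (∃ P)
anyFunction? {zero} P P? resp = map′ (λ p → []ᶠ , p) (λ (f , p) → resp {f} {[]ᶠ} (λ ()) p) (P? []ᶠ)
anyFunction? {suc k} P P? resp = map′
  (λ (x , f , p) → (x ∷ᶠ f) , p)
  (λ (f , p) → f zero , f ∘ suc , resp (λ { zero → refl ; (suc _) → refl }) p)
  (F.any? λ x → anyFunction? (λ f → P (x ∷ᶠ f)) (λ f → P? (x ∷ᶠ f))
    (λ e → resp λ { zero → refl ; (suc y) → e y }))

injective? : (φ : Fin k → Fin n) → Dec (Injective _≡_ _≡_ φ)
injective? φ = map′ (λ h {x} {y} → h x y) (λ h x y → h) (F.all? λ x → F.all? λ y → (φ x ≟ φ y) →-dec (x ≟ y))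

copyOf? : (H : Graph k) (G : Graph n) → Dec (CopyOf H G)
copyOf? H G = anyFunction? _
  (λ φ → injective? φ ×-dec F.all? λ i → F.all? λ j → (adj H i j B.≟ true) →-dec (adj G (φ i) (φ j) B.≟ true))
  (λ e (inj , hom) → (λ p → inj (trans (e _) (trans p (≡-sym (e _))))) ,
     λ i j a → subst₂ (λ x y → adj G x y ≡ true) (e i) (e j) (hom i j a))

sumᴸ-tabulate : ∀ {A : Set} (f : A → ℕ) (g : Fin n → A) → sumᴸ (map f (tabulate g)) ≡ sum (f ∘ g)
sumᴸ-tabulate {zero} f g = refl
sumᴸ-tabulate {suc n} f g = cong (λ z → f (g zero) + z) (sumᴸ-tabulate f (g ∘ suc))

edgeCount≡ : (G : Graph n) → edgeCount G ≡ dsum (λ i j → if (toℕ i <ᵇ toℕ j) ∧ adj G i j then 1 else 0)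
edgeCount≡ {n} G = trans (sumᴸ-tabulate {n} _ (λ i → i)) (sum-cong-≗ {n} λ i → sumᴸ-tabulate {n} _ (λ j → j))

module _ (H : Graph k) (G : Graph n) (φ : Fin k → Fin n) where

  private
    Used : Fin n → Fin n → Set
    Used x y = ∃ λ u → ∃ λ w → adj H u w ≡ true × φ u ≡ x × φ w ≡ y

    used? : ∀ x y → Dec (Used x y)
    used? x y = F.any? λ u → F.any? λ w → (adj H u w B.≟ true) ×-dec (φ u ≟ x) ×-dec (φ w ≟ y)

    rest? : ∀ x y → Dec (adj G x y ≡ true × ¬ Used x y)
    rest? x y = (adj G x y B.≟ true) ×-dec ¬? (used? x y)

  deleteEdges : Graph n
  deleteEdges = fromRel rest?
    (λ (a , ¬u) → adj-sym G a , λ (u , w , b , p , q) → ¬u (w , u , adj-sym H b , q , p))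
    (λ (a , _) → adj⇒≢ G a refl)

  deleteEdges-⊆E : deleteEdges ⊆E G
  deleteEdges-⊆E x y p = proj₁ (does-true (rest? x y) p)

  deleteEdges-avoids : ∀ {u w} → adj H u w ≡ true → adj deleteEdges (φ u) (φ w) ≢ true
  deleteEdges-avoids {u} {w} a p = proj₂ (does-true (rest? (φ u) (φ w)) p) (u , w , a , refl , refl)

  -- Each deleted edge is an ordered pair of points of the image of `φ`. With `A` counting
  -- preimages, the products `A i * A j` cover these pairs and sum to `k * k`.
  edgeCount-deleteEdges : edgeCount G ≤ edgeCount deleteEdges + k * k
  edgeCount-deleteEdges = begin
    edgeCount G                       ≡⟨ edgeCount≡ G ⟩
    dsum (e G)                        ≤⟨ dsum-mono pointwise ⟩
    dsum (λ i j → e deleteEdges i j + A i * A j) ≡⟨ dsum-+ (e deleteEdges) (λ i j → A i * A j) ⟩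
    dsum (e deleteEdges) + dsum (λ i j → A i * A j)
      ≡⟨ cong₂ _+_ (≡-sym (edgeCount≡ deleteEdges)) (trans (sum-cong-≗ {n} λ i → ≡-sym (*-distribˡ-sum (A i) A))
           (trans (≡-sym (*-distribʳ-sum (sum A) A)) (cong₂ _*_ sum-A sum-A))) ⟩
    edgeCount deleteEdges + k * k     ∎
    where
    open ≤-Reasoning
    e : Graph n → Fin n → Fin n → ℕ
    e G i j = if (toℕ i <ᵇ toℕ j) ∧ adj G i j then 1 else 0
    A : Fin n → ℕ
    A i = sum λ u → [ φ u ≐ i ]
    sum-A : sum A ≡ k
    sum-A = trans (∑-comm λ i u → [ φ u ≐ i ])
      (trans (sum-cong-≗ {k} λ u → count-single (φ u)) (trans (sum-const k 1) (*-identityʳ k)))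
    1≤A : ∀ u {i} → φ u ≡ i → 1 ≤ A i
    1≤A u {i} p = ≤-trans (≤-reflexive (cong bit (≡-sym (dec-true (φ u ≟ i) p)))) (term≤sum (λ u → [ φ u ≐ i ]) u)
    indicator : ∀ b {g g′ x} → (g ≡ true → g′ ≡ false → 1 ≤ x) →
      (if b ∧ g then 1 else 0) ≤ (if b ∧ g′ then 1 else 0) + x
    indicator false h = z≤n
    indicator true {false} h = z≤n
    indicator true {true} {true} h = s≤s z≤n
    indicator true {true} {false} h = h refl refl
    pointwise : ∀ i j → e G i j ≤ e deleteEdges i j + A i * A j
    pointwise i j = indicator (toℕ i <ᵇ toℕ j) λ p q → removed p q (used? i j)
      where
      removed : adj G i j ≡ true → adj deleteEdges i j ≡ false → Dec (Used i j) → 1 ≤ A i * A j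
      removed p q (yes (u , w , _ , pu , pw)) = *-mono-≤ (1≤A u pu) (1≤A w pw)
      removed p q (no ¬used) = true≢false (dec-true (rest? i j) (p , ¬used)) q

-- Weaker than edge-disjointness: two copies may share an edge of G in different roles.
record Packing (H : Graph k) (G : Graph n) (m : ℕ) : Set where
  field
    Φ        : Fin m → Fin k → Fin n
    inj      : ∀ i u w → Φ i u ≡ Φ i w → u ≡ w
    hom      : ∀ i u w → adj H u w ≡ true → adj G (Φ i u) (Φ i w) ≡ true
    disjoint : ∀ i j u w → adj H u w ≡ true → Φ i u ≡ Φ j u → Φ i w ≡ Φ j w → i ≡ j

-- Greedy choice. The number of rounds is capped by `t` because for an edgeless `H` nothing gets
-- deleted and the choice would never stop.
packing : (H : Graph k) → ∀ t (G : Graph n) → ∃ λ m → Packing H G m ×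
  (m ≡ t ⊎ Σ (Graph n) λ G′ → G′ ⊆E G × Free H G′ × edgeCount G ≤ edgeCount G′ + m * (k * k))
packing H zero G = 0 , record { Φ = λ () ; inj = λ () ; hom = λ () ; disjoint = λ () } , inj₁ refl
packing {k} {n} H (suc t) G with copyOf? H G
... | no free = 0 , record { Φ = λ () ; inj = λ () ; hom = λ () ; disjoint = λ () } ,
        inj₂ (G , (λ _ _ p → p) , free , ≤-reflexive (≡-sym (+-identityʳ _)))
... | yes (φ , φ-inj , φ-hom) with packing H t (deleteEdges H G φ)
...   | m , P , result = suc m , P′ , result′ result
  where
  module P = Packing P
  P′ : Packing H G (suc m)
  P′ = record
    { Φ = φ ∷ᶠ P.Φ
    ; inj = λ { zero u w → φ-inj ; (suc i) → P.inj i }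
    ; hom = λ { zero → φ-hom ; (suc i) u w a → deleteEdges-⊆E H G φ _ _ (P.hom i u w a) }
    ; disjoint = λ { zero zero _ _ _ _ _ → refl
                   ; zero (suc j) u w a p q → ⊥-elim (clash j a p q)
                   ; (suc i) zero u w a p q → ⊥-elim (clash i a (≡-sym p) (≡-sym q))
                   ; (suc i) (suc j) u w a p q → cong suc (P.disjoint i j u w a p q) } }
    where
    clash : ∀ j {u w} → adj H u w ≡ true → φ u ≡ P.Φ j u → φ w ≢ P.Φ j w
    clash j {u} {w} a p q = deleteEdges-avoids H G φ a
      (subst₂ (λ x y → adj (deleteEdges H G φ) x y ≡ true) (≡-sym p) (≡-sym q) (P.hom j u w a))
  result′ : (m ≡ t ⊎ Σ (Graph n) λ G′ → G′ ⊆E deleteEdges H G φ × Free H G′ × edgeCount (deleteEdges H G φ) ≤ edgeCount G′ + m * (k * k)) →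
    suc m ≡ suc t ⊎ Σ (Graph n) λ G′ → G′ ⊆E G × Free H G′ × edgeCount G ≤ edgeCount G′ + suc m * (k * k)
  result′ (inj₁ e) = inj₁ (cong suc e)
  result′ (inj₂ (G′ , sub , free , size)) = inj₂ (G′ , (λ x y p → deleteEdges-⊆E H G φ x y (sub x y p)) , free ,
    ≤-trans (edgeCount-deleteEdges H G φ) (≤-trans (+-monoˡ-≤ (k * k) size)
      (≤-reflexive (trans (+-assoc (edgeCount G′) (m * (k * k)) (k * k)) (cong (λ z → edgeCount G′ + z) (+-comm (m * (k * k)) (k * k)))))))

through : (Fin m → Fin k → Fin n) → (Fin m → Bool) → Fin k → Fin n → Fin m → Bool
through Φ S q a = restrict S (λ j → Φ j q ≟ a)

-- Discard the members through a whenever they make up less than 1/N of the weight D a;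
-- each pair (q , a) is charged at most once.
module _ {m k n : ℕ} (Φ : Fin m → Fin k → Fin n) (D : Fin n → ℕ) (N : ℕ) where

  private
    alive? : ∀ (S : Fin m → Bool) q a → Dec (∃ λ i → S i ≡ true × Φ i q ≡ a)
    alive? S q a = F.any? λ i → (S i B.≟ true) ×-dec (Φ i q ≟ a)

    alive : (Fin m → Bool) → Fin k → Fin n → ℕ
    alive S q a = bit (does (alive? S q a))

    charge : (Fin m → Bool) → ℕ
    charge S = sum λ q → sum λ a → alive S q a * D a

    Pruned : ℕ → (Fin m → Bool) → Set
    Pruned X S = Σ (Fin m → Bool) λ S′ → S′ ⊑ S × X ≤ N * count S′ ×
      (∀ i q → S′ i ≡ true → D (Φ i q) ≤ N * count (through Φ S′ q (Φ i q)))

    -- The potential `charge` adds up `D a` over the pairs still in use. Discarding the members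
    -- through `a` kills the pair `(q , a)` and releases `D a`, which exceeds `N` times the number
    -- of members lost, so the invariant is kept.
    prune-from : ∀ s X S → count S ≤ s → X + charge S ≤ N * count S → Pruned X S
    prune-from s X S small big
      with F.any? (λ i → F.any? λ q → (S i B.≟ true) ×-dec (N * count (through Φ S q (Φ i q)) <? D (Φ i q)))
    ... | no none = S , (λ _ p → p) , ≤-trans (m≤m+n X _) big , λ i q Si → ≮⇒≥ λ p → none (i , q , Si , p)
    prune-from zero X S small big | yes (i , q , Si , few) = ⊥-elim (<⇒≱ (0<count S i Si) small)
    prune-from (suc s) X S small big | yes (i , q , Si , few) =
      let (S″ , sub , large , good) = prune-from s X S′ (≤-pred (≤-trans
            (count-mono-< S′⊑S i (¬true⇒false λ p → proj₂ (restrict-elim S (λ j → ¬? (Φ j q ≟ a)) {i} p) refl) Si) small)) big′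
      in S″ , ⊑-trans {S = S″} sub S′⊑S , large , good
      where
      a : Fin n
      a = Φ i q
      S′ : Fin m → Bool
      S′ = restrict S (λ j → ¬? (Φ j q ≟ a))
      S′⊑S : S′ ⊑ S
      S′⊑S j p = proj₁ (restrict-elim S (λ j → ¬? (Φ j q ≟ a)) p)
      alive-mono : ∀ q′ a′ → alive S′ q′ a′ ≤ alive S q′ a′
      alive-mono q′ a′ = bit-mono λ p → let (j , Sj , e) = does-true (alive? S′ q′ a′) p in
        dec-true (alive? S q′ a′) (j , S′⊑S j Sj , e)
      dead : alive S′ q a ≡ 0
      dead = cong bit (dec-false (alive? S′ q a) λ (j , Sj , e) → proj₂ (restrict-elim S (λ j → ¬? (Φ j q ≟ a)) Sj) e)
      live : alive S q a ≡ 1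
      live = cong bit (dec-true (alive? S q a) (i , Si , refl))
      pointwise : ∀ q′ a′ (d : Dec (q ≡ q′)) (d′ : Dec (a ≡ a′)) →
        alive S′ q′ a′ * D a′ + bit (does d) * (bit (does d′) * D a′) ≤ alive S q′ a′ * D a′
      pointwise q′ a′ (yes refl) (yes refl) rewrite dead | live = ≤-reflexive (*-identityˡ (1 * D a))
      pointwise q′ a′ (yes _) (no _) = ≤-trans (≤-reflexive (+-identityʳ _)) (*-monoˡ-≤ (D a′) (alive-mono q′ a′))
      pointwise q′ a′ (no _) _ = ≤-trans (≤-reflexive (+-identityʳ _)) (*-monoˡ-≤ (D a′) (alive-mono q′ a′))
      charge-drop : charge S′ + D a ≤ charge S
      charge-drop = begin
        charge S′ + D a
          ≡⟨ cong (λ z → charge S′ + z) (trans (sum-cong-≗ {k} λ q′ → trans (≡-sym (*-distribˡ-sum [ q ≐ q′ ] (λ a′ → [ a ≐ a′ ] * D a′)))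
               (cong ([ q ≐ q′ ] *_) (sum-select a D))) (sum-select q (λ _ → D a))) ⟨
        charge S′ + (sum λ q′ → sum λ a′ → [ q ≐ q′ ] * ([ a ≐ a′ ] * D a′))
          ≡⟨ trans (sum-cong-≗ {k} λ q′ → ∑-distrib-+ (λ a′ → alive S′ q′ a′ * D a′) _)
                   (∑-distrib-+ (λ q′ → sum λ a′ → alive S′ q′ a′ * D a′) _) ⟨
        (sum λ q′ → sum λ a′ → alive S′ q′ a′ * D a′ + [ q ≐ q′ ] * ([ a ≐ a′ ] * D a′))
          ≤⟨ sum-mono (λ q′ → sum-mono λ a′ → pointwise q′ a′ (q ≟ q′) (a ≟ a′)) ⟩
        charge S ∎
        where open ≤-Reasoning
      big′ : X + charge S′ ≤ N * count S′
      big′ = +-cancelʳ-≤ (D a) _ _ (begin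
        X + charge S′ + D a                           ≡⟨ +-assoc X _ _ ⟩
        X + (charge S′ + D a)                         ≤⟨ +-monoʳ-≤ X charge-drop ⟩
        X + charge S                                  ≤⟨ big ⟩
        N * count S                                   ≡⟨ cong (N *_) (count-split S (λ j → Φ j q ≟ a)) ⟩
        N * (count (through Φ S q a) + count S′)        ≡⟨ *-distribˡ-+ N (count (through Φ S q a)) _ ⟩
        N * count (through Φ S q a) + N * count S′      ≤⟨ +-monoˡ-≤ (N * count S′) (<⇒≤ few) ⟩
        D a + N * count S′                            ≡⟨ +-comm (D a) _ ⟩
        N * count S′ + D a                            ∎)
        where open ≤-Reasoning

  prune : ∀ X S → X + k * sum D ≤ N * count S → Σ (Fin m → Bool) λ S′ → S′ ⊑ S × X ≤ N * count S′ ×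
      (∀ i q → S′ i ≡ true → D (Φ i q) ≤ N * count (through Φ S′ q (Φ i q)))
  prune X S big = prune-from (count S) X S ≤-refl (≤-trans (+-monoʳ-≤ X charge≤) big)
    where
    charge≤ : charge S ≤ k * sum D
    charge≤ = ≤-trans (sum-mono {k} {g = λ _ → sum D} λ q → sum-mono λ a →
      ≤-trans (*-monoˡ-≤ (D a) (bit≤1 (does (alive? S q a)))) (≤-reflexive (*-identityˡ (D a)))) (≤-reflexive (sum-const k (sum D)))

-- Lower bounds on probabilities

ℕtoℚᵘ : ∀ m → ℚ.toℚᵘ (ℕtoℚ m) ℚᵘ.≃ ℚᵘ.mkℚᵘ (+ m) 0
ℕtoℚᵘ m = ℚ.toℚᵘ-fromℚᵘ (ℚᵘ.mkℚᵘ (+ m) 0)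

ℕtoℚ-+ : ∀ a b → ℕtoℚ (a + b) ≡ ℕtoℚ a ℚ.+ ℕtoℚ b
ℕtoℚ-+ a b = ℚ.toℚᵘ-injective (begin
  ℚ.toℚᵘ (ℕtoℚ (a + b))                        ≈⟨ ℕtoℚᵘ (a + b) ⟩
  ℚᵘ.mkℚᵘ (+ (a + b)) 0                        ≈⟨ ℚᵘ.*≡* (cong (ℤ._* + 1) (cong₂ ℤ._+_ (ℤ.*-identityʳ (+ a)) (ℤ.*-identityʳ (+ b)))) ⟨
  ℚᵘ.mkℚᵘ (+ a) 0 ℚᵘ.+ ℚᵘ.mkℚᵘ (+ b) 0         ≈⟨ ℚᵘ.+-cong (ℕtoℚᵘ a) (ℕtoℚᵘ b) ⟨
  ℚ.toℚᵘ (ℕtoℚ a) ℚᵘ.+ ℚ.toℚᵘ (ℕtoℚ b)         ≈⟨ ℚ.toℚᵘ-homo-+ (ℕtoℚ a) (ℕtoℚ b) ⟨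
  ℚ.toℚᵘ (ℕtoℚ a ℚ.+ ℕtoℚ b)                   ∎)
  where open ℚᵘ.≃-Reasoning

ℕtoℚ-* : ∀ a b → ℕtoℚ (a * b) ≡ ℕtoℚ a ℚ.* ℕtoℚ b
ℕtoℚ-* a b = ℚ.toℚᵘ-injective (begin
  ℚ.toℚᵘ (ℕtoℚ (a * b))                        ≈⟨ ℕtoℚᵘ (a * b) ⟩
  ℚᵘ.mkℚᵘ (+ (a * b)) 0                        ≈⟨ ℚᵘ.*≡* (cong (ℤ._* + 1) (ℤ.pos-* a b)) ⟩
  ℚᵘ.mkℚᵘ (+ a) 0 ℚᵘ.* ℚᵘ.mkℚᵘ (+ b) 0         ≈⟨ ℚᵘ.*-cong (ℕtoℚᵘ a) (ℕtoℚᵘ b) ⟨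
  ℚ.toℚᵘ (ℕtoℚ a) ℚᵘ.* ℚ.toℚᵘ (ℕtoℚ b)         ≈⟨ ℚ.toℚᵘ-homo-* (ℕtoℚ a) (ℕtoℚ b) ⟨
  ℚ.toℚᵘ (ℕtoℚ a ℚ.* ℕtoℚ b)                   ∎)
  where open ℚᵘ.≃-Reasoning

ℕtoℚ-mono : ∀ {a b} → a ≤ b → ℕtoℚ a ℚ.≤ ℕtoℚ b
ℕtoℚ-mono {a} {b} p = ℚ.toℚᵘ-cancel-≤ (begin
  ℚ.toℚᵘ (ℕtoℚ a)   ≃⟨ ℕtoℚᵘ a ⟩
  ℚᵘ.mkℚᵘ (+ a) 0   ≤⟨ ℚᵘ.*≤* (subst₂ ℤ._≤_ (≡-sym (ℤ.*-identityʳ (+ a))) (≡-sym (ℤ.*-identityʳ (+ b))) (ℤ.+≤+ p)) ⟩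
  ℚᵘ.mkℚᵘ (+ b) 0   ≃⟨ ℕtoℚᵘ b ⟨
  ℚ.toℚᵘ (ℕtoℚ b)   ∎)
  where open ℚᵘ.≤-Reasoning

ℕtoℚ-cancel-< : ∀ {a b} → ℕtoℚ a ℚ.< ℕtoℚ b → a < b
ℕtoℚ-cancel-< {a} {b} p = ≰⇒> λ q → ℚ.<-irrefl refl (ℚ.<-≤-trans p (ℕtoℚ-mono q))

ℕtoℚ-positive : ∀ {m} → 0 < m → ℚ.Positive (ℕtoℚ m)
ℕtoℚ-positive {m} p = ℚ.positive (ℚ.<-≤-trans (ℚ.*<* (ℤ.+<+ (s≤s z≤n))) (ℕtoℚ-mono p))

-- inv 0 is a junk value.
inv : ℕ → ℚ
inv zero = 0ℚ
inv (suc m) = + 1 / suc m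

inv-inverse : ∀ {m} → 0 < m → ℕtoℚ m ℚ.* inv m ≡ 1ℚ
inv-inverse {suc m} _ = ℚ.toℚᵘ-injective (begin
  ℚ.toℚᵘ (ℕtoℚ (suc m) ℚ.* inv (suc m))                  ≈⟨ ℚ.toℚᵘ-homo-* (ℕtoℚ (suc m)) (inv (suc m)) ⟩
  ℚ.toℚᵘ (ℕtoℚ (suc m)) ℚᵘ.* ℚ.toℚᵘ (inv (suc m))        ≈⟨ ℚᵘ.*-cong (ℕtoℚᵘ (suc m)) (ℚ.toℚᵘ-fromℚᵘ (ℚᵘ.mkℚᵘ (+ 1) m)) ⟩
  ℚᵘ.mkℚᵘ (+ suc m) 0 ℚᵘ.* ℚᵘ.mkℚᵘ (+ 1) m               ≈⟨ ℚᵘ.*≡* (cong (λ x → + suc x) (eq m)) ⟩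
  ℚᵘ.mkℚᵘ (+ 1) 0                                        ∎)
  where
  open ℚᵘ.≃-Reasoning
  eq : ∀ m → m * 1 * 1 ≡ m + 0 + 0
  eq = solve-∀

0≤inv : ∀ m → 0ℚ ℚ.≤ inv m
0≤inv zero = ℚ.≤-refl
0≤inv (suc m) = ℚ.nonNegative⁻¹ (inv (suc m)) {{ℚ.normalize-nonNeg 1 (suc m)}}

inv-nonNegative : ∀ m → ℚ.NonNegative (inv m)
inv-nonNegative m = ℚ.nonNegative (0≤inv m)

≤⇒inv≤ : ∀ {m p} → 0 < m → 1ℚ ℚ.≤ ℕtoℚ m ℚ.* p → inv m ℚ.≤ p
≤⇒inv≤ {m} {p} 0<m h = ℚ.*-cancelˡ-≤-pos (ℕtoℚ m) {{ℕtoℚ-positive 0<m}}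
  (ℚ.≤-trans (ℚ.≤-reflexive (inv-inverse 0<m)) h)

inv-antitone : ∀ {a b} → 0 < a → a ≤ b → inv b ℚ.≤ inv a
inv-antitone {a} {b} 0<a a≤b = ≤⇒inv≤ (≤-trans 0<a a≤b)
  (ℚ.≤-trans (ℚ.≤-reflexive (≡-sym (inv-inverse 0<a))) (ℚ.*-monoʳ-≤-nonNeg (inv a) {{inv-nonNegative a}} (ℕtoℚ-mono a≤b)))

inv≤1 : ∀ m → inv m ℚ.≤ 1ℚ
inv≤1 zero = ℚ.*≤* (ℤ.+≤+ z≤n)
inv≤1 (suc m) = inv-antitone {1} {suc m} (s≤s z≤n) (s≤s z≤n)

inv-* : ∀ {a b} → 0 < a → 0 < b → inv (a * b) ≡ inv a ℚ.* inv b
inv-* {a} {b} 0<a 0<b = begin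
  inv (a * b)                                                ≡⟨ ℚ.*-identityʳ _ ⟨
  inv (a * b) ℚ.* 1ℚ                                         ≡⟨ cong (inv (a * b) ℚ.*_) (trans (cong₂ ℚ._*_ (inv-inverse 0<a) (inv-inverse 0<b)) (ℚ.*-identityʳ 1ℚ)) ⟨
  inv (a * b) ℚ.* (ℕtoℚ a ℚ.* inv a ℚ.* (ℕtoℚ b ℚ.* inv b))  ≡⟨ rearrange (inv (a * b)) (ℕtoℚ a) (inv a) (ℕtoℚ b) (inv b) ⟩
  ℕtoℚ a ℚ.* ℕtoℚ b ℚ.* inv (a * b) ℚ.* (inv a ℚ.* inv b)    ≡⟨ cong (λ z → z ℚ.* inv (a * b) ℚ.* (inv a ℚ.* inv b)) (ℕtoℚ-* a b) ⟨
  ℕtoℚ (a * b) ℚ.* inv (a * b) ℚ.* (inv a ℚ.* inv b)         ≡⟨ cong (ℚ._* (inv a ℚ.* inv b)) (inv-inverse (*-mono-≤ 0<a 0<b)) ⟩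
  1ℚ ℚ.* (inv a ℚ.* inv b)                                   ≡⟨ ℚ.*-identityˡ _ ⟩
  inv a ℚ.* inv b                                            ∎
  where
  open ≡-Reasoning
  open +-*-Solver using (solve; _:*_; _:=_)
  rearrange : ∀ z a a′ b b′ → z ℚ.* (a ℚ.* a′ ℚ.* (b ℚ.* b′)) ≡ a ℚ.* b ℚ.* z ℚ.* (a′ ℚ.* b′)
  rearrange = solve 5 (λ z a a′ b b′ → z :* (a :* a′ :* (b :* b′)) := a :* b :* z :* (a′ :* b′)) refl

average : ∀ k → (Fin (suc k) → ℚ) → ℚ
average k q = (+ 1) / suc k ℚ.* sumℚ (suc k) q

sumℚ-mono : ∀ m {q r : Fin m → ℚ} → (∀ i → q i ℚ.≤ r i) → sumℚ m q ℚ.≤ sumℚ m r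
sumℚ-mono zero h = ℚ.≤-refl
sumℚ-mono (suc m) h = ℚ.+-mono-≤ (h zero) (sumℚ-mono m (h ∘ suc))

average-mono : ∀ k {q r : Fin (suc k) → ℚ} → (∀ i → q i ℚ.≤ r i) → average k q ℚ.≤ average k r
average-mono k h = ℚ.*-monoˡ-≤-nonNeg (inv (suc k)) {{inv-nonNegative (suc k)}} (sumℚ-mono (suc k) h)

sumℚ-ℕ : ∀ m (f : Fin m → ℕ) → sumℚ m (λ i → ℕtoℚ (f i)) ≡ ℕtoℚ (sum f)
sumℚ-ℕ zero f = refl
sumℚ-ℕ (suc m) f = trans (cong (ℕtoℚ (f zero) ℚ.+_) (sumℚ-ℕ m (f ∘ suc))) (≡-sym (ℕtoℚ-+ (f zero) _))

sumℚ-affine : ∀ m s c (q : Fin m → ℚ) → sumℚ m (λ i → s ℚ.+ q i ℚ.* c) ≡ ℕtoℚ m ℚ.* s ℚ.+ sumℚ m q ℚ.* c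
sumℚ-affine zero s c q = ≡-sym (trans (cong₂ ℚ._+_ (ℚ.*-zeroˡ s) (ℚ.*-zeroˡ c)) (ℚ.+-identityˡ 0ℚ))
sumℚ-affine (suc m) s c q = begin
  s ℚ.+ q zero ℚ.* c ℚ.+ sumℚ m (λ i → s ℚ.+ q (suc i) ℚ.* c)
    ≡⟨ cong (s ℚ.+ q zero ℚ.* c ℚ.+_) (sumℚ-affine m s c (q ∘ suc)) ⟩
  s ℚ.+ q zero ℚ.* c ℚ.+ (ℕtoℚ m ℚ.* s ℚ.+ sumℚ m (q ∘ suc) ℚ.* c)
    ≡⟨ eq s c (q zero) (ℕtoℚ m) (sumℚ m (q ∘ suc)) ⟩
  (1ℚ ℚ.+ ℕtoℚ m) ℚ.* s ℚ.+ (q zero ℚ.+ sumℚ m (q ∘ suc)) ℚ.* c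
    ≡⟨ cong (λ z → z ℚ.* s ℚ.+ (q zero ℚ.+ sumℚ m (q ∘ suc)) ℚ.* c) (ℕtoℚ-+ 1 m) ⟨
  ℕtoℚ (suc m) ℚ.* s ℚ.+ sumℚ (suc m) q ℚ.* c ∎
  where
  open ≡-Reasoning
  open +-*-Solver using (solve; _:*_; _:+_; _:=_; con)
  eq : ∀ s c x m t → s ℚ.+ x ℚ.* c ℚ.+ (m ℚ.* s ℚ.+ t ℚ.* c) ≡ (1ℚ ℚ.+ m) ℚ.* s ℚ.+ (x ℚ.+ t) ℚ.* c
  eq = solve 5 (λ s c x m t → s :+ x :* c :+ (m :* s :+ t :* c) := (con 1ℚ :+ m) :* s :+ (x :+ t) :* c) refl

average-affine : ∀ k s c (q : Fin (suc k) → ℚ) → average k (λ i → s ℚ.+ q i ℚ.* c) ≡ s ℚ.+ average k q ℚ.* c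
average-affine k s c q = begin
  inv (suc k) ℚ.* sumℚ (suc k) (λ i → s ℚ.+ q i ℚ.* c)
    ≡⟨ cong (inv (suc k) ℚ.*_) (sumℚ-affine (suc k) s c q) ⟩
  inv (suc k) ℚ.* (ℕtoℚ (suc k) ℚ.* s ℚ.+ sumℚ (suc k) q ℚ.* c)
    ≡⟨ eq (inv (suc k)) (ℕtoℚ (suc k)) s (sumℚ (suc k) q) c ⟩
  (ℕtoℚ (suc k) ℚ.* inv (suc k)) ℚ.* s ℚ.+ average k q ℚ.* c
    ≡⟨ cong (λ z → z ℚ.* s ℚ.+ average k q ℚ.* c) (inv-inverse {suc k} (s≤s z≤n)) ⟩
  1ℚ ℚ.* s ℚ.+ average k q ℚ.* c
    ≡⟨ cong (ℚ._+ average k q ℚ.* c) (ℚ.*-identityˡ s) ⟩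
  s ℚ.+ average k q ℚ.* c ∎
  where
  open ≡-Reasoning
  open +-*-Solver using (solve; _:*_; _:+_; _:=_)
  eq : ∀ v n s t c → v ℚ.* (n ℚ.* s ℚ.+ t ℚ.* c) ≡ (n ℚ.* v) ℚ.* s ℚ.+ v ℚ.* t ℚ.* c
  eq = solve 5 (λ v n s t c → v :* (n :* s :+ t :* c) := (n :* v) :* s :+ v :* t :* c) refl

average-const : ∀ k s → average k (λ _ → s) ≡ s
average-const k s = begin
  average k (λ _ → s)                     ≡⟨ cong (λ z → average k (λ _ → z)) (trans (cong (s ℚ.+_) (ℚ.*-zeroˡ 0ℚ)) (ℚ.+-identityʳ s)) ⟨
  average k (λ _ → s ℚ.+ 0ℚ ℚ.* 0ℚ)       ≡⟨ average-affine k s 0ℚ (λ _ → 0ℚ) ⟩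
  s ℚ.+ average k (λ _ → 0ℚ) ℚ.* 0ℚ       ≡⟨ trans (cong (s ℚ.+_) (ℚ.*-zeroʳ (average k (λ _ → 0ℚ)))) (ℚ.+-identityʳ s) ⟩
  s                                       ∎
  where open ≡-Reasoning

-- A certificate for a lower bound: any branch can be given up by `trivially`, whereas `Mass` has to
-- settle `P` at every leaf.
data AtLeast {A : Set} (P : A → Set) : Rand A → ℚ → Set where
  surely : ∀ {a p} → P a → p ℚ.≤ 1ℚ → AtLeast P (ret a) p
  trivially   : ∀ {r p} → p ℚ.≤ 0ℚ → AtLeast P r p
  mixture : ∀ {k f p} (q : Fin (suc k) → ℚ) → (∀ i → AtLeast P (f i) (q i)) → p ℚ.≤ average k q → AtLeast P (pick k f) p

module _ {A : Set} {P : A → Set} where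

  AtLeast-weaken : ∀ {r p p′} → p′ ℚ.≤ p → AtLeast P r p → AtLeast P r p′
  AtLeast-weaken h (surely x b) = surely x (ℚ.≤-trans h b)
  AtLeast-weaken h (trivially b) = trivially (ℚ.≤-trans h b)
  AtLeast-weaken h (mixture q x b) = mixture q x (ℚ.≤-trans h b)

  AtLeast-all : (∀ a → P a) → ∀ r {p} → p ℚ.≤ 1ℚ → AtLeast P r p
  AtLeast-all all (ret a) h = surely (all a) h
  AtLeast-all all (pick k f) h = mixture (λ _ → 1ℚ) (λ i → AtLeast-all all (f i) ℚ.≤-refl)
    (ℚ.≤-trans h (ℚ.≤-reflexive (≡-sym (average-const k 1ℚ))))

  AtLeast-mono : {Q : A → Set} → (∀ a → P a → Q a) → ∀ {r p} → AtLeast P r p → AtLeast Q r p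
  AtLeast-mono h (surely x b) = surely (h _ x) b
  AtLeast-mono h (trivially b) = trivially b
  AtLeast-mono h (mixture q x b) = mixture q (λ i → AtLeast-mono h (x i)) b

  Mass-nonneg : ∀ {r q} → Mass P r q → 0ℚ ℚ.≤ q
  Mass-nonneg (leaf-yes _) = ℚ.*≤* (ℤ.+≤+ z≤n)
  Mass-nonneg (leaf-no _) = ℚ.≤-refl
  Mass-nonneg (node {k} q h) = ℚ.≤-trans (ℚ.≤-reflexive (≡-sym (average-const k 0ℚ)))
    (average-mono k (λ i → Mass-nonneg (h i)))

  AtLeast⇒≤Mass : ∀ {r p q} → AtLeast P r p → Mass P r q → p ℚ.≤ q
  AtLeast⇒≤Mass (surely _ b) (leaf-yes _) = b
  AtLeast⇒≤Mass (surely x _) (leaf-no ¬x) = ⊥-elim (¬x x)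
  AtLeast⇒≤Mass (trivially b) m = ℚ.≤-trans b (Mass-nonneg m)
  AtLeast⇒≤Mass (mixture {k} q x b) (node q′ h) = ℚ.≤-trans b (average-mono k (λ i → AtLeast⇒≤Mass (x i) (h i)))

  Mass-exists : (∀ a → Dec (P a)) → ∀ r → ∃ (Mass P r)
  Mass-exists P? (ret a) with P? a
  ... | yes p = 1ℚ , leaf-yes p
  ... | no ¬p = 0ℚ , leaf-no ¬p
  Mass-exists P? (pick k f) = _ , node (λ i → proj₁ (Mass-exists P? (f i))) (λ i → proj₂ (Mass-exists P? (f i)))

module _ {A B : Set} {Q : B → Set} where

  AtLeast-const : ∀ {s} {f : A → Rand B} → (∀ a → AtLeast Q (f a) s) → ∀ r → AtLeast Q (r >>= f) s
  AtLeast-const h (ret a) = h a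
  AtLeast-const {s} h (pick k g) = mixture (λ _ → s) (λ i → AtLeast-const h (g i)) (ℚ.≤-reflexive (≡-sym (average-const k s)))

  -- With s = 0 this is the product rule; in general a failure of P still leaves probability s.
  AtLeast-bind : ∀ {P : A → Set} {r p s c} {f : A → Rand B} → ℚ.NonNegative c → AtLeast P r p →
    (∀ a → P a → AtLeast Q (f a) (s ℚ.+ c)) → (∀ a → AtLeast Q (f a) s) →
    AtLeast Q (r >>= f) (s ℚ.+ p ℚ.* c)
  AtLeast-bind {p = p} {s} {c} c≥0 (surely {a = a} x b) hit miss =
    AtLeast-weaken (ℚ.+-monoʳ-≤ s (ℚ.≤-trans (ℚ.*-monoʳ-≤-nonNeg c {{c≥0}} b) (ℚ.≤-reflexive (ℚ.*-identityˡ c)))) (hit a x)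
  AtLeast-bind {r = r} {s = s} {c} c≥0 (trivially b) hit miss =
    AtLeast-weaken (ℚ.≤-trans (ℚ.+-monoʳ-≤ s (ℚ.≤-trans (ℚ.*-monoʳ-≤-nonNeg c {{c≥0}} b) (ℚ.≤-reflexive (ℚ.*-zeroˡ c))))
                     (ℚ.≤-reflexive (ℚ.+-identityʳ s))) (AtLeast-const miss r)
  AtLeast-bind {s = s} {c} c≥0 (mixture {k} q x b) hit miss =
    mixture (λ i → s ℚ.+ q i ℚ.* c) (λ i → AtLeast-bind c≥0 (x i) hit miss)
      (ℚ.≤-trans (ℚ.+-monoʳ-≤ s (ℚ.*-monoʳ-≤-nonNeg c {{c≥0}} b)) (ℚ.≤-reflexive (≡-sym (average-affine k s c q))))

-- With reciprocals of natural numbers as bounds, the constants can be computed in `ℕ`.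
Likely : {A : Set} → ℕ → (A → Set) → Rand A → Set
Likely N P r = AtLeast P r (inv N)

module _ {A B : Set} {P : A → Set} {Q : B → Set} where

  Likely-bind : ∀ {M N r} {f : A → Rand B} → 0 < M → 0 < N → Likely M P r → (∀ a → P a → Likely N Q (f a)) →
    Likely (M * N) Q (r >>= f)
  Likely-bind {M} {N} 0<M 0<N x y = AtLeast-weaken
    (ℚ.≤-reflexive (trans (inv-* 0<M 0<N) (≡-sym (ℚ.+-identityˡ _))))
    (AtLeast-bind {s = 0ℚ} (inv-nonNegative N) x
      (λ a p → AtLeast-weaken (ℚ.≤-reflexive (ℚ.+-identityˡ (inv N))) (y a p)) (λ a → trivially ℚ.≤-refl))

  AtLeast-then : ∀ {p r} {f : A → Rand B} → AtLeast P r p → (∀ a → P a → AtLeast Q (f a) 1ℚ) → AtLeast Q (r >>= f) p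
  AtLeast-then {p} x h = AtLeast-weaken
    (ℚ.≤-reflexive (trans (≡-sym (ℚ.*-identityʳ p)) (≡-sym (ℚ.+-identityˡ _))))
    (AtLeast-bind {s = 0ℚ} (ℚ.nonNegative {1ℚ} (ℚ.*≤* (ℤ.+≤+ z≤n))) x
      (λ a p → AtLeast-weaken (ℚ.≤-reflexive (ℚ.+-identityˡ 1ℚ)) (h a p)) (λ a → trivially ℚ.≤-refl))

Likely-weaken : ∀ {A : Set} {P : A → Set} {M N r} → 0 < M → M ≤ N → Likely M P r → Likely N P r
Likely-weaken 0<M M≤N = AtLeast-weaken (inv-antitone 0<M M≤N)

Likely-pick : ∀ {A : Set} {P : A → Set} {k} (g : Fin (suc k) → A) (hit : Fin (suc k) → Bool) N → 0 < N →
  (∀ i → hit i ≡ true → P (g i)) → suc k ≤ N * count hit → Likely N P (pick k (λ i → ret (g i)))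
Likely-pick {k = k} g hit N 0<N ok many = mixture (λ i → ℕtoℚ (bit (hit i)))
  (λ i → byBool (hit i)
    (λ p → surely (ok i p) (ℚ.≤-trans (ℕtoℚ-mono (bit≤1 (hit i))) ℚ.≤-refl))
    (λ p → trivially (ℚ.≤-reflexive (cong (λ b → ℕtoℚ (bit b)) p))))
  (≤⇒inv≤ 0<N (begin
    1ℚ                                                     ≡⟨ inv-inverse {suc k} (s≤s z≤n) ⟨
    ℕtoℚ (suc k) ℚ.* inv (suc k)                           ≤⟨ ℚ.*-monoʳ-≤-nonNeg (inv (suc k)) {{inv-nonNegative (suc k)}} (ℕtoℚ-mono many) ⟩
    ℕtoℚ (N * count hit) ℚ.* inv (suc k)                   ≡⟨ cong (ℚ._* inv (suc k)) (ℕtoℚ-* N (count hit)) ⟩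
    ℕtoℚ N ℚ.* ℕtoℚ (count hit) ℚ.* inv (suc k)            ≡⟨ trans (ℚ.*-assoc (ℕtoℚ N) _ _) (cong (ℕtoℚ N ℚ.*_)
                                                                (trans (ℚ.*-comm _ (inv (suc k)))
                                                                  (cong (inv (suc k) ℚ.*_) (≡-sym (sumℚ-ℕ (suc k) (bit ∘ hit)))))) ⟩
    ℕtoℚ N ℚ.* average k (λ i → ℕtoℚ (bit (hit i)))        ∎))
  where open ℚ.≤-Reasoning

-- This is `1 - (1 - p) ^ t`, written in the recursive form in which repeated runs produce it.
amplify : ℚ → ℕ → ℚ
amplify p zero = 0ℚ
amplify p (suc t) = amplify p t ℚ.+ p ℚ.* (1ℚ ℚ.- amplify p t)

module _ (M : ℕ) (0<M : 0 < M) where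
  private
    s : ℕ → ℚ
    s = amplify (inv M)
    open +-*-Solver using (solve; _:*_; _:+_; _:-_; _:=_; con)

  amplify≤1 : ∀ t → s t ℚ.≤ 1ℚ
  1-amplify : ∀ t → 0ℚ ℚ.≤ 1ℚ ℚ.- s t

  1-amplify t = ℚ.≤-trans (ℚ.≤-reflexive (≡-sym (ℚ.+-inverseʳ (s t)))) (ℚ.+-monoˡ-≤ (ℚ.- s t) (amplify≤1 t))

  amplify≤1 zero = ℚ.*≤* (ℤ.+≤+ z≤n)
  amplify≤1 (suc t) = begin
    s t ℚ.+ inv M ℚ.* (1ℚ ℚ.- s t)  ≤⟨ ℚ.+-monoʳ-≤ (s t) (ℚ.*-monoʳ-≤-nonNeg (1ℚ ℚ.- s t) {{ℚ.nonNegative (1-amplify t)}} (inv≤1 M)) ⟩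
    s t ℚ.+ 1ℚ ℚ.* (1ℚ ℚ.- s t)     ≡⟨ solve 1 (λ x → x :+ con 1ℚ :* (con 1ℚ :- x) := con 1ℚ) refl (s t) ⟩
    1ℚ                              ∎
    where open ℚ.≤-Reasoning

  -- Equivalently, `(1 - 1 / M) ^ t` is at most `M / (M + t)`. This rational bound takes the place
  -- of an exponential estimate.
  amplify-bound : ∀ t → ℕtoℚ t ℚ.≤ ℕtoℚ (M + t) ℚ.* s t
  amplify-bound zero = ℚ.≤-reflexive (≡-sym (ℚ.*-zeroʳ (ℕtoℚ (M + 0))))
  amplify-bound (suc t) = begin
    ℕtoℚ (suc t)                                               ≡⟨ ℕtoℚ-+ 1 t ⟩
    1ℚ ℚ.+ ℕtoℚ t                                              ≤⟨ ℚ.+-monoʳ-≤ 1ℚ (amplify-bound t) ⟩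
    1ℚ ℚ.+ ℕtoℚ (M + t) ℚ.* x                                  ≡⟨ cong (λ z → 1ℚ ℚ.+ z ℚ.* x) (ℕtoℚ-+ M t) ⟩
    1ℚ ℚ.+ (M′ ℚ.+ t′) ℚ.* x                                    ≡⟨ solve 3 (λ m t x → con 1ℚ :+ (m :+ t) :* x := (con 1ℚ :+ m :+ t) :* x :+ con 1ℚ :* (con 1ℚ :- x)) refl M′ t′ x ⟩
    (1ℚ ℚ.+ M′ ℚ.+ t′) ℚ.* x ℚ.+ 1ℚ ℚ.* (1ℚ ℚ.- x)              ≡⟨ cong (λ z → (1ℚ ℚ.+ M′ ℚ.+ t′) ℚ.* x ℚ.+ z ℚ.* (1ℚ ℚ.- x)) (inv-inverse 0<M) ⟨
    (1ℚ ℚ.+ M′ ℚ.+ t′) ℚ.* x ℚ.+ M′ ℚ.* p ℚ.* (1ℚ ℚ.- x)         ≤⟨ ℚ.+-monoʳ-≤ ((1ℚ ℚ.+ M′ ℚ.+ t′) ℚ.* x) (ℚ.*-monoʳ-≤-nonNeg (1ℚ ℚ.- x) {{ℚ.nonNegative (1-amplify t)}}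
                                                                    (ℚ.*-monoʳ-≤-nonNeg p {{inv-nonNegative M}} (ℚ.≤-trans (ℕtoℚ-mono (≤-trans (m≤m+n M t) (n≤1+n _))) (ℚ.≤-reflexive split)))) ⟩
    (1ℚ ℚ.+ M′ ℚ.+ t′) ℚ.* x ℚ.+ (1ℚ ℚ.+ M′ ℚ.+ t′) ℚ.* p ℚ.* (1ℚ ℚ.- x)
                                                               ≡⟨ solve 3 (λ n x p → n :* x :+ n :* p :* (con 1ℚ :- x) := n :* (x :+ p :* (con 1ℚ :- x))) refl (1ℚ ℚ.+ M′ ℚ.+ t′) x p ⟩
    (1ℚ ℚ.+ M′ ℚ.+ t′) ℚ.* s (suc t)                            ≡⟨ cong (ℚ._* s (suc t)) (trans (≡-sym split) (cong ℕtoℚ (≡-sym (+-suc M t)))) ⟩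
    ℕtoℚ (M + suc t) ℚ.* s (suc t)                             ∎
    where
    open ℚ.≤-Reasoning
    M′ t′ x p : ℚ
    M′ = ℕtoℚ M
    t′ = ℕtoℚ t
    x = s t
    p = inv M
    split : ℕtoℚ (suc (M + t)) ≡ 1ℚ ℚ.+ M′ ℚ.+ t′
    split = trans (ℕtoℚ-+ 1 (M + t)) (trans (cong (1ℚ ℚ.+_) (ℕtoℚ-+ M t)) (≡-sym (ℚ.+-assoc 1ℚ M′ t′)))

  -- The case `t = 99 * M` of `amplify-bound`, as `100 * M` unfolds to `M + 99 * M`.
  amplify-99 : (+ 99) / 100 ℚ.≤ s (99 * M)
  amplify-99 = ℚ.*-cancelˡ-≤-pos (ℕtoℚ (100 * M)) {{ℕtoℚ-positive (*-mono-≤ {1} {100} (s≤s z≤n) 0<M)}} (begin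
    ℕtoℚ (100 * M) ℚ.* ((+ 99) / 100)        ≡⟨ cong (ℚ._* ((+ 99) / 100)) (ℕtoℚ-* 100 M) ⟩
    ℕtoℚ 100 ℚ.* ℕtoℚ M ℚ.* ((+ 99) / 100)   ≡⟨ trans (cong (ℚ._* ((+ 99) / 100)) (ℚ.*-comm (ℕtoℚ 100) (ℕtoℚ M))) (ℚ.*-assoc (ℕtoℚ M) (ℕtoℚ 100) _) ⟩
    ℕtoℚ M ℚ.* ℕtoℚ 99                       ≡⟨ trans (ℚ.*-comm (ℕtoℚ M) (ℕtoℚ 99)) (≡-sym (ℕtoℚ-* 99 M)) ⟩
    ℕtoℚ (99 * M)                            ≤⟨ amplify-bound (99 * M) ⟩
    ℕtoℚ (100 * M) ℚ.* s (99 * M)            ∎)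
    where open ℚ.≤-Reasoning

-- The random search

sum-lookup : {A : Set} (xs : List A) (f : A → ℕ) → sum (λ i → f (lookup xs i)) ≡ sumᴸ (map f xs)
sum-lookup [] f = refl
sum-lookup (x ∷ xs) f = cong (λ z → f x + z) (sum-lookup xs f)

sumᴸ-filter : {A : Set} (p : A → Bool) (f : A → ℕ) (xs : List A) →
  sumᴸ (map f (filterᵇ p xs)) ≡ sumᴸ (map (λ x → bit (p x) * f x) xs)
sumᴸ-filter p f [] = refl
sumᴸ-filter p f (x ∷ xs) with p x
... | true = cong₂ _+_ (≡-sym (+-identityʳ (f x))) (sumᴸ-filter p f xs)
... | false = sumᴸ-filter p f xs

sum-lookup-allFin : ∀ {n} (f : Fin n → ℕ) → sum (λ i → f (lookup (allFin n) i)) ≡ sum f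
sum-lookup-allFin {n} f = trans (sum-lookup (allFin n) f) (sumᴸ-tabulate {n} f (λ x → x))

sum-lookup-neighbours : ∀ {n} (G : Graph n) u (f : Fin n → ℕ) →
  sum (λ i → f (lookup (neighbours G u) i)) ≡ sum (λ x → bit (adj G u x) * f x)
sum-lookup-neighbours {n} G u f = trans (sum-lookup (neighbours G u) f)
  (trans (sumᴸ-filter (adj G u) f (allFin n)) (sumᴸ-tabulate {n} _ (λ x → x)))

length-sum : {A : Set} (xs : List A) → length xs ≡ sum (λ (_ : Fin (length xs)) → 1)
length-sum xs = ≡-sym (trans (sum-const (length xs) 1) (*-identityʳ _))

length-allFin : ∀ n → length (allFin n) ≡ n
length-allFin n = trans (length-sum (allFin n)) (trans (sum-lookup-allFin {n} (λ _ → 1)) (trans (sum-const n 1) (*-identityʳ n)))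

length-neighbours : ∀ {n} (G : Graph n) u → length (neighbours G u) ≡ deg G u
length-neighbours {n} G u = trans (length-sum (neighbours G u))
  (trans (sum-lookup-neighbours G u (λ _ → 1)) (sum-cong-≗ {n} λ x → *-identityʳ _))

Likely-uniform : {A : Set} (xs : List A) (hit : A → Bool) → ∀ N → 0 < N → 0 < length xs →
  length xs ≤ N * sum (λ i → bit (hit (lookup xs i))) →
  Likely N (λ m → ∃ λ x → m ≡ just x × hit x ≡ true) (uniform xs)
Likely-uniform (x ∷ xs) hit N 0<N _ many =
  Likely-pick (λ i → just (lookup (x ∷ xs) i)) (λ i → hit (lookup (x ∷ xs) i)) N 0<N (λ i p → _ , refl , p) many

-- A level of at most `b` vertices makes at most `d * b` queries, each successful with probability
-- at least `1 / N`, and the next level has at most `d * b` vertices. All queries are required to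
-- succeed.
loopBound : (N d : ℕ) → ℕ → ℕ → ℕ
loopBound N d zero b = 1
loopBound N d (suc ℓ) b = (N ^ d) ^ b * loopBound N d ℓ (d * b)

0<^ : ∀ {a} → 0 < a → ∀ b → 0 < a ^ b
0<^ {a} p b = m^n>0 a {{>-nonZero p}} b

0<loopBound : ∀ {N} d → 0 < N → ∀ ℓ b → 0 < loopBound N d ℓ b
0<loopBound d 0<N zero b = s≤s z≤n
0<loopBound d 0<N (suc ℓ) b = *-mono-≤ (0<^ (0<^ 0<N d) b) (0<loopBound d 0<N ℓ (d * b))

-- Live u w: the search counts on a query of u returning some x with Target u w x.
module Search {n k : ℕ} (G : Graph n) (ws : List (Fin k)) (N : ℕ) (0<N : 0 < N)
  (Live : Fin n → Fin k → Set) (Target : Fin n → Fin k → Fin n → Set)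
  (one-query : ∀ u w → Likely N (λ m → Live u w → ∃ λ x → m ≡ just x × Target u w x) (randomNeighbour G u)) where

  private
    d : ℕ
    d = length ws

  -- The queries are matched with the entries of `vs` in order, and each has to succeed for its own
  -- entry only.
  queries-likely : ∀ u (vs : List (Fin k)) →
    Likely (N ^ length vs) (λ Γ → length Γ ≤ length vs × (∀ {w} → w ∈ vs → Live u w → ∃ λ x → x ∈ Γ × Target u w x))
      (queries G u (length vs))
  queries-likely u [] = surely (z≤n , λ ()) (inv≤1 1)
  queries-likely u (v ∷ vs) = Likely-bind 0<N (0<^ 0<N (length vs)) (one-query u v) λ
    { nothing h → AtLeast-mono (λ Γ (len , sat) → m≤n⇒m≤1+n len ,
        λ { (here refl) live → skip (h live) ; (there p) live → sat p live }) (queries-likely u vs)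
    ; (just x) h → AtLeast-then (queries-likely u vs) λ Γ (len , sat) →
        surely (s≤s len , λ { (here refl) live → found (h live)
                            ; (there p) live → let (y , q , t) = sat p live in y , there q , t }) ℚ.≤-refl }
    where
    skip : ∀ {B : Set} → (∃ λ x → nothing ≡ just x × Target u v x) → B
    skip (_ , () , _)
    found : ∀ {x Γ} → (∃ λ y → just x ≡ just y × Target u v y) → ∃ λ y → y ∈ x ∷ Γ × Target u v y
    found (y , refl , t) = y , here refl , t

  module _ (complete : ∀ w → w ∈ ws) where

    expand-likely : ∀ lvl → Likely ((N ^ d) ^ length lvl)
      (λ (xs , es) → length xs ≤ d * length lvl ×
        (∀ {u w} → u ∈ lvl → Live u w → ∃ λ x → x ∈ xs × (u , x) ∈ es × Target u w x))
      (expand G d lvl)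
    expand-likely [] = surely (z≤n , λ ()) (inv≤1 1)
    expand-likely (u ∷ us) = Likely-bind (0<^ 0<N d) (0<^ (0<^ 0<N d) (length us)) (queries-likely u ws) λ Γ (len , sat) →
      AtLeast-then (expand-likely us) λ { (xs , es) (len′ , sat′) →
        surely ( ≤-trans (≤-reflexive (length-++ Γ)) (≤-trans (+-mono-≤ len len′) (≤-reflexive (≡-sym (*-suc d (length us)))))
               , λ { (here refl) live → let (x , p , t) = sat (complete _) live in x , ∈-++⁺ˡ p , ∈-++⁺ˡ (∈-map⁺ _ p) , t
                   ; (there q) live → let (x , p , e , t) = sat′ q live in x , ∈-++⁺ʳ Γ p , ∈-++⁺ʳ (map _ Γ) e , t })
          ℚ.≤-refl }

    -- Good ℓ vis r: from the visited vertices on, the outcome r contains ℓ further levels of successful queries.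
    Good : ℕ → List (Fin n) → List (Fin n) × List (Fin n × Fin n) → Set
    Good zero vis r = ∀ {a} → a ∈ vis → a ∈ proj₁ r
    Good (suc ℓ) vis r = ∃ λ vis′ → (∀ {a} → a ∈ vis → a ∈ vis′) ×
      (∀ {a w} → a ∈ vis → Live a w → ∃ λ x → x ∈ vis′ × (a , x) ∈ proj₂ r × Target a w x) × Good ℓ vis′ r

    -- A vertex that is found again is not queried again. So every visited vertex either waits in
    -- the current level or has already had all its live demands met by recorded edges.
    Explored : List (Fin n) → List (Fin n) → List (Fin n × Fin n) → Set
    Explored vis lvl es = ∀ {a} → a ∈ vis →
      a ∈ lvl ⊎ (∀ {w} → Live a w → ∃ λ x → x ∈ vis × (a , x) ∈ es × Target a w x)

    memᵇ-sound : ∀ {x vis} → T (memᵇ G x vis) → x ∈ vis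
    memᵇ-sound {x} {v ∷ vis} t with x ≟ v
    ... | yes e = here e
    ... | no _ = there (memᵇ-sound t)

    ∈-deduplicate : ∀ {x} xs → x ∈ xs → x ∈ deduplicateᵇ (eqᵇ G) xs
    ∈-deduplicate (y ∷ xs) (here refl) = here refl
    ∈-deduplicate {x} (y ∷ xs) (there p) with y ≟ x in e
    ... | yes refl = here refl
    ... | no ¬e = there (∈-filter⁺ (λ z → ¬? (T? (eqᵇ G y z))) (∈-deduplicate xs p) t)
      where
      t : ¬ T (eqᵇ G y x)
      t rewrite e = λ ()

    length-deduplicate : ∀ xs → length (deduplicateᵇ (eqᵇ G) xs) ≤ length xs
    length-deduplicate [] = z≤n
    length-deduplicate (x ∷ xs) = s≤s (≤-trans (length-filter (λ z → ¬? (T? (eqᵇ G x z))) (deduplicateᵇ (eqᵇ G) xs)) (length-deduplicate xs))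

    loop-likely : ∀ ℓ b vis lvl es → length lvl ≤ b → Explored vis lvl es →
      Likely (loopBound N d ℓ b) (λ r → (∀ {e} → e ∈ es → e ∈ proj₂ r) × Good ℓ vis r) (traverseLoop G d ℓ vis lvl es)
    loop-likely zero b vis lvl es _ _ = surely ((λ p → p) , λ p → p) (inv≤1 1)
    loop-likely (suc ℓ) b vis lvl es len inv-es =
      Likely-bind (0<^ (0<^ 0<N d) b) (0<loopBound d 0<N ℓ (d * b))
        (Likely-weaken (0<^ (0<^ 0<N d) (length lvl)) (^-monoʳ-≤ (N ^ d) {{>-nonZero (0<^ 0<N d)}} len) (expand-likely lvl))
        λ { (xs , es′) (len′ , sat) → continue xs es′ len′ sat }
      where
      module _ (xs : List (Fin n)) (es′ : List (Fin n × Fin n)) (len′ : length xs ≤ d * length lvl)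
        (sat : ∀ {u w} → u ∈ lvl → Live u w → ∃ λ x → x ∈ xs × (u , x) ∈ es′ × Target u w x) where
        new : List (Fin n)
        new = filterᵇ (λ x → not (memᵇ G x vis)) (deduplicateᵇ (eqᵇ G) xs)

        kept : ∀ {x} → x ∈ xs → x ∈ vis ++ new
        kept {x} p with memᵇ G x vis in e
        ... | true = ∈-++⁺ˡ (memᵇ-sound {x} {vis} (subst T (≡-sym e) _))
        ... | false = ∈-++⁺ʳ vis (∈-filter⁺ (λ z → T? (not (memᵇ G z vis))) (∈-deduplicate xs p) (subst (T ∘ not) (≡-sym e) _))

        explored : ∀ {a} → a ∈ vis → ∀ {w} → Live a w → ∃ λ x → x ∈ vis ++ new × (a , x) ∈ es ++ es′ × Target a w x
        explored p live with inv-es p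
        ... | inj₁ q = let (x , r , e , t) = sat q live in x , kept r , ∈-++⁺ʳ es e , t
        ... | inj₂ h = let (x , r , e , t) = h live in x , ∈-++⁺ˡ r , ∈-++⁺ˡ e , t

        explored′ : Explored (vis ++ new) new (es ++ es′)
        explored′ p with ∈-++⁻ vis p
        ... | inj₁ q = inj₂ (explored q)
        ... | inj₂ q = inj₁ q

        len-new : length new ≤ d * b
        len-new = ≤-trans (length-filter (λ z → T? (not (memᵇ G z vis))) (deduplicateᵇ (eqᵇ G) xs))
          (≤-trans (length-deduplicate xs) (≤-trans len′ (*-monoʳ-≤ d len)))

        continue : Likely (loopBound N d ℓ (d * b)) (λ r → (∀ {e} → e ∈ es → e ∈ proj₂ r) × Good (suc ℓ) vis r)
          (traverseLoop G d ℓ (vis ++ new) new (es ++ es′))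
        continue = AtLeast-mono (λ r (sub , good) → (λ p → sub (∈-++⁺ˡ p)) ,
            vis ++ new , ∈-++⁺ˡ , (λ p live → let (x , q , e , t) = explored p live in x , q , sub e , t) , good)
          (loop-likely ℓ (d * b) (vis ++ new) new (es ++ es′) len-new explored′)

    Traverse-likely : ∀ v ℓ → Likely (loopBound N d ℓ 1) (Good ℓ (v ∷ [])) (Traverse G v d ℓ)
    Traverse-likely v ℓ = AtLeast-mono (λ _ → proj₂) (loop-likely ℓ 1 (v ∷ []) (v ∷ []) [] ≤-refl inj₁)

-- One-sided error: all recorded edges belong to the graph

Always-bind : {A B : Set} {P : A → Set} {Q : B → Set} {r : Rand A} {f : A → Rand B} →
  Always P r → (∀ a → P a → Always Q (f a)) → Always Q (r >>= f)
Always-bind (leaf p) h = h _ p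
Always-bind (node x) h = node λ i → Always-bind (x i) h

Always-mono : {A : Set} {P Q : A → Set} → (∀ a → P a → Q a) → ∀ {r} → Always P r → Always Q r
Always-mono h (leaf p) = leaf (h _ p)
Always-mono h (node x) = node λ i → Always-mono h (x i)

Always-trivial : {A : Set} (r : Rand A) → Always (λ _ → ⊤) r
Always-trivial (ret a) = leaf _
Always-trivial (pick k f) = node λ i → Always-trivial (f i)

module Soundness {n : ℕ} (G : Graph n) where

  Edges : List (Fin n × Fin n) → Set
  Edges es = ∀ {x y} → (x , y) ∈ es → adj G x y ≡ true

  neighbours-sound : ∀ {u x} → x ∈ neighbours G u → adj G u x ≡ true
  neighbours-sound {u} p = Equivalence.to T-≡ (proj₂ (∈-filter⁻ (λ x → T? (adj G u x)) {xs = allFin n} p))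

  randomNeighbour-sound : ∀ u → Always (λ m → ∀ {x} → m ≡ just x → adj G u x ≡ true) (randomNeighbour G u)
  randomNeighbour-sound u = go (neighbours G u) neighbours-sound
    where
    go : ∀ xs → (∀ {x} → x ∈ xs → adj G u x ≡ true) → Always (λ m → ∀ {x} → m ≡ just x → adj G u x ≡ true) (uniform xs)
    go [] h = leaf λ ()
    go (x ∷ xs) h = node λ i → leaf λ { refl → h (∈-lookup {xs = x ∷ xs} i) }

  queries-sound : ∀ u d → Always (λ Γ → ∀ {x} → x ∈ Γ → adj G u x ≡ true) (queries G u d)
  queries-sound u zero = leaf λ ()
  queries-sound u (suc d) = Always-bind (randomNeighbour-sound u) λ
    { nothing _ → queries-sound u d
    ; (just x) h → Always-bind (queries-sound u d) λ Γ h′ → leaf λ { (here refl) → h refl ; (there p) → h′ p } }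

  ++-Edges : ∀ es {es′} → Edges es → Edges es′ → Edges (es ++ es′)
  ++-Edges es h h′ p with ∈-++⁻ es p
  ... | inj₁ q = h q
  ... | inj₂ q = h′ q

  expand-sound : ∀ d lvl → Always (λ r → Edges (proj₂ r)) (expand G d lvl)
  expand-sound d [] = leaf λ ()
  expand-sound d (u ∷ us) = Always-bind (queries-sound u d) λ Γ h → Always-bind (expand-sound d us) λ
    { (ws , es) h′ → leaf (++-Edges (map _ Γ) (λ p → recorded h (∈-map⁻ _ p)) h′) }
    where
    recorded : ∀ {Γ x y} → (∀ {z} → z ∈ Γ → adj G u z ≡ true) → (∃ λ z → z ∈ Γ × (x , y) ≡ (u , z)) → adj G x y ≡ true
    recorded h (z , q , refl) = h q

  loop-sound : ∀ d ℓ vis lvl es → Edges es → Always (λ r → Edges (proj₂ r)) (traverseLoop G d ℓ vis lvl es)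
  loop-sound d zero vis lvl es h = leaf h
  loop-sound d (suc ℓ) vis lvl es h = Always-bind (expand-sound d lvl) λ { (_ , es′) h′ →
    loop-sound d ℓ _ _ (es ++ es′) (++-Edges es h h′) }

  runs-sound : ∀ t d ℓ → Always (λ rs → ∀ r → r ∈ rs → Edges (proj₂ r)) (RBE-runs G t d ℓ)
  runs-sound zero d ℓ = leaf λ _ ()
  runs-sound (suc t) d ℓ = Always-bind (Always-trivial (uniform (allFin n))) λ
    { nothing _ → leaf λ _ ()
    ; (just v) _ → Always-bind (loop-sound d ℓ (v ∷ []) (v ∷ []) [] λ ()) λ r h →
        Always-bind (runs-sound t d ℓ) λ rs h′ → leaf λ { _ (here refl) → h ; r′ (there p) → h′ r′ p } }

  accepts : (H : Graph k) → Free H G → ∀ t d ℓ → Always (λ runs → ¬ Rejects H runs) (RBE-runs G t d ℓ)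
  accepts H free t d ℓ = Always-mono (λ rs h rej → free (copy h (find rej))) (runs-sound t d ℓ)
    where
    copy : ∀ {rs} → (∀ r → r ∈ rs → Edges (proj₂ r)) → (∃ λ r → r ∈ rs × ContainsCopy H r) → CopyOf H G
    copy h (r , p , φ , inj , _ , edges) = φ , inj , λ i j a → edge (edges i j a)
      where
      edge : ∀ {x y} → (x , y) ∈ proj₂ r ⊎ (y , x) ∈ proj₂ r → adj G x y ≡ true
      edge (inj₁ q) = h r p q
      edge (inj₂ q) = adj-sym G (h r p q)

-- Success of a single run, and repetition

containsCopy? : (H : Graph k) (r : List (Fin n) × List (Fin n × Fin n)) → Dec (ContainsCopy H r)
containsCopy? H (vs , es) = anyFunction? _
  (λ φ → injective? φ ×-dec F.all? (λ i → φ i ∈V? vs) ×-dec F.all? λ i → F.all? λ j →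
    (adj H i j B.≟ true) →-dec (((φ i , φ j) ∈E? es) ⊎-dec ((φ j , φ i) ∈E? es)))
  (λ e (inj , vert , edges) → (λ p → inj (trans (e _) (trans p (≡-sym (e _))))) , (λ i → subst (_∈ vs) (e i) (vert i)) ,
     λ i j a → subst₂ (λ x y → (x , y) ∈ es ⊎ (y , x) ∈ es) (e i) (e j) (edges i j a))
  where
  open DecMembership _≟_ using () renaming (_∈?_ to _∈V?_)
  open DecMembership (≡-dec _≟_ _≟_) using () renaming (_∈?_ to _∈E?_)

rejects? : (H : Graph k) (rs : List (List (Fin n) × List (Fin n × Fin n))) → Dec (Rejects H rs)
rejects? H = any? (containsCopy? H)

count-unique : (V : Fin m → Bool) (b : Bool) → (∀ j → V j ≡ true → b ≡ true) → (∀ i j → V i ≡ true → V j ≡ true → i ≡ j) →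
  count V ≤ bit b
count-unique {zero} V b h u = z≤n
count-unique {suc m} V b h u = byBool (V zero)
  (λ p → ≤-trans (≤-reflexive (cong₂ _+_ (cong bit p) (trans (sum-cong-≗ {m} λ j → cong bit
      (¬true⇒false λ q → F.0≢1+n (u zero (suc j) p q))) (sum-zero m)))) (≤-reflexive (cong bit (≡-sym (h zero p)))))
  (λ p → ≤-trans (≤-reflexive (cong (λ z → bit z + count (V ∘ suc)) p))
      (count-unique (V ∘ suc) b (λ j → h (suc j)) (λ i j p q → F.suc-injective (u (suc i) (suc j) p q))))

count-injective : (U : Fin m → Bool) (e : Fin m → Fin n) (T : Fin n → Bool) → (∀ j → U j ≡ true → T (e j) ≡ true) →
  (∀ i j → U i ≡ true → U j ≡ true → e i ≡ e j → i ≡ j) → count U ≤ count T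
count-injective {m} {n} U e T maps inj = begin
  count U                                            ≡⟨ sum-cong-≗ {m} (λ j → trans (≡-sym (*-identityʳ (bit (U j)))) (cong (bit (U j) *_) (≡-sym (count-single (e j))))) ⟩
  (sum λ j → bit (U j) * sum λ x → [ e j ≐ x ])      ≡⟨ sum-cong-≗ {m} (λ j → *-distribˡ-sum (bit (U j)) (λ x → [ e j ≐ x ])) ⟩
  (sum λ j → sum λ x → bit (U j) * [ e j ≐ x ])      ≡⟨ ∑-comm (λ j x → bit (U j) * [ e j ≐ x ]) ⟩
  (sum λ x → sum λ j → bit (U j) * [ e j ≐ x ])      ≤⟨ sum-mono (λ x → ≤-trans (sum-mono (pointwise x)) (count-unique (fibre x) (T x) (hits x) (unique x))) ⟩
  count T                                            ∎
  where
  open ≤-Reasoning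
  fibre : Fin n → Fin m → Bool
  fibre x = restrict U (λ j → e j ≟ x)
  pointwise : ∀ x j → bit (U j) * [ e j ≐ x ] ≤ bit (fibre x j)
  pointwise x j with U j | does (e j ≟ x)
  ... | true | true = ≤-refl
  ... | true | false = ≤-refl
  ... | false | _ = z≤n
  hits : ∀ x j → fibre x j ≡ true → T x ≡ true
  hits x j p = let (Uj , ej) = restrict-elim U (λ j → e j ≟ x) {j} p in subst (λ y → T y ≡ true) ej (maps j Uj)
  unique : ∀ x i j → fibre x i ≡ true → fibre x j ≡ true → i ≡ j
  unique x i j p q = let (Ui , ei) = restrict-elim U (λ j → e j ≟ x) {i} p
                         (Uj , ej) = restrict-elim U (λ j → e j ≟ x) {j} q
                     in inj i j Ui Uj (trans ei (≡-sym ej))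

module OneRun {n k m : ℕ} (G : Graph n) (H : Graph k) (connected : Connected H)
  (Φ : Fin m → Fin k → Fin n) (hom : ∀ i u w → adj H u w ≡ true → adj G (Φ i u) (Φ i w) ≡ true)
  (disjoint : ∀ i j u w → adj H u w ≡ true → Φ i u ≡ Φ j u → Φ i w ≡ Φ j w → i ≡ j)
  (χ : Fin n → Fin k) (col : ∀ i u → χ (Φ i u) ≡ u)
  (S : Fin m → Bool) (forest : Forest H Φ S (λ _ → true))
  (N : ℕ) (0<N : 0 < N) (popular : ∀ i q → S i ≡ true → deg G (Φ i q) ≤ N * count (through Φ S q (Φ i q))) where

  private
    Live : Fin n → Fin k → Set
    Live u w = ∃ λ i → S i ≡ true × Φ i (χ u) ≡ u × adj H (χ u) w ≡ true

    Target : Fin n → Fin k → Fin n → Set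
    Target u w x = ∃ λ j → S j ≡ true × Φ j (χ u) ≡ u × Φ j w ≡ x

    live? : ∀ u w → Dec (Live u w)
    live? u w = F.any? λ i → (S i B.≟ true) ×-dec (Φ i (χ u) ≟ u) ×-dec (adj H (χ u) w B.≟ true)

    target? : ∀ u w x → Dec (Target u w x)
    target? u w x = F.any? λ j → (S j B.≟ true) ×-dec (Φ j (χ u) ≟ u) ×-dec (Φ j w ≟ x)

    -- Two members through `u` with the same image of `w` share an edge in the same role and hence
    -- coincide. So `u` has at least as many targets as members through it, which by popularity is a
    -- fraction `1 / N` of its degree.
    one-query : ∀ u w → Likely N (λ r → Live u w → ∃ λ x → r ≡ just x × Target u w x) (randomNeighbour G u)
    one-query u w with live? u w
    ... | no dead = AtLeast-all (λ _ live → ⊥-elim (dead live)) _ (inv≤1 N)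
    ... | yes (i , Si , e , a) = AtLeast-mono (λ r (x , p , h) _ → x , p , does-true (target? u w x) h)
      (Likely-uniform (neighbours G u) hit N 0<N nonempty many)
      where
      hit : Fin n → Bool
      hit x = does (target? u w x)
      hit-adj : ∀ x → hit x ≡ true → adj G u x ≡ true
      hit-adj x p = let (j , _ , e′ , e″) = does-true (target? u w x) p in
        subst₂ (λ y z → adj G y z ≡ true) e′ e″ (hom j (χ u) w a)
      nonempty : 0 < length (neighbours G u)
      nonempty = ≤-trans (0<count (adj G u) (Φ i w) (hit-adj _ (dec-true (target? u w _) (i , Si , e , refl))))
        (≤-reflexive (≡-sym (length-neighbours G u)))
      U : Fin m → Bool
      U = through Φ S (χ u) u
      U-elim : ∀ {j} → U j ≡ true → S j ≡ true × Φ j (χ u) ≡ u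
      U-elim {j} = restrict-elim S (λ j → Φ j (χ u) ≟ u) {j}
      U≤hit : count U ≤ count hit
      U≤hit = count-injective U (λ j → Φ j w) hit
        (λ j p → dec-true (target? u w _) (j , proj₁ (U-elim p) , proj₂ (U-elim p) , refl))
        (λ i j p q e → disjoint i j (χ u) w a (trans (proj₂ (U-elim p)) (≡-sym (proj₂ (U-elim q)))) e)
      pointwise : ∀ x → bit (hit x) ≤ bit (adj G u x) * bit (hit x)
      pointwise x = byBool (hit x)
        (λ p → ≤-reflexive (≡-sym (trans (cong (λ b → bit b * bit (hit x)) (hit-adj x p)) (*-identityˡ _))))
        (λ p → ≤-trans (≤-reflexive (cong bit p)) z≤n)
      many : length (neighbours G u) ≤ N * sum (λ i → bit (hit (lookup (neighbours G u) i)))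
      many = begin
        length (neighbours G u)                                ≡⟨ length-neighbours G u ⟩
        deg G u                                                ≡⟨ cong (deg G) e ⟨
        deg G (Φ i (χ u))                                      ≤⟨ popular i (χ u) Si ⟩
        N * count (through Φ S (χ u) (Φ i (χ u)))    ≡⟨ cong (λ a → N * count (through Φ S (χ u) a)) e ⟩
        N * count U                                            ≤⟨ *-monoʳ-≤ N (≤-trans U≤hit (sum-mono pointwise)) ⟩
        N * sum (λ x → bit (adj G u x) * bit (hit x))          ≡⟨ cong (N *_) (sum-lookup-neighbours G u (bit ∘ hit)) ⟨
        N * sum (λ i → bit (hit (lookup (neighbours G u) i)))  ∎
        where open ≤-Reasoning

  open Search G (allFin k) N 0<N Live Target one-query

  private
    module _ (r : List (Fin n) × List (Fin n × Fin n)) where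
      -- The number `b` counts the levels of successful queries after the visited set `vis`, not the
      -- distance from the start; a vertex visited early keeps its answers.
      Found : ℕ → Fin n → Set
      Found b a = ∃ λ vis → a ∈ vis × Good ∈-allFin b vis r

      Found-pred : ∀ {b a} → Found (suc b) a → Found b a
      Found-pred (vis , p , vis′ , sub , _ , good) = vis′ , sub p , good

      Found-vertex : ∀ {b a} → Found b a → a ∈ proj₁ r
      Found-vertex {zero} (vis , p , good) = good p
      Found-vertex {suc b} f = Found-vertex {b} (Found-pred f)

      advance : ∀ {b i} u w → S i ≡ true → Found (suc b) (Φ i u) → adj H u w ≡ true →
        ∃ λ j → S j ≡ true × Φ j u ≡ Φ i u × Found b (Φ j w) × (Φ i u , Φ j w) ∈ proj₂ r
      advance {i = i} u w Si (vis , p , vis′ , _ , succ , good) a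
        with succ p (i , Si , cong (Φ i) (col i u) , trans (cong (λ t → adj H t w) (col i u)) a)
      ... | x , q , e , j , Sj , f , refl = j , Sj , trans (cong (Φ j) (≡-sym (col i u))) f , (vis′ , q , good) , e

      containsCopy : ∀ {u₀ i} → S i ≡ true → Found (k + budget k k) (Φ i u₀) → ContainsCopy H r
      containsCopy {u₀} Si f with Explore.explore-all H Φ S Found (λ x y → (x , y) ∈ proj₂ r) Found-pred advance connected forest u₀ Si f
      ... | ψ , source , edges = ψ , inj , (λ z → let (_ , _ , g) = source z in Found-vertex g) , edges
        where
        color : ∀ z → χ (ψ z) ≡ z
        color z = let (j , e , _) = source z in trans (cong χ e) (col j z)
        inj : Injective _≡_ _≡_ ψ
        inj {x} {y} e = trans (≡-sym (color x)) (trans (cong χ e) (color y))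

  finds-copy : ∀ {i} u₀ → S i ≡ true →
    Likely (loopBound N (length (allFin k)) (k + budget k k) 1) (ContainsCopy H)
      (Traverse G (Φ i u₀) (length (allFin k)) (k + budget k k))
  finds-copy {i} u₀ Si = AtLeast-mono (λ r good → containsCopy r {u₀} Si (Φ i u₀ ∷ [] , here refl , good))
    (Traverse-likely ∈-allFin (Φ i u₀) (k + budget k k))

-- A good start and a good traversal together have probability at least `1 / (N * M)`. A run that
-- fails at either point still leaves the chance `s` of the remaining runs, which is the recursion
-- of `amplify`.
repeated-runs : (G : Graph n) (H : Graph k) (d ℓ N M : ℕ) → 0 < N → 0 < M → 0 < n → (start : Fin n → Bool) → n ≤ N * count start →
  (∀ v → start v ≡ true → Likely M (ContainsCopy H) (Traverse G v d ℓ)) →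
  ∀ t → AtLeast (Rejects H) (RBE-runs G t d ℓ) (amplify (inv (N * M)) t)
repeated-runs G H d ℓ N M 0<N 0<M 0<n start many finds zero = trivially ℚ.≤-refl
repeated-runs {suc n} G H d ℓ N M 0<N 0<M 0<n start many finds (suc t) =
  AtLeast-weaken (ℚ.≤-reflexive (cong (s ℚ.+_) (trans (cong (ℚ._* (1ℚ ℚ.- s)) (inv-* 0<N 0<M)) (ℚ.*-assoc (inv N) (inv M) (1ℚ ℚ.- s)))))
    -- As there is a vertex, `uniform` unfolds to a `pick` and its `just` disappears in the bind, so
    -- the start vertex can be treated as drawn directly.
    (AtLeast-bind {P = λ v → start v ≡ true} {r = pick (length xs) (λ i → ret (lookup (allFin (suc n)) i))}
      (ℚ.nonNeg*nonNeg⇒nonNeg (inv M) {{inv-nonNegative M}} (1ℚ ℚ.- s) {{1-s≥0}})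
      (Likely-pick (lookup (allFin (suc n))) (λ i → start (lookup (allFin (suc n)) i)) N 0<N (λ _ p → p)
        (≤-trans (≤-reflexive (length-allFin (suc n))) (≤-trans many (≤-reflexive (cong (N *_) (≡-sym (sum-lookup-allFin (bit ∘ start))))))))
      (λ v p → AtLeast-bind 1-s≥0 (finds v p)
        (λ r c → AtLeast-weaken (ℚ.≤-reflexive (s+1-s s)) (AtLeast-const (λ rs → surely (here c) ℚ.≤-refl) (RBE-runs G t d ℓ)))
        again)
      (λ v → AtLeast-const again (Traverse G v d ℓ)))
  where
  xs : List (Fin (suc n))
  xs = tabulate suc
  s : ℚ
  s = amplify (inv (N * M)) t
  1-s≥0 : ℚ.NonNegative (1ℚ ℚ.- s)
  1-s≥0 = ℚ.nonNegative (1-amplify (N * M) (*-mono-≤ 0<N 0<M) t)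
  s+1-s : ∀ s → s ℚ.+ (1ℚ ℚ.- s) ≡ 1ℚ
  s+1-s = solve 1 (λ s → s :+ (con 1ℚ :- s) := con 1ℚ) refl
    where open +-*-Solver using (solve; _:+_; _:-_; _:=_; con)
  again : ∀ r → AtLeast (Rejects H) (RBE-runs G t d ℓ >>= λ rs → ret (r ∷ rs)) s
  again r = AtLeast-then (repeated-runs G H d ℓ N M 0<N 0<M 0<n start many finds t) λ rs rej → surely (there rej) ℚ.≤-refl

-- From farness to a large family of copies

inv-denominator≤ : ∀ ε → 0ℚ ℚ.< ε → inv (ℚ.↧ₙ ε) ℚ.≤ ε
inv-denominator≤ ε@(ℚ.mkℚ (+ suc a) d _) 0<ε = ℚ.toℚᵘ-cancel-≤ (begin
  ℚ.toℚᵘ (inv (suc d))       ≃⟨ ℚ.toℚᵘ-fromℚᵘ (ℚᵘ.mkℚᵘ (+ 1) d) ⟩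
  ℚᵘ.mkℚᵘ (+ 1) d            ≤⟨ ℚᵘ.*≤* (ℤ.*-monoʳ-≤-nonNeg (+ suc d) {+ 1} {+ suc a} (ℤ.+≤+ (s≤s z≤n))) ⟩
  ℚᵘ.mkℚᵘ (+ suc a) d        ∎)
  where open ℚᵘ.≤-Reasoning
inv-denominator≤ (ℚ.mkℚ (+ zero) d _) (ℚ.*<* (ℤ.+<+ ()))
inv-denominator≤ (ℚ.mkℚ ℤ.-[1+ a ] d _) (ℚ.*<* ())

Connected⇒0<k : (H : Graph k) → Connected H → 0 < k
Connected⇒0<k H (x , _) = ≤-trans (s≤s z≤n) (F.toℕ<n x)

Far⇒0<n : (H : Graph k) → Connected H → ∀ {ε} (G : Graph n) → Far ε H G → 0 < n
Far⇒0<n {n = suc n} H _ G far = s≤s z≤n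
Far⇒0<n {n = zero} H (x , _) {ε} G far =
  ⊥-elim (ℚ.<-irrefl (ℚ.*-zeroʳ ε) (subst (λ d → ε ℚ.* 0ℚ ℚ.< ℕtoℚ d) (n∸n≡0 (edgeCount G)) (far G (λ _ _ p → p) λ (φ , _) → F.¬Fin0 (φ x))))

-- A positive rational is at least the reciprocal of its denominator, so all later constants depend
-- on `ε` through `↧ₙ ε` alone.
scaled-< : ∀ ε → 0ℚ ℚ.< ε → ∀ {n d} → ε ℚ.* ℕtoℚ n ℚ.< ℕtoℚ d → n < ℚ.↧ₙ ε * d
scaled-< ε 0<ε {n} {d} lt = ℕtoℚ-cancel-< (begin-strict
  ℕtoℚ n                                   ≡⟨ ℚ.*-identityˡ (ℕtoℚ n) ⟨
  1ℚ ℚ.* ℕtoℚ n                            ≡⟨ cong (ℚ._* ℕtoℚ n) (inv-inverse {B} (s≤s z≤n)) ⟨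
  ℕtoℚ B ℚ.* inv B ℚ.* ℕtoℚ n              ≡⟨ ℚ.*-assoc (ℕtoℚ B) (inv B) (ℕtoℚ n) ⟩
  ℕtoℚ B ℚ.* (inv B ℚ.* ℕtoℚ n)            ≤⟨ ℚ.*-monoˡ-≤-nonNeg (ℕtoℚ B) {{ℚ.nonNegative (ℕtoℚ-mono {0} {B} z≤n)}}
                                                (ℚ.*-monoʳ-≤-nonNeg (ℕtoℚ n) {{ℚ.nonNegative (ℕtoℚ-mono {0} {n} z≤n)}} (inv-denominator≤ ε 0<ε)) ⟩
  ℕtoℚ B ℚ.* (ε ℚ.* ℕtoℚ n)                <⟨ ℚ.*-monoʳ-<-pos (ℕtoℚ B) {{ℕtoℚ-positive {B} (s≤s z≤n)}} lt ⟩
  ℕtoℚ B ℚ.* ℕtoℚ d                        ≡⟨ ℕtoℚ-* B d ⟨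
  ℕtoℚ (B * d)                             ∎)
  where
  open ℚ.≤-Reasoning
  B : ℕ
  B = ℚ.↧ₙ ε

-- If the greedy choice stops early, it has deleted at most `m * (k * k)` edges, which farness
-- bounds from below. Otherwise it reaches `n` copies, and these suffice.
Far⇒packing : (H : Graph k) → 0 < k → (G : Graph n) → ∀ B → 0 < B →
  (∀ G′ → G′ ⊆E G → Free H G′ → n ≤ B * (edgeCount G ∸ edgeCount G′)) → ∃ λ m → Packing H G m × n ≤ B * (k * k) * m
Far⇒packing {k} {n} H 0<k G B 0<B far = on (packing H n G)
  where
  on : (∃ λ m → Packing H G m × (m ≡ n ⊎ Σ (Graph n) λ G′ → G′ ⊆E G × Free H G′ × edgeCount G ≤ edgeCount G′ + m * (k * k))) →
    ∃ λ m → Packing H G m × n ≤ B * (k * k) * m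
  on (m , P , inj₁ refl) = m , P , ≤-trans (≤-reflexive (≡-sym (*-identityˡ m))) (*-monoˡ-≤ m (*-mono-≤ 0<B (*-mono-≤ 0<k 0<k)))
  on (m , P , inj₂ (G′ , sub , free , size)) = m , P , (begin
    n                                      ≤⟨ far G′ sub free ⟩
    B * (edgeCount G ∸ edgeCount G′)       ≤⟨ *-monoʳ-≤ B (≤-trans (∸-monoˡ-≤ (edgeCount G′) size) (≤-reflexive (m+n∸m≡n (edgeCount G′) _))) ⟩
    B * (m * (k * k))                      ≡⟨ trans (cong (B *_) (*-comm m (k * k))) (≡-sym (*-assoc B (k * k) m)) ⟩
    B * (k * k) * m                        ∎)
    where open ≤-Reasoning

-- A run starts at a uniformly random vertex, so many copies are of no use if they all share a few
-- vertices. By `distinct`, the images of `s₀` provide as many starting points as `S` has members.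
record Family (H : Graph k) (G : Graph n) (A : ℕ) : Set where
  field
    members  : ℕ
    Φ        : Fin members → Fin k → Fin n
    hom      : ∀ i u w → adj H u w ≡ true → adj G (Φ i u) (Φ i w) ≡ true
    disjoint : ∀ i j u w → adj H u w ≡ true → Φ i u ≡ Φ j u → Φ i w ≡ Φ j w → i ≡ j
    χ        : Fin n → Fin k
    col      : ∀ i u → χ (Φ i u) ≡ u
    S        : Fin members → Bool
    s₀       : Fin k
    distinct : ∀ i j → S i ≡ true → S j ≡ true → Φ i s₀ ≡ Φ j s₀ → i ≡ j
    size     : n ≤ A * count S

count-all : ∀ m → m ≤ count {m} (λ _ → true)
count-all m = ≤-reflexive (≡-sym (trans (sum-const m 1) (*-identityʳ m)))

-- The losses in order: packing, coloring, and one dependency along an edge of `H`.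
familyFactor : (B l k : ℕ) → ℕ
familyFactor B l k = B * (k * k) * k ^ k * depFactor l

1≤familyFactor : ∀ B l {k} → 0 < B → 0 < k → 1 ≤ familyFactor B l k
1≤familyFactor B l {k} 0<B 0<k = *-mono-≤ (*-mono-≤ (*-mono-≤ 0<B (*-mono-≤ 0<k 0<k)) (m^n>0 k {{>-nonZero 0<k}} k)) (s≤s z≤n)

-- `H` is a single vertex here. Deleting edges destroys no copy, and the greedy packing may repeat
-- the same one, so each vertex of `G` is taken as a member instead.
edgeless-family : (H : Graph k) → Connected H → (∀ u w → adj H u w ≢ true) → (G : Graph n) → ∀ {A} → 0 < A → Family H G A
edgeless-family {k} {n} H (x , reach) edgeless G 0<A = record
  { members = n ; Φ = λ i _ → i
  ; hom = λ i u w a → ⊥-elim (edgeless u w a)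
  ; disjoint = λ i j _ _ _ e _ → e
  ; χ = λ _ → x
  ; col = λ i u → single (reach x u)
  ; S = λ _ → true ; s₀ = x ; distinct = λ i j _ _ e → e
  ; size = ≤-trans (≤-reflexive (≡-sym (*-identityˡ n))) (*-mono-≤ 0<A (count-all n)) }
  where
  single : ∀ {P : Fin k → Set} {x y} → Reach H P x y → x ≡ y
  single here = refl
  single (step a _ _) = ⊥-elim (edgeless _ _ a)

-- Of the two ends of an edge of H, one determines the other and hence, by disjointness, the whole copy.
edge-family : (L : Graph l) (H : Graph k) (G : Graph n) → MinorFree L G → 0 < k → ∀ {u₀ w₀} → adj H u₀ w₀ ≡ true →
  ∀ {m} (P : Packing H G m) B → n ≤ B * (k * k) * m → Family H G (familyFactor B l k)
edge-family {l} {k} {n} L H G free 0<k {u₀} {w₀} uw {m} P B n≤ = build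
  (dependency (λ _ → true) (λ x → does (u₀ ≟ x)) u₀ w₀ (dec-true (u₀ ≟ u₀) refl) (dec-false (u₀ ≟ w₀) (adj⇒≢ H uw))
    (λ s p i j _ _ eq → trans (cong (Φ i) (does-true (u₀ ≟ s) p)) (trans eq (cong (Φ j) (≡-sym (does-true (u₀ ≟ s) p)))))
    (λ s t p q → 0 , subst₂ (Walk H (λ x → does (u₀ ≟ x)) 0) (does-true (u₀ ≟ s) p) (does-true (u₀ ≟ t) q) stop)
    (dec-true (u₀ ≟ u₀) refl) uw)
  where
  module P = Packing P
  colored : Σ (Fin n → Fin k) λ χ → Σ (Fin m → Bool) λ S → (∀ i u → S i ≡ true → χ (P.Φ i u) ≡ u) × m ≤ k ^ k * count S
  colored = coloring P.Φ P.inj 0<k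
  χ : Fin n → Fin k
  χ = proj₁ colored
  S₀ : Fin m → Bool
  S₀ = proj₁ (proj₂ colored)
  e : Fin (count S₀) → Fin m
  e = proj₁ (enumerate S₀)
  Φ : Fin (count S₀) → Fin k → Fin n
  Φ i = P.Φ (e i)
  hom : ∀ i u w → adj H u w ≡ true → adj G (Φ i u) (Φ i w) ≡ true
  hom i = P.hom (e i)
  col : ∀ i u → χ (Φ i u) ≡ u
  col i u = proj₁ (proj₂ (proj₂ colored)) (e i) u (proj₁ (proj₂ (enumerate S₀)) i)
  disjoint : ∀ i j u w → adj H u w ≡ true → Φ i u ≡ Φ j u → Φ i w ≡ Φ j w → i ≡ j
  disjoint i j u w a p q = proj₂ (proj₂ (enumerate S₀)) i j (P.disjoint (e i) (e j) u w a p q)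
  open Dependencies L G free H Φ hom χ col using (dependency)
  build : (Σ (Fin (count S₀) → Bool) λ S → S ⊑ (λ _ → true) × (Dep Φ S u₀ w₀ ⊎ Dep Φ S w₀ u₀) ×
      count {count S₀} (λ _ → true) ≤ depFactor l * count S) →
    Family H G (familyFactor B l k)
  build (S , _ , det , size) = record
    { members = count S₀ ; Φ = Φ ; hom = hom ; disjoint = disjoint ; χ = χ ; col = col ; S = S
    ; s₀ = proj₁ (ends det) ; distinct = proj₂ (ends det)
    ; size = ≤-trans n≤ (≤-trans (*-monoʳ-≤ (B * (k * k)) (≤-trans (proj₂ (proj₂ (proj₂ colored)))
          (*-monoʳ-≤ (k ^ k) (≤-trans (count-all (count S₀)) size))))
        (≤-reflexive (assoc (B * (k * k)) (k ^ k) (depFactor l) (count S)))) }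
    where
    assoc : ∀ a b c d → a * (b * (c * d)) ≡ a * b * c * d
    assoc = solve-∀
    ends : Dep Φ S u₀ w₀ ⊎ Dep Φ S w₀ u₀ →
      ∃ λ s → ∀ i j → S i ≡ true → S j ≡ true → Φ i s ≡ Φ j s → i ≡ j
    ends (inj₁ d) = u₀ , λ i j Si Sj eq → disjoint i j u₀ w₀ uw eq (d i j Si Sj eq)
    ends (inj₂ d) = w₀ , λ i j Si Sj eq → disjoint i j u₀ w₀ uw (d i j Si Sj eq) eq

Far⇒Family : (L : Graph l) (H : Graph k) → Connected H → (G : Graph n) → MinorFree L G → ∀ B → 0 < B →
  (∀ G′ → G′ ⊆E G → Free H G′ → n ≤ B * (edgeCount G ∸ edgeCount G′)) → Family H G (familyFactor B l k)
Far⇒Family {l} {k} {n} L H conn G free B 0<B far = on (F.any? (λ u → F.any? (λ w → adj H u w B.≟ true)))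
  where
  0<k : 0 < k
  0<k = Connected⇒0<k H conn
  on : Dec (∃ λ u → ∃ λ w → adj H u w ≡ true) → Family H G (familyFactor B l k)
  on (yes (u , w , uw)) = let (m , P , n≤) = Far⇒packing H 0<k G B 0<B far in edge-family L H G free 0<k uw P B n≤
  on (no edgeless) = edgeless-family H conn (λ u w a → edgeless (u , w , a)) G (1≤familyFactor B l 0<B 0<k)

-- The summand 1 is for the `n / N` members that are to survive the pruning, and
-- `k * cliqueDensity l` pays for the members discarded at the `k` positions.
sampleFactor : (B l k : ℕ) → ℕ
sampleFactor B l k = (1 + k * cliqueDensity l) * (familyFactor B l k * forestFactor l k k)

1≤sampleFactor : ∀ B l {k} → 0 < B → 0 < k → 1 ≤ sampleFactor B l k
1≤sampleFactor B l {k} 0<B 0<k = *-mono-≤ {1} {1 + k * cliqueDensity l} (s≤s z≤n)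
  (*-mono-≤ (1≤familyFactor B l 0<B 0<k) (1≤forestFactor l k k))

depth : ℕ → ℕ
depth k = k + budget k k

module _ (H : Graph k) (conn : Connected H) (G : Graph n) (0<n : 0 < n) {A : ℕ} (𝓕 : Family H G A)
  (N : ℕ) (0<N : 0 < N) (S₁ : Fin (Family.members 𝓕) → Bool) (S₁⊑ : S₁ ⊑ Family.S 𝓕)
  (forest : Forest H (Family.Φ 𝓕) S₁ (λ _ → true)) (enough : n + k * degreeSum G ≤ N * count S₁) where
  private
    module 𝓕 = Family 𝓕

    pruned : Σ (Fin 𝓕.members → Bool) λ S₂ → S₂ ⊑ S₁ × n ≤ N * count S₂ ×
      (∀ i q → S₂ i ≡ true → deg G (𝓕.Φ i q) ≤ N * count (through 𝓕.Φ S₂ q (𝓕.Φ i q)))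
    pruned = prune 𝓕.Φ (deg G) N n S₁ enough

    S₂ : Fin 𝓕.members → Bool
    S₂ = proj₁ pruned

    S₂⊑ : S₂ ⊑ S₁
    S₂⊑ = proj₁ (proj₂ pruned)

    start? : ∀ v → Dec (∃ λ i → S₂ i ≡ true × 𝓕.Φ i 𝓕.s₀ ≡ v)
    start? v = F.any? λ i → (S₂ i B.≟ true) ×-dec (𝓕.Φ i 𝓕.s₀ ≟ v)

    start : Fin n → Bool
    start v = does (start? v)

    S₂≤start : count S₂ ≤ count start
    S₂≤start = count-injective S₂ (λ i → 𝓕.Φ i 𝓕.s₀) start (λ i p → dec-true (start? _) (i , p , refl))
      (λ i j p q → 𝓕.distinct i j (S₁⊑ i (S₂⊑ i p)) (S₁⊑ j (S₂⊑ j q)))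

    finds : ∀ v → (∃ λ i → S₂ i ≡ true × 𝓕.Φ i 𝓕.s₀ ≡ v) →
      Likely (loopBound N (length (allFin k)) (depth k) 1) (ContainsCopy H) (Traverse G v (length (allFin k)) (depth k))
    finds _ (i , Si , refl) = OneRun.finds-copy G H conn 𝓕.Φ 𝓕.hom 𝓕.disjoint 𝓕.χ 𝓕.col S₂ (Forest-⊑ S₂⊑ forest) N 0<N
      (proj₂ (proj₂ (proj₂ pruned))) 𝓕.s₀ Si

  -- The images of `s₀` under the pruned family are the good starting points; `distinct` makes them
  -- at least `n / N` in number. The forest is inherited from `S₁`.
  runs-reject : ∀ t → AtLeast (Rejects H) (RBE-runs G t (length (allFin k)) (depth k))
    (amplify (inv (N * loopBound N (length (allFin k)) (depth k) 1)) t)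
  runs-reject = repeated-runs G H (length (allFin k)) (depth k) N (loopBound N (length (allFin k)) (depth k) 1)
    0<N (0<loopBound (length (allFin k)) 0<N (depth k) 1) 0<n
    start (≤-trans (proj₁ (proj₂ (proj₂ pruned))) (*-monoʳ-≤ N S₂≤start)) (λ v p → finds v (does-true (start? v) p))

far-runs-reject : (L : Graph l) (H : Graph k) → Connected H → (G : Graph n) → 0 < n → MinorFree L G →
  ∀ A → 0 < A → Family H G A → ∀ N → N ≡ (1 + k * cliqueDensity l) * (A * forestFactor l k k) → ∀ t →
  AtLeast (Rejects H) (RBE-runs G t (length (allFin k)) (depth k))
    (amplify (inv (N * loopBound N (length (allFin k)) (depth k) 1)) t)
far-runs-reject {l} {k} {n} L H conn G 0<n free A 0<A 𝓕 N N≡ =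
  let (S₁ , S₁⊑ , forest , size₁) = Forests.forest L G free H 𝓕.Φ 𝓕.hom 𝓕.χ 𝓕.col k 𝓕.S (λ _ → true) (count≤n {k} _)
  in runs-reject H conn G 0<n 𝓕 N 0<N S₁ S₁⊑ forest (enough S₁ size₁)
  where
  module 𝓕 = Family 𝓕
  0<N : 0 < N
  0<N = ≤-trans (*-mono-≤ {1} {1 + k * cliqueDensity l} (s≤s z≤n) (*-mono-≤ 0<A (1≤forestFactor l k k))) (≤-reflexive (≡-sym N≡))
  enough : ∀ S₁ → count 𝓕.S ≤ forestFactor l k k * count S₁ → n + k * degreeSum G ≤ N * count S₁
  enough S₁ size₁ = begin
    n + k * degreeSum G                        ≤⟨ +-monoʳ-≤ n (*-monoʳ-≤ k (MinorFree⇒degreeSum≤ L G free)) ⟩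
    n + k * (cliqueDensity l * n)              ≡⟨ eq n k (cliqueDensity l) ⟩
    (1 + k * cliqueDensity l) * n              ≤⟨ *-monoʳ-≤ (1 + k * cliqueDensity l) (≤-trans 𝓕.size (*-monoʳ-≤ A size₁)) ⟩
    (1 + k * cliqueDensity l) * (A * (forestFactor l k k * count S₁))
                                               ≡⟨ assoc (1 + k * cliqueDensity l) A (forestFactor l k k) (count S₁) ⟩
    (1 + k * cliqueDensity l) * (A * forestFactor l k k) * count S₁
                                               ≡⟨ cong (_* count S₁) N≡ ⟨
    N * count S₁                               ∎
    where
    open ≤-Reasoning
    eq : ∀ n k c → n + k * (c * n) ≡ (1 + k * c) * n
    eq = solve-∀
    assoc : ∀ a b c d → a * (b * (c * d)) ≡ a * (b * c) * d
    assoc = solve-∀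

theorem9p1 : ∀ {l k : ℕ} (L : Graph l) (H : Graph k) → Connected H →
    Σ (ℚ → ℕ) λ f → Σ (ℚ → ℕ) λ g → Σ (ℚ → ℕ) λ h →
    (∀ ε → 0 < f ε) × (∀ ε → 0 < g ε) × (∀ ε → 0 < h ε) ×
    (∀ (ε : ℚ) → Data.Rational._<_ 0ℚ ε → Data.Rational._<_ ε 1ℚ →
    ∀ {n : ℕ} (G : Graph n) → MinorFree L G →
    (Free H G → Always (λ runs → ¬ Rejects H runs) (RBE-runs G (f ε) (h ε) (g ε)))
    × (Far ε H G → ∃ λ q → Mass (Rejects H) (RBE-runs G (f ε) (h ε) (g ε)) q
    × Data.Rational._≤_ ((+ 99) / 100) q))
theorem9p1 {l} {k} L H conn = f , (λ _ → depth k) , (λ _ → length (allFin k)) ,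
  0<f , (λ _ → ≤-trans 0<k (m≤m+n k _)) , (λ _ → ≤-trans 0<k (≤-reflexive (≡-sym (length-allFin k)))) ,
  λ ε 0<ε _ G free → (λ H-free → Soundness.accepts G H H-free (f ε) (length (allFin k)) (depth k)) , λ far →
    rejects G (f ε) ((+ 99) / 100) (amplify-99 (M ε) (0<M ε))
      (far-runs-reject L H conn G (Far⇒0<n H conn {ε} G far) free (A ε) (0<A ε)
        (Far⇒Family L H conn G free (ℚ.↧ₙ ε) (s≤s z≤n) (λ G′ sub free′ → <⇒≤ (scaled-< ε 0<ε (far G′ sub free′))))
        (N ε) refl (f ε))
  where
  0<k : 0 < k
  0<k = Connected⇒0<k H conn
  A N M f : ℚ → ℕ
  A ε = familyFactor (ℚ.↧ₙ ε) l k
  N ε = sampleFactor (ℚ.↧ₙ ε) l k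
  M ε = N ε * loopBound (N ε) (length (allFin k)) (depth k) 1
  -- With success probability at least `1 / M` per run, `99 * M` runs reach `99 / 100`.
  f ε = 99 * M ε
  0<A : ∀ ε → 0 < A ε
  0<A ε = 1≤familyFactor (ℚ.↧ₙ ε) l (s≤s z≤n) 0<k
  0<M : ∀ ε → 0 < M ε
  0<M ε = *-mono-≤ (1≤sampleFactor (ℚ.↧ₙ ε) l (s≤s z≤n) 0<k)
    (0<loopBound (length (allFin k)) (1≤sampleFactor (ℚ.↧ₙ ε) l (s≤s z≤n) 0<k) (depth k) 1)
  0<f : ∀ ε → 0 < f ε
  0<f ε = *-mono-≤ {1} {99} (s≤s z≤n) (0<M ε)
  rejects : ∀ {n} (G : Graph n) t p {s} → p ℚ.≤ s → AtLeast (Rejects H) (RBE-runs G t (length (allFin k)) (depth k)) s →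
    ∃ λ q → Mass (Rejects H) (RBE-runs G t (length (allFin k)) (depth k)) q × p ℚ.≤ q
  rejects G t p p≤s x = let (q , mass) = Mass-exists (rejects? H) (RBE-runs G t (length (allFin k)) (depth k)) in
    q , mass , ℚ.≤-trans p≤s (AtLeast⇒≤Mass x mass)
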